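{- Let $\Gamma$ be a finite flag complex. Then $\Gamma$ is an obstruction to shellability if and only if $\Gamma$ is an obstruction to partitionability, if and only if $\Gamma$ is an obstruction to sequential Cohen-Macaulayness. That is, in the class of flag complexes the three sets of obstructions coincide.
   Context: A simplicial complex $\Gamma$ is a family of subsets (faces) of a finite set closed under taking subsets; $\dim\sigma=|\sigma|-1$, facets are inclusion-maximal faces, $V(\Gamma)$ is the set of vertices. $\Gamma$ is a flag complex if all its minimal non-faces (inclusion-minimal subsets of $V(\Gamma)$ not in $\Gamma$) have size $2$. For $W\subseteq V(\Gamma)$, $\Gamma[W]$ is the subcomplex of faces contained in $W$. $\mathrm{link}_\Gamma(\tau)=\{\eta\in\Gamma:\eta\cap\tau=\emptyset,\ \eta\cup\tau\in\Gamma\}$; $\mathrm{pure}_i(\Gamma)$ is the set of subfaces of $i$-dimensional faces. A sequence of all facets $\sigma_1,\dots,\sigma_t$ is a shelling if for each $j\ge2$, $(\bigcup_{i<j}\overline{\sigma_i})\cap\overline{\sigma_j}$ is pure of dimension $\dim\sigma_j-1$ ($\overline\sigma$ = all subsets of $\sigma$; facets may have different dimensions); $\Gamma$ is shellable if it has a shelling. $\Gamma$ is partitionable if it is a disjoint union of intervals $[\tau_\sigma,\sigma]=\{\eta:\tau_\sigma\subseteq\eta\subseteq\sigma\}$, one per facet $\sigma$. A pure complex is Cohen-Macaulay (over $\mathbb Z$) if $\widetilde H_k(\mathrm{link}_\Gamma(\tau);\mathbb Z)=0$ for all $\tau\in\Gamma$ and $k\neq\dim\mathrm{link}_\Gamma(\tau)$;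 $\Gamma$ is sequentially Cohen-Macaulay if every $\mathrm{pure}_i(\Gamma)$ is Cohen-Macaulay. $\Gamma$ is an obstruction to a property $\mathcal P$ if $\Gamma$ fails $\mathcal P$ but $\Gamma[W]$ satisfies $\mathcal P$ for all $W\subsetneq V(\Gamma)$. -}

module Defs where

open import Data.Nat using (ℕ; zero; suc; _≤_; _<_; _∸_; _<ᵇ_)
open import Data.Integer as ℤ using (ℤ; 0ℤ; 1ℤ; -1ℤ)
open import Data.Fin using (Fin; toℕ)
open import Data.Fin.Subset
  using (Subset; _∈_; _∉_; _⊆_; _⊂_; _∪_; _∩_; ⁅_⁆; ∣_∣; inside; outside)
  renaming (⊥ to ∅)
open import Data.Vec using (Vec; lookup; tabulate)
open import Data.Bool using (Bool; true; false; if_then_else_)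
open import Data.Product using (_×_; ∃; Σ-syntax; ∃-syntax)
open import Relation.Binary.PropositionalEquality using (_≡_; _≢_)
open import Relation.Nullary using (¬_; Dec)

-- Simplicial complexes on the ground set Fin n.
-- A (candidate) family of faces is a predicate on subsets of Fin n.

SC : ℕ → Set₁
SC n = Subset n → Set

IsComplex : ∀ {n} → SC n → Set
IsComplex {n} Γ = Γ ∅ × (∀ (σ τ : Subset n) → τ ⊆ σ → Γ σ → Γ τ)

IsVertex : ∀ {n} → SC n → Fin n → Set
IsVertex Γ v = Γ ⁅ v ⁆

IsFacet : ∀ {n} → SC n → Subset n → Set
IsFacet {n} Γ σ = Γ σ × (∀ (ρ : Subset n) → Γ ρ → σ ⊆ ρ → ρ ≡ σ)

IsFlag : ∀ {n} → SC n → Set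
IsFlag {n} Γ = ∀ (σ : Subset n) →
  (∀ {v} → v ∈ σ → IsVertex Γ v) → ¬ Γ σ →
  (∀ (τ : Subset n) → τ ⊂ σ → Γ τ) → ∣ σ ∣ ≡ 2

Induced : ∀ {n} → SC n → Subset n → SC n
Induced Γ W σ = σ ⊆ W × Γ σ

ProperVertexSubset : ∀ {n} → SC n → Subset n → Set
ProperVertexSubset Γ W =
  (∀ {v} → v ∈ W → IsVertex Γ v) × ∃[ v ] (IsVertex Γ v × v ∉ W)

Obstruction : ∀ {n} → (SC n → Set) → SC n → Set
Obstruction {n} P Γ =
  ¬ P Γ × (∀ (W : Subset n) → ProperVertexSubset Γ W → P (Induced Γ W))

-- Purity. Dimensions are encoded by sizes: a face of dimension d has
-- size d+1.  "Pure of size s" = pure of dimension s-1 (s = 0: {∅}).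

IsPureSize : ∀ {n} → SC n → ℕ → Set
IsPureSize {n} K s =
  ∀ (τ : Subset n) → K τ →
    ∣ τ ∣ ≤ s × ∃[ ρ ] (K ρ × τ ⊆ ρ × ∣ ρ ∣ ≡ s)

-- pure_i(K) with i = s - 1: subfaces of faces of size s
PureSkel : ∀ {n} → SC n → ℕ → SC n
PureSkel K s τ = ∃[ ρ ] (K ρ × τ ⊆ ρ × ∣ ρ ∣ ≡ s)

-- An enumeration σ₀,…,σ_{t-1} of all facets, each exactly once.
-- For j ≥ 1 (i.e. the paper's j ≥ 2): (⋃_{i<j} ‾σᵢ) ∩ ‾σⱼ is pure of
-- dimension dim σⱼ - 1, i.e. of size ∣σⱼ∣ - 1.
EarlierIntersection : ∀ {n t} → (Fin t → Subset n) → Fin t → SC n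
EarlierIntersection f j τ = τ ⊆ f j × ∃[ i ] (toℕ i < toℕ j × τ ⊆ f i)

IsShelling : ∀ {n} → SC n → (t : ℕ) → (Fin t → Subset n) → Set
IsShelling {n} Γ t f =
  (∀ i → IsFacet Γ (f i)) ×
  (∀ i j → f i ≡ f j → i ≡ j) ×
  (∀ (σ : Subset n) → IsFacet Γ σ → ∃[ i ] (f i ≡ σ)) ×
  (∀ j → 1 ≤ toℕ j → IsPureSize (EarlierIntersection f j) (∣ f j ∣ ∸ 1))

Shellable : ∀ {n} → SC n → Set
Shellable {n} Γ = ∃[ t ] Σ[ f ∈ (Fin t → Subset n) ] IsShelling Γ t f

InInterval : ∀ {n} → Subset n → Subset n → Subset n → Set
InInterval τ σ η = τ ⊆ η × η ⊆ σ

Partitionable : ∀ {n} → SC n → Set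
Partitionable {n} Γ = Σ[ r ∈ (Subset n → Subset n) ] (
  (∀ (η : Subset n) → Γ η → ∃[ σ ] (IsFacet Γ σ × InInterval (r σ) σ η)) ×
  (∀ (η σ σ' : Subset n) → IsFacet Γ σ → IsFacet Γ σ' →
     InInterval (r σ) σ η → InInterval (r σ') σ' η → σ ≡ σ'))

-- Reduced simplicial homology with ℤ coefficients.
-- Oriented simplices use the natural order of Fin n.
-- A chain in size-degree m (homological degree m - 1) on K is an
-- integer function on subsets supported on faces of K of size m.

sumFin : ∀ {n} → (Fin n → ℤ) → ℤ
sumFin {zero}  f = 0ℤ
sumFin {suc n} f = f Fin.zero ℤ.+ sumFin (λ i → f (Fin.suc i))
  where import Data.Fin as Fin

below : ∀ {n} → Subset n → Fin n → ℕ
below ρ v = ∣ ρ ∩ tabulate (λ u → toℕ u <ᵇ toℕ v) ∣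

∂ : ∀ {n} → (Subset n → ℤ) → Subset n → ℤ
∂ c ρ = sumFin (λ v → if lookup ρ v then 0ℤ
                      else (-1ℤ ℤ.^ below ρ v) ℤ.* c (ρ ∪ ⁅ v ⁆))

IsChain : ∀ {n} → SC n → ℕ → (Subset n → ℤ) → Set
IsChain {n} K m c = ∀ (σ : Subset n) → c σ ≢ 0ℤ → K σ × ∣ σ ∣ ≡ m

-- H̃_{m-1}(K; ℤ) = 0 : every cycle of size-degree m is a boundary
HomologyVanishes : ∀ {n} → SC n → ℕ → Set
HomologyVanishes {n} K m =
  ∀ (c : Subset n → ℤ) → IsChain K m c → (∀ ρ → ∂ c ρ ≡ 0ℤ) →
    Σ[ d ∈ (Subset n → ℤ) ] (IsChain K (suc m) d × (∀ ρ → ∂ d ρ ≡ c ρ))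

Link : ∀ {n} → SC n → Subset n → SC n
Link K τ η = η ∩ τ ≡ ∅ × K (η ∪ τ)

HasDimSize : ∀ {n} → SC n → ℕ → Set
HasDimSize {n} K s = ∃[ ρ ] (K ρ × ∣ ρ ∣ ≡ s) × (∀ (τ : Subset n) → K τ → ∣ τ ∣ ≤ s)

-- H̃_k(link τ; ℤ) = 0 for every face τ and every k ≠ dim link τ
-- (k ranges over k ≥ -1, i.e. size-degree m = k + 1 ∈ ℕ)
CohenMacaulay : ∀ {n} → SC n → Set
CohenMacaulay {n} K =
  ∀ (τ : Subset n) → K τ → ∀ s → HasDimSize (Link K τ) s →
    ∀ m → m ≢ s → HomologyVanishes (Link K τ) m

SeqCohenMacaulay : ∀ {n} → SC n → Set
SeqCohenMacaulay K = ∀ s → CohenMacaulay (PureSkel K s)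

{-# OPTIONS --safe #-}
module Submission where

-- Let G be the graph of non-edges of the flag complex Γ, so that the faces of Γ are
-- the independent sets of G, and call an induced cycle of G bad if its length is 4 or
-- at least 6.  For each of the three properties P,
--   (1) Γ[W] has P if W contains no bad cycle, and
--   (2) Γ[W] fails P if W is the vertex set of a bad cycle.
-- These two facts determine which induced subcomplexes are obstructions to P, so the
-- three notions of obstruction agree.
--
-- For (1), Γ[W] is vertex decomposable (Woodroofe): an induced P₃ a-b-c that is not the
-- middle of an induced P₅ makes b a shedding vertex, and such a P₃ exists whenever
-- there is an induced P₃ (Chvátal, Rusu and Sritharan).  For (2), consider the faces of
-- maximum size k of the independence complex of a cycle.  For length 2k there are two
-- of them, each meeting no other facet in codimension one; they are disjoint, and they
-- are both forced to have the interval [∅, σ] in a partition.  For length 2k+1 they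
-- form a band around a circle, which carries a nontrivial H₁ in dimension k-1 ≥ 2, and
-- a partition would have to run through the band in one direction and use up all
-- vertices, leaving nothing for ∅.

open import Defs
open import Data.Nat using (ℕ; zero; suc; _+_; _*_; _∸_; _≤_; _<_; z≤n; s≤s; s≤s⁻¹; s<s⁻¹; _≤?_; _<?_; _%_; _/_;
    NonZero; >-nonZero)
open import Data.Nat.Properties
open import Data.Nat.DivMod using (m≡m%n+[m/n]*n; m%n<n; m<n⇒m%n≡m; [m+kn]%n≡m%n; [m+n]%n≡m%n; n%n≡0)
open import Relation.Binary.Definitions using (tri<; tri≈; tri>)
open import Data.Nat.Tactic.RingSolver renaming (solve-∀ to ℕ-solve-∀)
open import Data.Integer as ℤ using (ℤ; 0ℤ; 1ℤ; -1ℤ)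
import Data.Integer.Properties as ℤP
open import Data.Integer.Tactic.RingSolver using (solve-∀)
open import Data.Fin as Fin using (Fin; toℕ; fromℕ<)
import Data.Fin.Properties as FinP
open import Data.Fin.Subset using (Subset; _∈_; _∉_; _⊆_; _∪_; _∩_; _-_; _─_; ⁅_⁆; ∣_∣; inside; outside) renaming
    (⊥ to ∅)
open import Data.Fin.Subset.Properties using
    (_∈?_; _⊆?_; ∉⊥; ⊥⊆; ∣p∣≤n; ∣⊥∣≡0; x∈⁅x⁆; x∈⁅y⁆⇒x≡y; ∣⁅x⁆∣≡1; ⊆-refl; ⊆-antisym; p⊆q⇒∣p∣≤∣q∣; p⊂q⇒∣p∣<∣q∣;
    x∈p∩q⁺; x∈p∩q⁻; p⊆p∪q; q⊆p∪q; x∈p∪q⁻; x∈p∧x≢y⇒x∈p-y; x∈p∧x∉q⇒x∈p─q; x∈p⇒∣p-x∣<∣p∣; p─q⊆p; ∪-comm; ∪-identityˡ;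
    ∪-identityʳ; ∩-zeroˡ; ∩-zeroʳ; nonempty?; Empty-unique; drop-there; p─⊥≡p)
open import Data.Vec using ([]; _∷_; lookup; tabulate; here; there)
open import Data.Vec.Properties using (lookup∘tabulate; []=⇒lookup; lookup⇒[]=; ≡-dec)
open import Data.Bool as Bool using (Bool; true; false; if_then_else_)
open import Data.Product using (_×_; Σ-syntax; ∃-syntax; _,_; proj₁; proj₂; map₂)
open import Data.Sum using (_⊎_; inj₁; inj₂; [_,_]′)
open import Data.Empty using (⊥; ⊥-elim)
open import Relation.Nullary using (¬_; Dec; yes; no; does; contradiction)
open import Relation.Nullary.Decidable using (_×-dec_; _⊎-dec_; ¬?; dec-true; dec-false; decidable-stable; map′)
open import Relation.Binary.PropositionalEquality using
    (_≡_; _≢_; refl; sym; trans; cong; cong₂; subst; subst₂; module ≡-Reasoning)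
open import Function using (_∘_)
open import Function.Bundles using (_⇔_; mk⇔)
open import Algebra.Properties.AbelianGroup ℤP.+-0-abelianGroup using (inverseʳ-unique; identityʳ-unique)

-- Subsets of Fin n and counting

-- The obstructions themselves are never classified: under (1) and (2), being an obstruction to P
-- means that Γ contains a bad cycle and no proper induced subcomplex does, a condition that no
-- longer mentions P. For shellability, (2) is inherited from partitionability. For sequential
-- Cohen-Macaulayness, (1) comes down to one fact about vertex decomposable complexes, acyclicity of
-- each pure skeleton below its top degree, because links in a flag complex are induced again.
--
-- The lengths 3 and 5 are genuine exceptions: the independence complex of a triangle is three
-- points, that of a 5-cycle is again a 5-cycle, and both are shellable. In the second the H₁ class
-- sits in the top degree.
--
-- Homology groups are never computed. A class is seen to be nonzero by pairing it with an integer
-- cochain that is a cocycle on the pure skeleton spanned by the maximum faces.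

⟦_⟧ : ∀ {n} {P : Fin n → Set} → (∀ x → Dec (P x)) → Subset n
⟦ P? ⟧ = tabulate (λ x → does (P? x))

module _ {n} {P : Fin n → Set} (P? : ∀ x → Dec (P x)) where

  ∈⟦⟧⁺ : ∀ {x} → P x → x ∈ ⟦ P? ⟧
  ∈⟦⟧⁺ {x} px = lookup⇒[]= x _ (trans (lookup∘tabulate _ x) (dec-true (P? x) px))

  ∈⟦⟧⁻ : ∀ {x} → x ∈ ⟦ P? ⟧ → P x
  ∈⟦⟧⁻ {x} x∈ with P? x | trans (sym (lookup∘tabulate (λ x → does (P? x)) x)) ([]=⇒lookup x∈)
  ... | yes px | _ = px
  ... | no _ | ()

_≟ₛ_ : ∀ {n} (σ τ : Subset n) → Dec (σ ≡ τ)
_≟ₛ_ = ≡-dec Bool._≟_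

x∉p-x : ∀ {n} (p : Subset n) {x} → x ∉ p - x
x∉p-x (s ∷ p) {Fin.suc x} (there h) = x∉p-x p h
x∉p-x (s ∷ p) {Fin.zero} ()

x∈p-y⁻ : ∀ {n} (p : Subset n) {x y} → x ∈ p - y → x ∈ p × x ≢ y
x∈p-y⁻ p {x} {y} h = p─q⊆p p ⁅ y ⁆ h , λ { refl → x∉p-x p h }

x∈p∪⁅y⁆⁻ : ∀ {n} (p : Subset n) {x y} → x ∈ p ∪ ⁅ y ⁆ → x ∈ p ⊎ x ≡ y
x∈p∪⁅y⁆⁻ p {x} {y} h with x∈p∪q⁻ p ⁅ y ⁆ h
... | inj₁ a = inj₁ a
... | inj₂ b = inj₂ (x∈⁅y⁆⇒x≡y y b)

p⊆p∪⁅x⁆ : ∀ {n} {p : Subset n} {x} → p ⊆ p ∪ ⁅ x ⁆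
p⊆p∪⁅x⁆ {x = x} = p⊆p∪q ⁅ x ⁆

x∈p∪⁅x⁆ : ∀ {n} (p : Subset n) {x} → x ∈ p ∪ ⁅ x ⁆
x∈p∪⁅x⁆ p {x} = q⊆p∪q p ⁅ x ⁆ (x∈⁅x⁆ x)

∪⁅⁆-⊆ : ∀ {n} {p q : Subset n} {x} → p ⊆ q → x ∈ q → p ∪ ⁅ x ⁆ ⊆ q
∪⁅⁆-⊆ {p = p} p⊆q x∈q h with x∈p∪⁅y⁆⁻ p h
... | inj₁ a = p⊆q a
... | inj₂ refl = x∈q

∪⁅⁆-mono : ∀ {n} {p q : Subset n} {x} → p ⊆ q → p ∪ ⁅ x ⁆ ⊆ q ∪ ⁅ x ⁆
∪⁅⁆-mono {q = q} p⊆q = ∪⁅⁆-⊆ (p⊆p∪⁅x⁆ ∘ p⊆q) (x∈p∪⁅x⁆ q)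

p-x∪⁅x⁆≡p : ∀ {n} {p : Subset n} {x} → x ∈ p → (p - x) ∪ ⁅ x ⁆ ≡ p
p-x∪⁅x⁆≡p {p = p} {x} x∈p = ⊆-antisym (∪⁅⁆-⊆ (p─q⊆p p ⁅ x ⁆) x∈p) back
  where
  back : p ⊆ (p - x) ∪ ⁅ x ⁆
  back {y} y∈p with y Fin.≟ x
  ... | yes refl = x∈p∪⁅x⁆ (p - x)
  ... | no y≢x = p⊆p∪⁅x⁆ (x∈p∧x≢y⇒x∈p-y y∈p y≢x)

p∪⁅x⁆-x≡p : ∀ {n} {p : Subset n} {x} → x ∉ p → (p ∪ ⁅ x ⁆) - x ≡ p
p∪⁅x⁆-x≡p {p = p} {x} x∉p = ⊆-antisym fwd back
  where
  fwd : (p ∪ ⁅ x ⁆) - x ⊆ p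
  fwd h with x∈p-y⁻ (p ∪ ⁅ x ⁆) h
  ... | a , y≢x with x∈p∪⁅y⁆⁻ p a
  ... | inj₁ b = b
  ... | inj₂ e = contradiction e y≢x
  back : p ⊆ (p ∪ ⁅ x ⁆) - x
  back {y} y∈p = x∈p∧x≢y⇒x∈p-y (p⊆p∪⁅x⁆ y∈p) λ { refl → x∉p y∈p }

∣p∪⁅x⁆∣ : ∀ {n} (p : Subset n) {x} → x ∉ p → ∣ p ∪ ⁅ x ⁆ ∣ ≡ suc ∣ p ∣
∣p∪⁅x⁆∣ (inside ∷ p) {Fin.zero} h = contradiction here h
∣p∪⁅x⁆∣ (outside ∷ p) {Fin.zero} h = cong (suc ∘ ∣_∣) (∪-identityʳ p)
∣p∪⁅x⁆∣ (inside ∷ p) {Fin.suc x} h = cong suc (∣p∪⁅x⁆∣ p (h ∘ there))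
∣p∪⁅x⁆∣ (outside ∷ p) {Fin.suc x} h = ∣p∪⁅x⁆∣ p (h ∘ there)

∣p∣≡1+∣p-x∣ : ∀ {n} (p : Subset n) {x} → x ∈ p → ∣ p ∣ ≡ suc ∣ p - x ∣
∣p∣≡1+∣p-x∣ p {x} x∈p = trans (cong ∣_∣ (sym (p-x∪⁅x⁆≡p x∈p))) (∣p∪⁅x⁆∣ (p - x) (x∉p-x p))

⊈⇒∃ : ∀ {n} (p q : Subset n) → ¬ (q ⊆ p) → ∃[ x ] (x ∈ q × x ∉ p)
⊈⇒∃ p q q⊈p with FinP.any? (λ x → (x ∈? q) ×-dec ¬? (x ∈? p))
... | yes w = w
... | no ¬w = contradiction (λ {x} x∈q → decidable-stable (x ∈? p) (λ x∉p → ¬w (x , x∈q , x∉p))) q⊈p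

∣p∣<∣q∣⇒∃ : ∀ {n} (p q : Subset n) → ∣ p ∣ < ∣ q ∣ → ∃[ x ] (x ∈ q × x ∉ p)
∣p∣<∣q∣⇒∃ p q lt = ⊈⇒∃ p q λ q⊆p → <⇒≱ lt (p⊆q⇒∣p∣≤∣q∣ q⊆p)

⊆∧∣∣≡⇒≡ : ∀ {n} {p q : Subset n} → p ⊆ q → ∣ q ∣ ≤ ∣ p ∣ → p ≡ q
⊆∧∣∣≡⇒≡ {p = p} {q} p⊆q ge with q ⊆? p
... | yes q⊆p = ⊆-antisym p⊆q q⊆p
... | no q⊈p = contradiction (p⊂q⇒∣p∣<∣q∣ (p⊆q , ⊈⇒∃ p q q⊈p)) (≤⇒≯ ge)

-- Enumerated subsets, and counting by classes

imgs : ∀ {n} → (ℕ → Fin n) → ℕ → Subset n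
imgs f zero = ∅
imgs f (suc t) = imgs f t ∪ ⁅ f t ⁆

∈imgs⁺ : ∀ {n} (f : ℕ → Fin n) {t i} → i < t → f i ∈ imgs f t
∈imgs⁺ f {suc t} {i} i<t with m<1+n⇒m<n∨m≡n i<t
... | inj₁ lt = p⊆p∪⁅x⁆ (∈imgs⁺ f lt)
... | inj₂ refl = x∈p∪⁅x⁆ (imgs f t)

∈imgs⁻ : ∀ {n} (f : ℕ → Fin n) t {x} → x ∈ imgs f t → ∃[ i ] (i < t × x ≡ f i)
∈imgs⁻ f zero h = contradiction h ∉⊥
∈imgs⁻ f (suc t) h with x∈p∪⁅y⁆⁻ (imgs f t) h
... | inj₂ e = t , ≤-refl , e
... | inj₁ h′ with ∈imgs⁻ f t h′
... | i , lt , e = i , m<n⇒m<1+n lt , e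

∣imgs∣ : ∀ {n} (f : ℕ → Fin n) t → (∀ i j → i < j → j < t → f i ≢ f j) → ∣ imgs f t ∣ ≡ t
∣imgs∣ {n} f zero _ = ∣⊥∣≡0 n
∣imgs∣ f (suc t) inj = trans (∣p∪⁅x⁆∣ (imgs f t) fresh) (cong suc (∣imgs∣ f t λ i j a b → inj i j a (m<n⇒m<1+n b)))
  where
  fresh : f t ∉ imgs f t
  fresh h with ∈imgs⁻ f t h
  ... | i , lt , e = inj i t lt ≤-refl (sym e)

module _ {n} (R : Fin n → ℕ → Set) (R? : ∀ x j → Dec (R x j)) where

  Hit : Subset n → ℕ → Set
  Hit ρ j = ∃[ x ] (x ∈ ρ × R x j)

  hit? : ∀ ρ j → Dec (Hit ρ j)
  hit? ρ j = FinP.any? (λ x → (x ∈? ρ) ×-dec R? x j)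

  Covered : Subset n → ℕ → Set
  Covered ρ t = ∀ {x} → x ∈ ρ → ∃[ j ] (j < t × R x j)

  Separated : Subset n → Set
  Separated ρ = ∀ {x y} j → x ∈ ρ → y ∈ ρ → R x j → R y j → x ≡ y

  covered-unhit : ∀ {ρ t} → Covered ρ (suc t) → ¬ Hit ρ t → Covered ρ t
  covered-unhit cov ¬h x∈ρ with cov x∈ρ
  ... | j , j<1+t , r with m<1+n⇒m<n∨m≡n j<1+t
  ... | inj₁ lt = j , lt , r
  ... | inj₂ refl = contradiction (_ , x∈ρ , r) ¬h

  covered-hit : ∀ {ρ t} → Covered ρ (suc t) → Separated ρ → (h : Hit ρ t) → Covered (ρ - proj₁ h) t
  covered-hit {ρ} cov sep (x , x∈ρ , rx) {y} y∈ with x∈p-y⁻ ρ y∈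
  ... | y∈ρ , y≢x with cov y∈ρ
  ... | j , j<1+t , r with m<1+n⇒m<n∨m≡n j<1+t
  ... | inj₁ lt = j , lt , r
  ... | inj₂ refl = contradiction (sep j y∈ρ x∈ρ r rx) y≢x

  separated-⊆ : ∀ {ρ τ} → τ ⊆ ρ → Separated ρ → Separated τ
  separated-⊆ τ⊆ρ sep j a b = sep j (τ⊆ρ a) (τ⊆ρ b)

  ∣∣≤classes : ∀ t ρ → Covered ρ t → Separated ρ → ∣ ρ ∣ ≤ t
  ∣∣≤classes zero ρ cov sep with nonempty? ρ
  ... | yes (x , x∈ρ) = contradiction (proj₁ (proj₂ (cov x∈ρ))) λ ()
  ... | no e = ≤-reflexive (trans (cong ∣_∣ (Empty-unique e)) (∣⊥∣≡0 n))
  ∣∣≤classes (suc t) ρ cov sep with hit? ρ t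
  ... | no ¬h = m≤n⇒m≤1+n (∣∣≤classes t ρ (covered-unhit cov ¬h) sep)
  ... | yes h@(x , x∈ρ , _) = subst (_≤ suc t) (sym (∣p∣≡1+∣p-x∣ ρ x∈ρ))
    (s≤s (∣∣≤classes t (ρ - x) (covered-hit cov sep h) (separated-⊆ (p─q⊆p ρ ⁅ x ⁆) sep)))

  -- An unhit class would leave fewer classes than elements. The classes used below are pairs of
  -- adjacent vertices of a cycle.
  all-hit : ∀ t ρ → Covered ρ t → Separated ρ → t ≤ ∣ ρ ∣ → ∀ {j} → j < t → Hit ρ j
  all-hit (suc t) ρ cov sep t≤ {j} j<1+t with hit? ρ t
  ... | no ¬h = contradiction (≤-trans t≤ (∣∣≤classes t ρ (covered-unhit cov ¬h) sep)) 1+n≰n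
  ... | yes h@(x , x∈ρ , _) with m<1+n⇒m<n∨m≡n j<1+t
  ... | inj₂ refl = h
  ... | inj₁ lt with all-hit t (ρ - x) (covered-hit cov sep h) (separated-⊆ (p─q⊆p ρ ⁅ x ⁆) sep)
                     (s≤s⁻¹ (subst (suc t ≤_) (∣p∣≡1+∣p-x∣ ρ x∈ρ) t≤)) lt
  ... | y , y∈ , r = y , proj₁ (x∈p-y⁻ ρ y∈) , r

-- Chains

Chain : ℕ → Set
Chain n = Subset n → ℤ

sumFin-cong : ∀ {n} {f g : Fin n → ℤ} → (∀ i → f i ≡ g i) → sumFin f ≡ sumFin g
sumFin-cong {zero} eq = refl
sumFin-cong {suc n} eq = cong₂ ℤ._+_ (eq Fin.zero) (sumFin-cong (eq ∘ Fin.suc))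

sumFin-0 : ∀ n → sumFin {n} (λ _ → 0ℤ) ≡ 0ℤ
sumFin-0 zero = refl
sumFin-0 (suc n) = trans (ℤP.+-identityˡ _) (sumFin-0 n)

interchange : ∀ a b c d → (a ℤ.+ b) ℤ.+ (c ℤ.+ d) ≡ (a ℤ.+ c) ℤ.+ (b ℤ.+ d)
interchange = solve-∀

sumFin-+ : ∀ {n} (f g : Fin n → ℤ) → sumFin (λ i → f i ℤ.+ g i) ≡ sumFin f ℤ.+ sumFin g
sumFin-+ {zero} f g = refl
sumFin-+ {suc n} f g = trans (cong (λ z → (f Fin.zero ℤ.+ g Fin.zero) ℤ.+ z) (sumFin-+ (f ∘ Fin.suc) (g ∘ Fin.suc)))
  (interchange (f Fin.zero) (g Fin.zero) _ _)

sumFin-* : ∀ {n} (k : ℤ) (f : Fin n → ℤ) → sumFin (λ i → k ℤ.* f i) ≡ k ℤ.* sumFin f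
sumFin-* {zero} k f = sym (ℤP.*-zeroʳ k)
sumFin-* {suc n} k f = trans (cong (λ z → (k ℤ.* f Fin.zero) ℤ.+ z) (sumFin-* k (f ∘ Fin.suc)))
  (sym (ℤP.*-distribˡ-+ k (f Fin.zero) _))

sumFin-neg : ∀ {n} (f : Fin n → ℤ) → sumFin (λ i → ℤ.- f i) ≡ ℤ.- sumFin f
sumFin-neg {zero} f = refl
sumFin-neg {suc n} f = trans (cong (λ z → (ℤ.- f Fin.zero) ℤ.+ z) (sumFin-neg (f ∘ Fin.suc)))
  (sym (ℤP.neg-distrib-+ (f Fin.zero) _))

sumFin-swap : ∀ {m n} (f : Fin m → Fin n → ℤ) →
  sumFin (λ i → sumFin (f i)) ≡ sumFin (λ j → sumFin (λ i → f i j))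
sumFin-swap {zero} {n} f = sym (sumFin-0 n)
sumFin-swap {suc m} f = trans (cong (λ z → sumFin (f Fin.zero) ℤ.+ z) (sumFin-swap (f ∘ Fin.suc)))
  (sym (sumFin-+ (f Fin.zero) (λ j → sumFin (λ i → f (Fin.suc i) j))))

-- Chains form the exterior algebra on the ground set.  In the recursion below a
-- chain on Fin (1+n) is a pair of chains, off and on the vertex 0; this makes the
-- sign rules of the boundary, the contraction ι v and the product ε v = v ∧ _
-- provable by induction, without computing positions.

∂′ : ∀ {n} → Chain n → Chain n
∂′ c [] = 0ℤ
∂′ c (outside ∷ ρ) = c (inside ∷ ρ) ℤ.+ ∂′ (c ∘ (outside ∷_)) ρ
∂′ c (inside ∷ ρ) = ℤ.- ∂′ (c ∘ (inside ∷_)) ρ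

ι : ∀ {n} → Fin n → Chain n → Chain n
ι Fin.zero c (outside ∷ ρ) = c (inside ∷ ρ)
ι Fin.zero c (inside ∷ ρ) = 0ℤ
ι (Fin.suc v) c (outside ∷ ρ) = ι v (c ∘ (outside ∷_)) ρ
ι (Fin.suc v) c (inside ∷ ρ) = ℤ.- ι v (c ∘ (inside ∷_)) ρ

ε : ∀ {n} → Fin n → Chain n → Chain n
ε Fin.zero c (outside ∷ ρ) = 0ℤ
ε Fin.zero c (inside ∷ ρ) = c (outside ∷ ρ)
ε (Fin.suc v) c (outside ∷ ρ) = ε v (c ∘ (outside ∷_)) ρ
ε (Fin.suc v) c (inside ∷ ρ) = ℤ.- ε v (c ∘ (inside ∷_)) ρ

-- A vertex 0 inside the face raises every count `below` by one, which is the sign in the last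
-- clause of `∂′`. If it is outside, the term that adds it has sign +1.
∂≡∂′ : ∀ {n} (c : Chain n) ρ → ∂ c ρ ≡ ∂′ c ρ
∂≡∂′ c [] = refl
∂≡∂′ c (outside ∷ ρ) = cong₂ ℤ._+_
  (trans (cong₂ (λ k σ → (-1ℤ ℤ.^ k) ℤ.* c (inside ∷ σ)) (∣∩false∣ ρ) (∪-identityʳ ρ)) (ℤP.*-identityˡ _))
  (∂≡∂′ (c ∘ (outside ∷_)) ρ)
  where
  ∣∩false∣ : ∀ {n} (σ : Subset n) → ∣ σ ∩ tabulate (λ _ → false) ∣ ≡ 0
  ∣∩false∣ [] = refl
  ∣∩false∣ (inside ∷ σ) = ∣∩false∣ σ
  ∣∩false∣ (outside ∷ σ) = ∣∩false∣ σ
∂≡∂′ {suc n} c (inside ∷ ρ) = begin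
  0ℤ ℤ.+ sumFin (λ v → if lookup ρ v then 0ℤ else (-1ℤ ℤ.^ suc (below ρ v)) ℤ.* c′ (ρ ∪ ⁅ v ⁆)) ≡⟨ ℤP.+-identityˡ _ ⟩
  sumFin (λ v → if lookup ρ v then 0ℤ else (-1ℤ ℤ.^ suc (below ρ v)) ℤ.* c′ (ρ ∪ ⁅ v ⁆)) ≡⟨ sumFin-cong
      (λ v → negate (lookup ρ v) (-1ℤ ℤ.^ below ρ v) (c′ (ρ ∪ ⁅ v ⁆))) ⟩
  sumFin (λ v → ℤ.- (if lookup ρ v then 0ℤ else (-1ℤ ℤ.^ below ρ v) ℤ.* c′ (ρ ∪ ⁅ v ⁆))) ≡⟨ sumFin-neg
      (λ v → if lookup ρ v then 0ℤ else (-1ℤ ℤ.^ below ρ v) ℤ.* c′ (ρ ∪ ⁅ v ⁆)) ⟩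
  ℤ.- ∂ c′ ρ ≡⟨ cong ℤ.-_ (∂≡∂′ c′ ρ) ⟩
  ℤ.- ∂′ c′ ρ ∎
  where
  open ≡-Reasoning
  c′ : Chain n
  c′ = c ∘ (inside ∷_)
  negate : ∀ (b : Bool) (s a : ℤ) → (if b then 0ℤ else (-1ℤ ℤ.* s) ℤ.* a) ≡ ℤ.- (if b then 0ℤ else s ℤ.* a)
  negate true s a = refl
  negate false s a = trans (cong (ℤ._* a) (ℤP.-1*i≡-i s)) (sym (ℤP.neg-distribˡ-* s a))

-- Chains are compared pointwise, so respecting pointwise equality is a field of its own. Zero,
-- negatives and differences follow from additivity.
record Linear {n} (T : Chain n → Chain n) : Set where
  field
    ≗-cong : ∀ {c d} → (∀ ρ → c ρ ≡ d ρ) → ∀ ρ → T c ρ ≡ T d ρ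
    additive : ∀ c d ρ → T (λ σ → c σ ℤ.+ d σ) ρ ≡ T c ρ ℤ.+ T d ρ

  zero-map : ∀ ρ → T (λ _ → 0ℤ) ρ ≡ 0ℤ
  zero-map ρ = identityʳ-unique (T (λ _ → 0ℤ) ρ) _ (sym (additive (λ _ → 0ℤ) (λ _ → 0ℤ) ρ))

  negative : ∀ c ρ → T (λ σ → ℤ.- c σ) ρ ≡ ℤ.- T c ρ
  negative c ρ = inverseʳ-unique (T c ρ) _
    (trans (sym (additive c (λ σ → ℤ.- c σ) ρ)) (trans (≗-cong (λ σ → ℤP.+-inverseʳ (c σ)) ρ) (zero-map ρ)))

  subtractive : ∀ c d ρ → T (λ σ → c σ ℤ.- d σ) ρ ≡ T c ρ ℤ.- T d ρ
  subtractive c d ρ = trans (additive c (λ σ → ℤ.- d σ) ρ) (cong (λ z → T c ρ ℤ.+ z) (negative d ρ))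

open Linear

∂′-linear : ∀ {n} → Linear (∂′ {n})
∂′-linear .≗-cong = go
  where
  go : ∀ {n} {c d : Chain n} → (∀ ρ → c ρ ≡ d ρ) → ∀ ρ → ∂′ c ρ ≡ ∂′ d ρ
  go eq [] = refl
  go eq (outside ∷ ρ) = cong₂ ℤ._+_ (eq _) (go (eq ∘ (outside ∷_)) ρ)
  go eq (inside ∷ ρ) = cong ℤ.-_ (go (eq ∘ (inside ∷_)) ρ)
∂′-linear .additive = go
  where
  go : ∀ {n} (c d : Chain n) ρ → ∂′ (λ σ → c σ ℤ.+ d σ) ρ ≡ ∂′ c ρ ℤ.+ ∂′ d ρ
  go c d [] = refl
  go c d (outside ∷ ρ) = trans (cong (λ z → (c (inside ∷ ρ) ℤ.+ d (inside ∷ ρ)) ℤ.+ z)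
      (go (c ∘ (outside ∷_)) (d ∘ (outside ∷_)) ρ))
    (interchange (c (inside ∷ ρ)) (d (inside ∷ ρ)) _ _)
  go c d (inside ∷ ρ) = trans (cong ℤ.-_ (go (c ∘ (inside ∷_)) (d ∘ (inside ∷_)) ρ))
      (ℤP.neg-distrib-+ (∂′ (c ∘ (inside ∷_)) ρ) _)

ι-linear : ∀ {n} (v : Fin n) → Linear (ι v)
ι-linear v .≗-cong = go v
  where
  go : ∀ {n} (v : Fin n) {c d : Chain n} → (∀ ρ → c ρ ≡ d ρ) → ∀ ρ → ι v c ρ ≡ ι v d ρ
  go Fin.zero eq (outside ∷ ρ) = eq _
  go Fin.zero eq (inside ∷ ρ) = refl
  go (Fin.suc v) eq (outside ∷ ρ) = go v (eq ∘ (outside ∷_)) ρ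
  go (Fin.suc v) eq (inside ∷ ρ) = cong ℤ.-_ (go v (eq ∘ (inside ∷_)) ρ)
ι-linear v .additive = go v
  where
  go : ∀ {n} (v : Fin n) (c d : Chain n) ρ → ι v (λ σ → c σ ℤ.+ d σ) ρ ≡ ι v c ρ ℤ.+ ι v d ρ
  go Fin.zero c d (outside ∷ ρ) = refl
  go Fin.zero c d (inside ∷ ρ) = refl
  go (Fin.suc v) c d (outside ∷ ρ) = go v (c ∘ (outside ∷_)) (d ∘ (outside ∷_)) ρ
  go (Fin.suc v) c d (inside ∷ ρ) = trans (cong ℤ.-_ (go v (c ∘ (inside ∷_)) (d ∘ (inside ∷_)) ρ))
      (ℤP.neg-distrib-+ (ι v (c ∘ (inside ∷_)) ρ) _)

ε-linear : ∀ {n} (v : Fin n) → Linear (ε v)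
ε-linear v .≗-cong = go v
  where
  go : ∀ {n} (v : Fin n) {c d : Chain n} → (∀ ρ → c ρ ≡ d ρ) → ∀ ρ → ε v c ρ ≡ ε v d ρ
  go Fin.zero eq (outside ∷ ρ) = refl
  go Fin.zero eq (inside ∷ ρ) = eq _
  go (Fin.suc v) eq (outside ∷ ρ) = go v (eq ∘ (outside ∷_)) ρ
  go (Fin.suc v) eq (inside ∷ ρ) = cong ℤ.-_ (go v (eq ∘ (inside ∷_)) ρ)
ε-linear v .additive = go v
  where
  go : ∀ {n} (v : Fin n) (c d : Chain n) ρ → ε v (λ σ → c σ ℤ.+ d σ) ρ ≡ ε v c ρ ℤ.+ ε v d ρ
  go Fin.zero c d (outside ∷ ρ) = refl
  go Fin.zero c d (inside ∷ ρ) = refl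
  go (Fin.suc v) c d (outside ∷ ρ) = go v (c ∘ (outside ∷_)) (d ∘ (outside ∷_)) ρ
  go (Fin.suc v) c d (inside ∷ ρ) = trans (cong ℤ.-_ (go v (c ∘ (inside ∷_)) (d ∘ (inside ∷_)) ρ))
      (ℤP.neg-distrib-+ (ε v (c ∘ (inside ∷_)) ρ) _)

-- `∂′` is the sum of the contractions over all vertices, and contractions anticommute.
∂′-ι : ∀ {n} (v : Fin n) c ρ → ∂′ (ι v c) ρ ≡ ℤ.- ι v (∂′ c) ρ
∂′-ι Fin.zero c (outside ∷ ρ) = trans (ℤP.+-identityˡ _) (sym (ℤP.neg-involutive _))
∂′-ι Fin.zero c (inside ∷ ρ) = cong ℤ.-_ (zero-map ∂′-linear ρ)
∂′-ι (Fin.suc v) c (outside ∷ ρ) = begin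
  ℤ.- ι v c₁ ρ ℤ.+ ∂′ (ι v c₀) ρ ≡⟨ cong (λ z → ℤ.- ι v c₁ ρ ℤ.+ z) (∂′-ι v c₀ ρ) ⟩
  ℤ.- ι v c₁ ρ ℤ.+ ℤ.- ι v (∂′ c₀) ρ ≡⟨ ℤP.neg-distrib-+ (ι v c₁ ρ) _ ⟨
  ℤ.- (ι v c₁ ρ ℤ.+ ι v (∂′ c₀) ρ) ≡⟨ cong ℤ.-_ (additive (ι-linear v) c₁ (∂′ c₀) ρ) ⟨
  ℤ.- ι v (λ σ → c₁ σ ℤ.+ ∂′ c₀ σ) ρ ∎
  where
  open ≡-Reasoning
  c₀ = c ∘ (outside ∷_)
  c₁ = c ∘ (inside ∷_)
∂′-ι (Fin.suc v) c (inside ∷ ρ) = cong ℤ.-_ (begin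
  ∂′ (λ σ → ℤ.- ι v c₁ σ) ρ ≡⟨ negative ∂′-linear (ι v c₁) ρ ⟩
  ℤ.- ∂′ (ι v c₁) ρ ≡⟨ cong ℤ.-_ (∂′-ι v c₁ ρ) ⟩
  ℤ.- (ℤ.- ι v (∂′ c₁) ρ) ≡⟨ cong ℤ.-_ (negative (ι-linear v) (∂′ c₁) ρ) ⟨
  ℤ.- ι v (λ σ → ℤ.- ∂′ c₁ σ) ρ ∎)
  where
  open ≡-Reasoning
  c₁ = c ∘ (inside ∷_)

-- The Leibniz rule of the exterior algebra. On a cycle the last term vanishes, so coning with `v`
-- fills it.
∂′-ε : ∀ {n} (v : Fin n) c ρ → ∂′ (ε v c) ρ ≡ c ρ ℤ.- ε v (∂′ c) ρ
∂′-ε Fin.zero c (outside ∷ ρ) = cong (λ z → c (outside ∷ ρ) ℤ.+ z) (zero-map ∂′-linear ρ)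
∂′-ε Fin.zero c (inside ∷ ρ) = lem (c (inside ∷ ρ)) _
  where
  lem : ∀ a b → ℤ.- b ≡ a ℤ.- (a ℤ.+ b)
  lem = solve-∀
∂′-ε (Fin.suc v) c (outside ∷ ρ) = begin
  ℤ.- ε v c₁ ρ ℤ.+ ∂′ (ε v c₀) ρ ≡⟨ cong (λ z → ℤ.- ε v c₁ ρ ℤ.+ z) (∂′-ε v c₀ ρ) ⟩
  ℤ.- ε v c₁ ρ ℤ.+ (c₀ ρ ℤ.- ε v (∂′ c₀) ρ) ≡⟨ lem (ε v c₁ ρ) (c₀ ρ) _ ⟩
  c₀ ρ ℤ.- (ε v c₁ ρ ℤ.+ ε v (∂′ c₀) ρ) ≡⟨ cong (λ z → c₀ ρ ℤ.- z) (additive (ε-linear v) c₁ (∂′ c₀) ρ) ⟨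
  c₀ ρ ℤ.- ε v (λ σ → c₁ σ ℤ.+ ∂′ c₀ σ) ρ ∎
  where
  open ≡-Reasoning
  c₀ = c ∘ (outside ∷_)
  c₁ = c ∘ (inside ∷_)
  lem : ∀ a b d → ℤ.- a ℤ.+ (b ℤ.- d) ≡ b ℤ.- (a ℤ.+ d)
  lem = solve-∀
∂′-ε (Fin.suc v) c (inside ∷ ρ) = begin
  ℤ.- ∂′ (λ σ → ℤ.- ε v c₁ σ) ρ ≡⟨ cong ℤ.-_ (negative ∂′-linear (ε v c₁) ρ) ⟩
  ℤ.- (ℤ.- ∂′ (ε v c₁) ρ) ≡⟨ ℤP.neg-involutive _ ⟩
  ∂′ (ε v c₁) ρ ≡⟨ ∂′-ε v c₁ ρ ⟩
  c₁ ρ ℤ.- ε v (∂′ c₁) ρ ≡⟨ cong (λ z → c₁ ρ ℤ.+ z) (negative (ε-linear v) (∂′ c₁) ρ) ⟨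
  c₁ ρ ℤ.+ ε v (λ σ → ℤ.- ∂′ c₁ σ) ρ ≡⟨ cong (λ z → c₁ ρ ℤ.+ z) (ℤP.neg-involutive _) ⟨
  c₁ ρ ℤ.- (ℤ.- ε v (λ σ → ℤ.- ∂′ c₁ σ) ρ) ∎
  where
  open ≡-Reasoning
  c₁ = c ∘ (inside ∷_)

ι-ε-same : ∀ {n} (v : Fin n) c ρ → ι v (ε v c) ρ ≡ c ρ ℤ.- ε v (ι v c) ρ
ι-ε-same Fin.zero c (outside ∷ ρ) = sym (ℤP.+-identityʳ _)
ι-ε-same Fin.zero c (inside ∷ ρ) = sym (ℤP.+-inverseʳ (c (inside ∷ ρ)))
ι-ε-same (Fin.suc v) c (outside ∷ ρ) = ι-ε-same v (c ∘ (outside ∷_)) ρ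
ι-ε-same (Fin.suc v) c (inside ∷ ρ) = begin
  ℤ.- ι v (λ σ → ℤ.- ε v c₁ σ) ρ ≡⟨ cong ℤ.-_ (negative (ι-linear v) (ε v c₁) ρ) ⟩
  ℤ.- (ℤ.- ι v (ε v c₁) ρ) ≡⟨ ℤP.neg-involutive _ ⟩
  ι v (ε v c₁) ρ ≡⟨ ι-ε-same v c₁ ρ ⟩
  c₁ ρ ℤ.- ε v (ι v c₁) ρ ≡⟨ cong (λ z → c₁ ρ ℤ.+ z) (negative (ε-linear v) (ι v c₁) ρ) ⟨
  c₁ ρ ℤ.+ ε v (λ σ → ℤ.- ι v c₁ σ) ρ ≡⟨ cong (λ z → c₁ ρ ℤ.+ z) (ℤP.neg-involutive _) ⟨
  c₁ ρ ℤ.- (ℤ.- ε v (λ σ → ℤ.- ι v c₁ σ) ρ) ∎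
  where
  open ≡-Reasoning
  c₁ = c ∘ (inside ∷_)

ι-ε-distinct : ∀ {n} {u v : Fin n} → u ≢ v → ∀ c ρ → ι u (ε v c) ρ ≡ ℤ.- ε v (ι u c) ρ
ι-ε-distinct {u = Fin.zero} {Fin.zero} u≢v = contradiction refl u≢v
ι-ε-distinct {u = Fin.zero} {Fin.suc v} _ c (outside ∷ ρ) = refl
ι-ε-distinct {u = Fin.zero} {Fin.suc v} _ c (inside ∷ ρ) = sym (trans (ℤP.neg-involutive _) (zero-map (ε-linear v) ρ))
ι-ε-distinct {u = Fin.suc u} {Fin.zero} _ c (outside ∷ ρ) = zero-map (ι-linear u) ρ
ι-ε-distinct {u = Fin.suc u} {Fin.zero} _ c (inside ∷ ρ) = refl
ι-ε-distinct {u = Fin.suc u} {Fin.suc v} u≢v c (outside ∷ ρ) = ι-ε-distinct (u≢v ∘ cong Fin.suc) (c ∘ (outside ∷_)) ρ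
ι-ε-distinct {u = Fin.suc u} {Fin.suc v} u≢v c (inside ∷ ρ) = cong ℤ.-_ (begin
  ι u (λ σ → ℤ.- ε v c₁ σ) ρ ≡⟨ negative (ι-linear u) (ε v c₁) ρ ⟩
  ℤ.- ι u (ε v c₁) ρ ≡⟨ cong ℤ.-_ (ι-ε-distinct (u≢v ∘ cong Fin.suc) c₁ ρ) ⟩
  ℤ.- (ℤ.- ε v (ι u c₁) ρ) ≡⟨ cong ℤ.-_ (negative (ε-linear v) (ι u c₁) ρ) ⟨
  ℤ.- ε v (λ σ → ℤ.- ι u c₁ σ) ρ ∎)
  where
  open ≡-Reasoning
  c₁ = c ∘ (inside ∷_)

ι-ι : ∀ {n} (u v : Fin n) c ρ → ι u (ι v c) ρ ≡ ℤ.- ι v (ι u c) ρ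
ι-ι Fin.zero Fin.zero c (outside ∷ ρ) = refl
ι-ι Fin.zero Fin.zero c (inside ∷ ρ) = refl
ι-ι Fin.zero (Fin.suc v) c (outside ∷ ρ) = refl
ι-ι Fin.zero (Fin.suc v) c (inside ∷ ρ) = sym (trans (ℤP.neg-involutive _) (zero-map (ι-linear v) ρ))
ι-ι (Fin.suc u) Fin.zero c (outside ∷ ρ) = sym (ℤP.neg-involutive _)
ι-ι (Fin.suc u) Fin.zero c (inside ∷ ρ) = cong ℤ.-_ (zero-map (ι-linear u) ρ)
ι-ι (Fin.suc u) (Fin.suc v) c (outside ∷ ρ) = ι-ι u v (c ∘ (outside ∷_)) ρ
ι-ι (Fin.suc u) (Fin.suc v) c (inside ∷ ρ) = cong ℤ.-_ (begin
  ι u (λ σ → ℤ.- ι v c₁ σ) ρ ≡⟨ negative (ι-linear u) (ι v c₁) ρ ⟩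
  ℤ.- ι u (ι v c₁) ρ ≡⟨ cong ℤ.-_ (ι-ι u v c₁ ρ) ⟩
  ℤ.- (ℤ.- ι v (ι u c₁) ρ) ≡⟨ cong ℤ.-_ (negative (ι-linear v) (ι u c₁) ρ) ⟨
  ℤ.- ι v (λ σ → ℤ.- ι u c₁ σ) ρ ∎)
  where
  open ≡-Reasoning
  c₁ = c ∘ (inside ∷_)

-- Over ∅ no vertex precedes another, so all signs are +1. Evaluating at ∅ is what turns the cochain
-- computations below into plain sums.
∂′-∅ : ∀ {n} (c : Chain n) → ∂′ c ∅ ≡ sumFin (λ x → ι x c ∅)
∂′-∅ {zero} c = refl
∂′-∅ {suc n} c = cong (λ z → c (inside ∷ ∅) ℤ.+ z) (∂′-∅ (c ∘ (outside ∷_)))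

ε-∅ : ∀ {n} (v : Fin n) c → ε v c ∅ ≡ 0ℤ
ε-∅ Fin.zero c = refl
ε-∅ (Fin.suc v) c = ε-∅ v (c ∘ (outside ∷_))

neg-≢0 : ∀ {i} → ℤ.- i ≢ 0ℤ → i ≢ 0ℤ
neg-≢0 h refl = h refl

ι-support : ∀ {n} (v : Fin n) c σ → ι v c σ ≢ 0ℤ → v ∉ σ × c (σ ∪ ⁅ v ⁆) ≢ 0ℤ
ι-support Fin.zero c (outside ∷ σ) h = (λ ()) , subst (λ τ → c (inside ∷ τ) ≢ 0ℤ) (sym (∪-identityʳ σ)) h
ι-support Fin.zero c (inside ∷ σ) h = contradiction refl h
ι-support (Fin.suc v) c (outside ∷ σ) h with ι-support v (c ∘ (outside ∷_)) σ h
... | v∉σ , h′ = v∉σ ∘ drop-there , h′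
ι-support (Fin.suc v) c (inside ∷ σ) h with ι-support v (c ∘ (inside ∷_)) σ (neg-≢0 h)
... | v∉σ , h′ = v∉σ ∘ drop-there , h′

ε-support : ∀ {n} (v : Fin n) c σ → ε v c σ ≢ 0ℤ → v ∈ σ × c (σ - v) ≢ 0ℤ
ε-support Fin.zero c (outside ∷ σ) h = contradiction refl h
ε-support Fin.zero c (inside ∷ σ) h = here , subst (λ τ → c (outside ∷ τ) ≢ 0ℤ) (sym (p─⊥≡p σ)) h
ε-support (Fin.suc v) c (outside ∷ σ) h with ε-support v (c ∘ (outside ∷_)) σ h
... | v∈σ , h′ = there v∈σ , h′
ε-support (Fin.suc v) c (inside ∷ σ) h with ε-support v (c ∘ (inside ∷_)) σ (neg-≢0 h)
... | v∈σ , h′ = there v∈σ , h′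

+-≢0 : ∀ {i j} → i ℤ.+ j ≢ 0ℤ → i ≢ 0ℤ ⊎ j ≢ 0ℤ
+-≢0 {i} {j} h with i ℤP.≟ 0ℤ
... | no i≢0 = inj₁ i≢0
... | yes refl = inj₂ (λ { refl → h refl })

-- Complexes and vertex decomposability

infix 4 _≐_

_≐_ : ∀ {n} → SC n → SC n → Set
K ≐ L = ∀ σ → (K σ → L σ) × (L σ → K σ)

≐-sym : ∀ {n} {K L : SC n} → K ≐ L → L ≐ K
≐-sym eq σ = proj₂ (eq σ) , proj₁ (eq σ)

Closed : ∀ {n} → SC n → Set
Closed {n} K = ∀ (σ τ : Subset n) → τ ⊆ σ → K σ → K τ

Decidable : ∀ {n} → SC n → Set
Decidable {n} K = ∀ (σ : Subset n) → Dec (K σ)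

module _ {n} {K L : SC n} where

  facet-≐ : K ≐ L → ∀ {σ} → IsFacet K σ → IsFacet L σ
  facet-≐ eq {σ} (k , max) = proj₁ (eq σ) k , λ ρ l → max ρ (proj₂ (eq ρ) l)

  closed-≐ : K ≐ L → Closed K → Closed L
  closed-≐ eq cl σ τ τ⊆σ l = proj₁ (eq τ) (cl σ τ τ⊆σ (proj₂ (eq σ) l))

  pureSkel-≐ : K ≐ L → ∀ s → PureSkel K s ≐ PureSkel L s
  pureSkel-≐ eq s τ = (λ { (ρ , k , r) → ρ , proj₁ (eq ρ) k , r }) , (λ { (ρ , l , r) → ρ , proj₂ (eq ρ) l , r })

  homologyVanishes-≐ : K ≐ L → ∀ {m} → HomologyVanishes K m → HomologyVanishes L m
  homologyVanishes-≐ eq hv c chain cycle with hv c (λ σ h → proj₂ (eq σ) (proj₁ (chain σ h)) , proj₂ (chain σ h))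
      cycle
  ... | d , chain′ , ∂d≡c = d , (λ σ h → proj₁ (eq σ) (proj₁ (chain′ σ h)) , proj₂ (chain′ σ h)) , ∂d≡c

module _ {n} {K L : SC n} (eq : K ≐ L) where

  shellable-≐ : Shellable K → Shellable L
  shellable-≐ (t , f , facets , inj , all , pure) =
    t , f , facet-≐ eq ∘ facets , inj , (λ σ → all σ ∘ facet-≐ (≐-sym eq)) , pure

  partitionable-≐ : Partitionable K → Partitionable L
  partitionable-≐ (r , cover , disjoint) = r ,
    (λ η l → map₂ (λ { (facet , int) → facet-≐ eq facet , int }) (cover η (proj₂ (eq η) l))) ,
    λ η σ σ′ facet facet′ → disjoint η σ σ′ (facet-≐ (≐-sym eq) facet) (facet-≐ (≐-sym eq) facet′)

  link-≐ : ∀ τ → Link K τ ≐ Link L τ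
  link-≐ τ η = map₂ (proj₁ (eq (η ∪ τ))) , map₂ (proj₂ (eq (η ∪ τ)))

  hasDimSize-≐ : ∀ {s} → HasDimSize K s → HasDimSize L s
  hasDimSize-≐ (ρ , (k , size) , bound) = ρ , (proj₁ (eq ρ) k , size) , λ τ l → bound τ (proj₂ (eq τ) l)

cohenMacaulay-≐ : ∀ {n} {K L : SC n} → K ≐ L → CohenMacaulay K → CohenMacaulay L
cohenMacaulay-≐ eq cm τ l s dim m m≢s = homologyVanishes-≐ (link-≐ eq τ)
  (cm τ (proj₂ (eq τ) l) s (hasDimSize-≐ (link-≐ (≐-sym eq) τ) dim) m m≢s)

seqCohenMacaulay-≐ : ∀ {n} {K L : SC n} → K ≐ L → SeqCohenMacaulay K → SeqCohenMacaulay L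
seqCohenMacaulay-≐ eq scm s = cohenMacaulay-≐ (pureSkel-≐ eq s) (scm s)

module _ {n} {K : SC n} (K? : Decidable K) (cl : Closed K) where

  facet-above : ∀ σ → K σ → ∃[ ρ ] (IsFacet K ρ × σ ⊆ ρ)
  facet-above σ = go n σ (m≤n⇒m≤o+n ∣ σ ∣ ≤-refl)
    where
    go : ∀ k σ → n ≤ ∣ σ ∣ + k → K σ → ∃[ ρ ] (IsFacet K ρ × σ ⊆ ρ)
    go k σ le kσ with FinP.any? (λ u → ¬? (u ∈? σ) ×-dec K? (σ ∪ ⁅ u ⁆))
    ... | no ¬ext = σ , (kσ , maximal) , ⊆-refl
      where
      maximal : ∀ ρ → K ρ → σ ⊆ ρ → ρ ≡ σ
      maximal ρ kρ σ⊆ρ with ρ ⊆? σ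
      ... | yes ρ⊆σ = ⊆-antisym ρ⊆σ σ⊆ρ
      ... | no ρ⊈σ with ⊈⇒∃ σ ρ ρ⊈σ
      ... | x , x∈ρ , x∉σ = contradiction (x , x∉σ , cl ρ _ (∪⁅⁆-⊆ σ⊆ρ x∈ρ) kρ) ¬ext
    go zero σ le kσ | yes (u , u∉σ , _) =
      contradiction (subst (n <_) (sym (∣p∪⁅x⁆∣ σ u∉σ)) (s≤s (subst (n ≤_) (+-identityʳ _) le)))
          (≤⇒≯ (∣p∣≤n (σ ∪ ⁅ u ⁆)))
    go (suc k) σ le kσ | yes (u , u∉σ , k∪) with go k (σ ∪ ⁅ u ⁆)
        (subst (n ≤_) (trans (+-suc _ k) (cong (_+ k) (sym (∣p∪⁅x⁆∣ σ u∉σ)))) le) k∪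
    ... | ρ , facet , ⊆ρ = ρ , facet , ⊆ρ ∘ p⊆p∪⁅x⁆

  -- A face belongs to the first facet that contains it. The lower end of `f i` collects the
  -- vertices whose removal leaves a face of an earlier facet; by purity, a subface of `f i` is new
  -- exactly when it contains them all.
  shellable⇒partitionable : Shellable K → Partitionable K
  shellable⇒partitionable (t , f , facets , inj , all , pure) = r , cover , disjoint
    where
    Removable : Fin t → Fin n → Set
    Removable i v = v ∈ f i × ∃[ j ] (toℕ j < toℕ i × f i - v ⊆ f j)

    removable? : ∀ i v → Dec (Removable i v)
    removable? i v = (v ∈? f i) ×-dec FinP.any? (λ j → (toℕ j <? toℕ i) ×-dec (f i - v ⊆? f j))

    r : Subset n → Subset n
    r σ with FinP.any? (λ i → f i ≟ₛ σ)
    ... | yes (i , _) = ⟦ removable? i ⟧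
    ... | no _ = ∅

    r-f : ∀ i → r (f i) ≡ ⟦ removable? i ⟧
    r-f i with FinP.any? (λ j → f j ≟ₛ f i)
    ... | yes (j , e) = cong (λ j → ⟦ removable? j ⟧) (inj j i e)
    ... | no ¬e = contradiction (i , refl) ¬e

    first : ∀ {η} k i → toℕ i < k → η ⊆ f i → ∃[ i ] (η ⊆ f i × ∀ j → toℕ j < toℕ i → ¬ (η ⊆ f j))
    first {η} (suc k) i i<k η⊆ with FinP.any? (λ j → (toℕ j <? toℕ i) ×-dec (η ⊆? f j))
    ... | no ¬e = i , η⊆ , λ j j<i η⊆j → ¬e (j , j<i , η⊆j)
    ... | yes (j , j<i , η⊆j) = first k j (<-≤-trans j<i (s≤s⁻¹ i<k)) η⊆j

    cover : ∀ η → K η → ∃[ σ ] (IsFacet K σ × InInterval (r σ) σ η)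
    cover η kη with facet-above η kη
    ... | σ , facet , η⊆σ with all σ facet
    ... | i₀ , refl with first t i₀ (FinP.toℕ<n i₀) η⊆σ
    ... | i , η⊆ , least = f i , facets i , subst (_⊆ η) (sym (r-f i)) rf⊆η , η⊆
      where
      rf⊆η : ⟦ removable? i ⟧ ⊆ η
      rf⊆η {v} v∈ with v ∈? η | ∈⟦⟧⁻ (removable? i) v∈
      ... | yes v∈η | _ = v∈η
      ... | no v∉η | _ , j , j<i , sub =
        contradiction (λ {x} x∈η → sub (x∈p∧x≢y⇒x∈p-y (η⊆ x∈η) λ { refl → v∉η x∈η })) (least j j<i)

    clash : ∀ {η} i j → toℕ i < toℕ j → η ⊆ f i → ⟦ removable? j ⟧ ⊆ η → η ⊆ f j → ⊥
    clash {η} i j i<j η⊆i r⊆η η⊆j with pure j (≤-trans (s≤s z≤n) i<j) η (η⊆j , i , i<j , η⊆i)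
    ... | _ , ρ , (ρ⊆j , i′ , i′<j , ρ⊆i′) , η⊆ρ , size with ∣ f j ∣ in card
    -- An empty `f j`, where `∸ 1` truncates, would lie in `f i` and so not be a facet of its own.
    ... | zero = <⇒≢ i<j (cong toℕ (inj i j
          (proj₂ (facets j) (f i) (proj₁ (facets i)) λ {x} x∈ →
          contradiction (≤-trans (≤-reflexive (sym (∣⁅x⁆∣≡1 x)))
          (≤-trans (p⊆q⇒∣p∣≤∣q∣ λ { h → subst (_∈ f j) (sym (x∈⁅y⁆⇒x≡y x h)) x∈ }) (≤-reflexive card))) λ ())))
    ... | suc m with ∣p∣<∣q∣⇒∃ ρ (f j) (≤-reflexive (trans (cong suc size) (sym card)))
    ... | v , v∈j , v∉ρ = v∉ρ (η⊆ρ (r⊆η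
          (∈⟦⟧⁺ (removable? j) (v∈j , i′ , i′<j , λ h → ρ⊆i′ (subst (_ ∈_) (sym ρ≡) h)))))
      where
      ρ≡ : ρ ≡ f j - v
      ρ≡ = ⊆∧∣∣≡⇒≡ (λ {x} h → x∈p∧x≢y⇒x∈p-y (ρ⊆j h) λ { refl → v∉ρ h })
        (≤-reflexive (trans (suc-injective (trans (sym (∣p∣≡1+∣p-x∣ (f j) v∈j)) card)) (sym size)))

    disjoint : ∀ η σ σ′ → IsFacet K σ → IsFacet K σ′ → InInterval (r σ) σ η → InInterval (r σ′) σ′ η → σ ≡ σ′
    disjoint η σ σ′ facet facet′ (lo , hi) (lo′ , hi′) with all σ facet | all σ′ facet′
    ... | i , refl | j , refl with <-cmp (toℕ i) (toℕ j)
    ... | tri< i<j _ _ = ⊥-elim (clash i j i<j hi (subst (_⊆ η) (r-f j) lo′) hi′)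
    ... | tri≈ _ i≡j _ = cong f (FinP.toℕ-injective i≡j)
    ... | tri> _ _ j<i = ⊥-elim (clash j i j<i hi′ (subst (_⊆ η) (r-f i) lo) hi)

-- Deletion, link and shedding vertices

Del : ∀ {n} → SC n → Fin n → SC n
Del K v σ = v ∉ σ × K σ

Lk : ∀ {n} → SC n → Fin n → SC n
Lk K v σ = v ∉ σ × K (σ ∪ ⁅ v ⁆)

-- Equivalently, no facet of the deletion is a face of the link.
Shedding : ∀ {n} → SC n → Fin n → Set
Shedding {n} K v = ∀ (σ : Subset n) → Lk K v σ → ∃[ u ] (u ∉ σ × Del K v (σ ∪ ⁅ u ⁆))

-- The nonpure notion. `D` and `L` are given up to `≐`, so that for flag complexes they can be taken
-- to be induced subcomplexes.
data VertexDecomposable {n} (K : SC n) : Set₁ where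
  simplex : ∀ W → K ≐ (_⊆ W) → VertexDecomposable K
  shed : ∀ {D L} v → Shedding K v → D ≐ Del K v → VertexDecomposable D →
    L ≐ Lk K v → VertexDecomposable L → VertexDecomposable K

module _ {n} {K : SC n} (cl : Closed K) (v : Fin n) where

  del-closed : Closed (Del K v)
  del-closed σ τ τ⊆σ (v∉σ , k) = v∉σ ∘ τ⊆σ , cl σ τ τ⊆σ k

  lk-closed : Closed (Lk K v)
  lk-closed σ τ τ⊆σ (v∉σ , k) = v∉σ ∘ τ⊆σ , cl _ _ (∪⁅⁆-mono τ⊆σ) k

  lk⇒del : ∀ {σ} → Lk K v σ → Del K v σ
  lk⇒del {σ} (v∉σ , k) = v∉σ , cl _ σ p⊆p∪⁅x⁆ k

  lk-minus : ∀ {σ} → K σ → v ∈ σ → Lk K v (σ - v)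
  lk-minus {σ} k v∈σ = x∉p-x σ , subst K (sym (p-x∪⁅x⁆≡p v∈σ)) k

  facet-del⁻ : ∀ {σ} → IsFacet K σ → v ∉ σ → IsFacet (Del K v) σ
  facet-del⁻ (k , max) v∉σ = (v∉σ , k) , λ ρ → max ρ ∘ proj₂

  facet-lk⁺ : ∀ {σ} → IsFacet (Lk K v) σ → IsFacet K (σ ∪ ⁅ v ⁆)
  facet-lk⁺ {σ} ((v∉σ , k) , max) = k , λ ρ kρ σv⊆ρ →
    let v∈ρ = σv⊆ρ (x∈p∪⁅x⁆ σ) in
    trans (sym (p-x∪⁅x⁆≡p v∈ρ)) (cong (_∪ ⁅ v ⁆) (max (ρ - v) (lk-minus kρ v∈ρ)
      λ {x} x∈σ → x∈p∧x≢y⇒x∈p-y (σv⊆ρ (p⊆p∪⁅x⁆ x∈σ)) λ { refl → v∉σ x∈σ }))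

  facet-lk⁻ : ∀ {σ} → IsFacet K σ → v ∈ σ → IsFacet (Lk K v) (σ - v)
  facet-lk⁻ {σ} (k , max) v∈σ = lk-minus k v∈σ , λ { ρ (v∉ρ , kρ) sub →
    trans (sym (p∪⁅x⁆-x≡p v∉ρ)) (cong (_- v) (max (ρ ∪ ⁅ v ⁆) kρ
      (subst (_⊆ ρ ∪ ⁅ v ⁆) (p-x∪⁅x⁆≡p v∈σ) (∪⁅⁆-mono sub)))) }

  -- A facet of the deletion that could absorb `v` would lie in the link, where shedding enlarges it
  -- without `v`.
  facet-del⁺ : Shedding K v → ∀ {σ} → IsFacet (Del K v) σ → IsFacet K σ
  facet-del⁺ sh {σ} ((v∉σ , k) , max) = k , max′
    where
    max′ : ∀ ρ → K ρ → σ ⊆ ρ → ρ ≡ σ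
    max′ ρ kρ σ⊆ρ with v ∈? ρ
    ... | no v∉ρ = max ρ (v∉ρ , kρ) σ⊆ρ
    ... | yes v∈ρ with sh σ (v∉σ , cl ρ _ (∪⁅⁆-⊆ σ⊆ρ v∈ρ) kρ)
    ... | u , u∉σ , del = contradiction (subst (u ∈_) (max _ del p⊆p∪⁅x⁆) (x∈p∪⁅x⁆ σ)) u∉σ

  module _ (K? : Decidable K) where

    del? : Decidable (Del K v)
    del? σ = ¬? (v ∈? σ) ×-dec K? σ

    lk? : Decidable (Lk K v)
    lk? σ = ¬? (v ∈? σ) ×-dec K? (σ ∪ ⁅ v ⁆)

facet-simplex : ∀ {n} {K : SC n} {W} → K ≐ (_⊆ W) → ∀ {σ} → IsFacet K σ → σ ≡ W
facet-simplex {W = W} eq {σ} (k , max) = sym (max W (proj₂ (eq W) ⊆-refl) (proj₁ (eq σ) k))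

simplex-facet : ∀ {n} {K : SC n} {W} → K ≐ (_⊆ W) → IsFacet K W
simplex-facet {W = W} eq = proj₂ (eq W) ⊆-refl , λ ρ k → ⊆-antisym (proj₁ (eq ρ) k)

-- The facets of `K` are those of the deletion and those of the link with `v` added. Putting `v`
-- into both ends of each link interval keeps the two families of intervals apart.
vd⇒partitionable : ∀ {n} {K : SC n} → Closed K → VertexDecomposable K → Partitionable K
vd⇒partitionable cl (simplex W eq) = (λ _ → ∅) ,
  (λ η k → W , simplex-facet eq , ⊥⊆ , proj₁ (eq η) k) ,
  λ η σ σ′ facet facet′ _ _ → trans (facet-simplex eq facet) (sym (facet-simplex eq facet′))
vd⇒partitionable {n} {K} cl (shed v sh eqD vdD eqL vdL)
  with partitionable-≐ eqD (vd⇒partitionable (closed-≐ (≐-sym eqD) (del-closed cl v)) vdD)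
     | partitionable-≐ eqL (vd⇒partitionable (closed-≐ (≐-sym eqL) (lk-closed cl v)) vdL)
... | rD , coverD , disjointD | rL , coverL , disjointL = r , cover , disjoint
  where
  r : Subset n → Subset n
  r σ with v ∈? σ
  ... | yes _ = rL (σ - v) ∪ ⁅ v ⁆
  ... | no _ = rD σ

  r-off : ∀ {σ} → v ∉ σ → r σ ≡ rD σ
  r-off {σ} v∉σ with v ∈? σ
  ... | yes v∈σ = contradiction v∈σ v∉σ
  ... | no _ = refl

  r-on : ∀ {σ} → v ∈ σ → r σ ≡ rL (σ - v) ∪ ⁅ v ⁆
  r-on {σ} v∈σ with v ∈? σ
  ... | yes _ = refl
  ... | no v∉σ = contradiction v∈σ v∉σ

  cover : ∀ η → K η → ∃[ σ ] (IsFacet K σ × InInterval (r σ) σ η)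
  cover η k with v ∈? η
  ... | no v∉η with coverD η (v∉η , k)
  ... | σ , facet@((v∉σ , _) , _) , lo , hi = σ , facet-del⁺ cl v sh facet , subst (_⊆ η) (sym (r-off v∉σ)) lo , hi
  cover η k | yes v∈η with coverL (η - v) (lk-minus cl v k v∈η)
  ... | σ , facet@((v∉σ , _) , _) , lo , hi = σ ∪ ⁅ v ⁆ , facet-lk⁺ cl v facet ,
    subst (_⊆ η) (sym (trans (r-on (x∈p∪⁅x⁆ σ)) (cong (λ τ → rL τ ∪ ⁅ v ⁆) (p∪⁅x⁆-x≡p v∉σ))))
      (subst (rL σ ∪ ⁅ v ⁆ ⊆_) (p-x∪⁅x⁆≡p v∈η) (∪⁅⁆-mono lo)) ,
    subst (_⊆ σ ∪ ⁅ v ⁆) (p-x∪⁅x⁆≡p v∈η) (∪⁅⁆-mono hi)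

  on-interval : ∀ {η σ} → v ∈ σ → InInterval (r σ) σ η → v ∈ η
  on-interval {η} {σ} v∈σ (lo , _) = lo (subst (v ∈_) (sym (r-on v∈σ)) (x∈p∪⁅x⁆ (rL (σ - v))))

  minus-mono : ∀ {p q : Subset n} → p ⊆ q → p - v ⊆ q - v
  minus-mono {p} p⊆q h = x∈p∧x≢y⇒x∈p-y (p⊆q (proj₁ (x∈p-y⁻ p h))) (proj₂ (x∈p-y⁻ p h))

  lower-L : ∀ {η σ} → IsFacet K σ → v ∈ σ → InInterval (r σ) σ η → InInterval (rL (σ - v)) (σ - v) (η - v)
  lower-L {η} {σ} facet v∈σ int@(lo , hi) = low , minus-mono hi
    where
    low : rL (σ - v) ⊆ η - v
    low {x} x∈ = x∈p∧x≢y⇒x∈p-y (lo (subst (x ∈_) (sym (r-on v∈σ)) (p⊆p∪⁅x⁆ x∈)))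
      λ { refl → rL∌v x∈ }
      where
      -- A lower end lies inside its facet: the facet has to be covered, and no other facet contains
      -- it.
      rL∌v : v ∉ rL (σ - v)
      rL∌v h with coverL (σ - v) (proj₁ (facet-lk⁻ cl v facet v∈σ))
      ... | σ′ , facet′ , lo′ , hi′ with proj₂ (facet-lk⁻ cl v facet v∈σ) σ′ (proj₁ facet′) hi′
      ... | refl = x∉p-x σ (lo′ h)

  disjoint : ∀ η σ σ′ → IsFacet K σ → IsFacet K σ′ → InInterval (r σ) σ η → InInterval (r σ′) σ′ η → σ ≡ σ′
  disjoint η σ σ′ facet facet′ int int′ with v ∈? σ | v ∈? σ′
  ... | no v∉σ | no v∉σ′ = disjointD η σ σ′ (facet-del⁻ cl v facet v∉σ) (facet-del⁻ cl v facet′ v∉σ′) int int′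
  ... | no v∉σ | yes v∈σ′ = contradiction
        (proj₂ int (on-interval v∈σ′ (subst (_⊆ η) (sym (r-on v∈σ′)) (proj₁ int′) , proj₂ int′))) v∉σ
  ... | yes v∈σ | no v∉σ′ = contradiction
        (proj₂ int′ (on-interval v∈σ (subst (_⊆ η) (sym (r-on v∈σ)) (proj₁ int) , proj₂ int))) v∉σ′
  ... | yes v∈σ | yes v∈σ′ = trans (sym (p-x∪⁅x⁆≡p v∈σ)) (trans (cong (_∪ ⁅ v ⁆)
    (disjointL (η - v) (σ - v) (σ′ - v) (facet-lk⁻ cl v facet v∈σ) (facet-lk⁻ cl v facet′ v∈σ′)
      (lower-L facet v∈σ (subst (_⊆ η) (sym (r-on v∈σ)) (proj₁ int) , proj₂ int))
          (lower-L facet′ v∈σ′ (subst (_⊆ η) (sym (r-on v∈σ′)) (proj₁ int′) , proj₂ int′))))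
    (p-x∪⁅x⁆≡p v∈σ′))

-- Shellability and homology of vertex decomposable complexes

data SplitView (m n : ℕ) : Fin (m + n) → Set where
  left : ∀ a → SplitView m n (a Fin.↑ˡ n)
  right : ∀ b → SplitView m n (m Fin.↑ʳ b)

splitView : ∀ m n i → SplitView m n i
splitView m n i with Fin.splitAt m i in eq
... | inj₁ a = subst (SplitView m n) (FinP.splitAt⁻¹-↑ˡ eq) (left a)
... | inj₂ b = subst (SplitView m n) (FinP.splitAt⁻¹-↑ʳ eq) (right b)

-- The facets of the deletion come first, then those of the link with `v` added. Within each block
-- the given shellings do the work.
vd⇒shellable : ∀ {n} {K : SC n} → Decidable K → Closed K → VertexDecomposable K → Shellable K
vd⇒shellable K? cl (simplex W eq) = 1 , (λ _ → W) , (λ _ → simplex-facet eq) ,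
  (λ { Fin.zero Fin.zero _ → refl }) , (λ σ facet → Fin.zero , sym (facet-simplex eq facet)) , λ { Fin.zero () }
vd⇒shellable {n} {K} K? cl (shed {D} {L} v sh eqD vdD eqL vdL)
  with shellable-≐ eqD (vd⇒shellable (λ σ → map′ (proj₂ (eqD σ)) (proj₁ (eqD σ)) (del? cl v K? σ))
      (closed-≐ (≐-sym eqD) (del-closed cl v)) vdD)
     | shellable-≐ eqL (vd⇒shellable (λ σ → map′ (proj₂ (eqL σ)) (proj₁ (eqL σ)) (lk? cl v K? σ))
         (closed-≐ (≐-sym eqL) (lk-closed cl v)) vdL)
... | p , fD , facetD , injD , allD , pureD | q , fL , facetL , injL , allL , pureL = p + q , f , facets , inj ,
      all , pure
  where
  f : Fin (p + q) → Subset n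
  f i = [ fD , (λ b → fL b ∪ ⁅ v ⁆) ]′ (Fin.splitAt p i)

  f-left : ∀ a → f (a Fin.↑ˡ q) ≡ fD a
  f-left a rewrite FinP.splitAt-↑ˡ p a q = refl

  f-right : ∀ b → f (p Fin.↑ʳ b) ≡ fL b ∪ ⁅ v ⁆
  f-right b rewrite FinP.splitAt-↑ʳ p q b = refl

  v∉fD : ∀ a → v ∉ fD a
  v∉fD a = proj₁ (proj₁ (facetD a))

  v∉fL : ∀ b → v ∉ fL b
  v∉fL b = proj₁ (proj₁ (facetL b))

  facets : ∀ i → IsFacet K (f i)
  facets i with splitView p q i
  ... | left a = subst (IsFacet K) (sym (f-left a)) (facet-del⁺ cl v sh (facetD a))
  ... | right b = subst (IsFacet K) (sym (f-right b)) (facet-lk⁺ cl v (facetL b))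

  inj : ∀ i j → f i ≡ f j → i ≡ j
  inj i j eq with splitView p q i | splitView p q j
  ... | left a | left a′ = cong (Fin._↑ˡ q) (injD a a′ (trans (sym (f-left a)) (trans eq (f-left a′))))
  ... | left a | right b = contradiction
        (subst (v ∈_) (trans (sym (f-right b)) (trans (sym eq) (f-left a))) (x∈p∪⁅x⁆ (fL b))) (v∉fD a)
  ... | right b | left a = contradiction
        (subst (v ∈_) (trans (sym (f-right b)) (trans eq (f-left a))) (x∈p∪⁅x⁆ (fL b))) (v∉fD a)
  ... | right b | right b′ = cong (p Fin.↑ʳ_)
        (injL b b′ (trans (sym (p∪⁅x⁆-x≡p (v∉fL b)))
        (trans (cong (_- v) (trans (sym (f-right b)) (trans eq (f-right b′)))) (p∪⁅x⁆-x≡p (v∉fL b′)))))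

  all : ∀ σ → IsFacet K σ → ∃[ i ] (f i ≡ σ)
  all σ facet with v ∈? σ
  ... | no v∉σ with allD σ (facet-del⁻ cl v facet v∉σ)
  ... | a , eq = a Fin.↑ˡ q , trans (f-left a) eq
  all σ facet | yes v∈σ with allL (σ - v) (facet-lk⁻ cl v facet v∈σ)
  ... | b , eq = p Fin.↑ʳ b , trans (f-right b) (trans (cong (_∪ ⁅ v ⁆) eq) (p-x∪⁅x⁆≡p v∈σ))

  Purifies : ∀ {t} → (Fin t → Subset n) → Fin t → Subset n → Subset n → Set
  Purifies g j τ ρ = EarlierIntersection g j ρ × τ ⊆ ρ × ∣ ρ ∣ ≡ ∣ g j ∣ ∸ 1

  left-left : ∀ {τ} a a′ → toℕ a < toℕ a′ → τ ⊆ fD a′ → τ ⊆ fD a → ∃[ ρ ] Purifies f (a′ Fin.↑ˡ q) τ ρ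
  left-left {τ} a a′ a<a′ τ⊆a′ τ⊆a with pureD a′ (≤-trans (s≤s z≤n) a<a′) τ (τ⊆a′ , a , a<a′ , τ⊆a)
  ... | _ , ρ , (ρ⊆a′ , b , b<a′ , ρ⊆b) , τ⊆ρ , size = ρ ,
    (subst (ρ ⊆_) (sym (f-left a′)) ρ⊆a′ , b Fin.↑ˡ q ,
      subst₂ _<_ (sym (FinP.toℕ-↑ˡ b q)) (sym (FinP.toℕ-↑ˡ a′ q)) b<a′ , subst (ρ ⊆_) (sym (f-left b)) ρ⊆b) ,
    τ⊆ρ , trans size (cong (λ σ → ∣ σ ∣ ∸ 1) (sym (f-left a′)))

  -- The face of codimension one is `fL b` itself: it is a face of the deletion, hence of an earlier
  -- facet, and it contains `τ`, which avoids `v` as a part of `fD a`.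
  left-right : ∀ {τ} a b → τ ⊆ fL b ∪ ⁅ v ⁆ → τ ⊆ fD a → ∃[ ρ ] Purifies f (p Fin.↑ʳ b) τ ρ
  left-right {τ} a b τ⊆b τ⊆a with facet-above (del? cl v K?) (del-closed cl v) (fL b) (lk⇒del cl v (proj₁ (facetL b)))
  ... | σ , facet , fLb⊆σ with allD σ facet
  ... | a′ , refl = fL b ,
    (subst (fL b ⊆_) (sym (f-right b)) p⊆p∪⁅x⁆ , a′ Fin.↑ˡ q ,
      subst₂ _<_ (sym (FinP.toℕ-↑ˡ a′ q)) (sym (FinP.toℕ-↑ʳ p b)) (<-≤-trans (FinP.toℕ<n a′) (m≤m+n p _)) ,
      subst (fL b ⊆_) (sym (f-left a′)) fLb⊆σ) ,
    τ⊆fLb , sym (trans (cong (λ σ → ∣ σ ∣ ∸ 1) (f-right b)) (cong (_∸ 1) (∣p∪⁅x⁆∣ (fL b) (v∉fL b))))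
    where
    τ⊆fLb : τ ⊆ fL b
    τ⊆fLb x∈τ with x∈p∪⁅y⁆⁻ (fL b) (τ⊆b x∈τ)
    ... | inj₁ x∈ = x∈
    ... | inj₂ refl = contradiction (τ⊆a x∈τ) (v∉fD a)

  right-right : ∀ {τ} b′ b → toℕ b′ < toℕ b → τ ⊆ fL b ∪ ⁅ v ⁆ → τ ⊆ fL b′ ∪ ⁅ v ⁆ →
      ∃[ ρ ] Purifies f (p Fin.↑ʳ b) τ ρ
  right-right {τ} b′ b b′<b τ⊆b τ⊆b′
    with pureL b (≤-trans (s≤s z≤n) b′<b) (τ - v) (minus-⊆ τ⊆b , b′ , b′<b , minus-⊆ τ⊆b′)
    where
    minus-⊆ : ∀ {σ} → τ ⊆ σ ∪ ⁅ v ⁆ → τ - v ⊆ σ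
    minus-⊆ {σ} sub h with x∈p-y⁻ τ h
    ... | x∈τ , x≢v with x∈p∪⁅y⁆⁻ σ (sub x∈τ)
    ... | inj₁ x∈σ = x∈σ
    ... | inj₂ e = contradiction e x≢v
  ... | _ , ρ , (ρ⊆b , c , c<b , ρ⊆c) , τv⊆ρ , size = ρ ∪ ⁅ v ⁆ ,
    (subst (ρ ∪ ⁅ v ⁆ ⊆_) (sym (f-right b)) (∪⁅⁆-mono ρ⊆b) , p Fin.↑ʳ c ,
      subst₂ _<_ (sym (FinP.toℕ-↑ʳ p c)) (sym (FinP.toℕ-↑ʳ p b)) (+-monoʳ-< p c<b) ,
      subst (ρ ∪ ⁅ v ⁆ ⊆_) (sym (f-right c)) (∪⁅⁆-mono ρ⊆c)) ,
    τ⊆ρv , (begin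
      ∣ ρ ∪ ⁅ v ⁆ ∣ ≡⟨ ∣p∪⁅x⁆∣ ρ (v∉fL b ∘ ρ⊆b) ⟩
      suc ∣ ρ ∣ ≡⟨ cong suc size ⟩
      suc (∣ fL b ∣ ∸ 1) ≡⟨ m+[n∸m]≡n nonempty ⟩
      ∣ fL b ∣ ≡⟨ cong (_∸ 1) (∣p∪⁅x⁆∣ (fL b) (v∉fL b)) ⟨
      ∣ fL b ∪ ⁅ v ⁆ ∣ ∸ 1 ≡⟨ cong (λ σ → ∣ σ ∣ ∸ 1) (f-right b) ⟨
      ∣ f (p Fin.↑ʳ b) ∣ ∸ 1 ∎)
    where
    open ≡-Reasoning
    τ⊆ρv : τ ⊆ ρ ∪ ⁅ v ⁆
    τ⊆ρv {x} x∈τ with x Fin.≟ v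
    ... | yes refl = x∈p∪⁅x⁆ ρ
    ... | no x≢v = p⊆p∪⁅x⁆ (τv⊆ρ (x∈p∧x≢y⇒x∈p-y x∈τ x≢v))
    -- This makes `∸ 1` an honest subtraction; an empty facet would lie in `fL b′`.
    nonempty : 1 ≤ ∣ fL b ∣
    nonempty with fL b ⊆? fL b′
    ... | yes sub = contradiction (cong toℕ (injL b′ b (proj₂ (facetL b) _ (proj₁ (facetL b′)) sub))) (<⇒≢ b′<b)
    ... | no ¬sub with ⊈⇒∃ (fL b′) (fL b) ¬sub
    ... | x , x∈ , _ = subst (1 ≤_) (sym (∣p∣≡1+∣p-x∣ (fL b) x∈)) (s≤s z≤n)

  purify : ∀ j τ → EarlierIntersection f j τ → ∃[ ρ ] Purifies f j τ ρ
  purify j τ (τ⊆j , i , i<j , τ⊆i) with splitView p q i | splitView p q j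
  ... | left a | left a′ = left-left a a′ (subst₂ _<_ (FinP.toℕ-↑ˡ a q) (FinP.toℕ-↑ˡ a′ q) i<j)
    (subst (τ ⊆_) (f-left a′) τ⊆j) (subst (τ ⊆_) (f-left a) τ⊆i)
  ... | left a | right b = left-right a b (subst (τ ⊆_) (f-right b) τ⊆j) (subst (τ ⊆_) (f-left a) τ⊆i)
  ... | right b | left a = contradiction (m≤m+n p (toℕ b))
    (<⇒≱ (<-trans (subst₂ _<_ (FinP.toℕ-↑ʳ p b) (FinP.toℕ-↑ˡ a q) i<j) (FinP.toℕ<n a)))
  ... | right b′ | right b = right-right b′ b
        (+-cancelˡ-< p _ _ (subst₂ _<_ (FinP.toℕ-↑ʳ p b′) (FinP.toℕ-↑ʳ p b) i<j))
    (subst (τ ⊆_) (f-right b) τ⊆j) (subst (τ ⊆_) (f-right b′) τ⊆i)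

  pure : ∀ j → 1 ≤ toℕ j → IsPureSize (EarlierIntersection f j) (∣ f j ∣ ∸ 1)
  pure j _ τ e with purify j τ e
  ... | ρ , earlier , τ⊆ρ , size = subst (∣ τ ∣ ≤_) size (p⊆q⇒∣p∣≤∣q∣ τ⊆ρ) , ρ , earlier , τ⊆ρ , size

-- Acyclicity of pure skeleta below the top degree

subtract-≢0 : ∀ {i j} → i ℤ.- j ≢ 0ℤ → i ≢ 0ℤ ⊎ j ≢ 0ℤ
subtract-≢0 h with +-≢0 h
... | inj₁ a = inj₁ a
... | inj₂ b = inj₂ (neg-≢0 b)

-- If `W` has at least `s` elements, this is a full skeleton of a simplex. Coning with some `v` of
-- `W` produces faces of size `m + 1`, and `m < s` keeps them inside.
simplex-acyclic : ∀ {n} (W : Subset n) s m → m < s → HomologyVanishes (PureSkel (_⊆ W) s) m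
simplex-acyclic {n} W s m m<s c chain cycle with nonempty? W
... | no W≡∅ = (λ _ → 0ℤ) , (λ _ h → contradiction refl h) , λ ρ → trans (∂≡∂′ (λ _ → 0ℤ) ρ)
  (trans (Linear.zero-map ∂′-linear ρ) (sym (decidable-stable (c ρ ℤP.≟ 0ℤ) λ h → empty (proj₁ (chain ρ h)))))
  where
  empty : ∀ {ρ} → PureSkel (_⊆ W) s ρ → ⊥
  empty (σ , σ⊆W , _ , size) with nonempty? σ
  ... | yes (x , x∈σ) = W≡∅ (x , σ⊆W x∈σ)
  ... | no e = contradiction (<-≤-trans m<s
        (≤-reflexive (trans (sym size) (trans (cong ∣_∣ (Empty-unique e)) (∣⊥∣≡0 n))))) λ ()
... | yes (v , v∈W) = ε v c , chain′ , λ ρ → begin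
    ∂ (ε v c) ρ ≡⟨ ∂≡∂′ (ε v c) ρ ⟩
    ∂′ (ε v c) ρ ≡⟨ ∂′-ε v c ρ ⟩
    c ρ ℤ.- ε v (∂′ c) ρ ≡⟨ cong (λ z → c ρ ℤ.- z)
        (trans (Linear.≗-cong (ε-linear v) (λ σ → trans (sym (∂≡∂′ c σ)) (cycle σ)) ρ)
        (Linear.zero-map (ε-linear v) ρ)) ⟩
    c ρ ℤ.- 0ℤ ≡⟨ ℤP.+-identityʳ (c ρ) ⟩
    c ρ ∎
  where
  open ≡-Reasoning
  chain′ : IsChain (PureSkel (_⊆ W) s) (suc m) (ε v c)
  chain′ σ h with ε-support v c σ h
  ... | v∈σ , h′ with chain (σ - v) h′
  ... | (ρ , ρ⊆W , σv⊆ρ , size) , card = face , trans (∣p∣≡1+∣p-x∣ σ v∈σ) (cong suc card)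
    where
    face : PureSkel (_⊆ W) s σ
    face with v ∈? ρ
    ... | yes v∈ρ = ρ , ρ⊆W , subst (_⊆ ρ) (p-x∪⁅x⁆≡p v∈σ) (∪⁅⁆-⊆ σv⊆ρ v∈ρ) , size
    -- An exchange: since `m < s`, some `y` of `ρ` lies outside `σ - v` and can be traded for `v`.
    ... | no v∉ρ with ∣p∣<∣q∣⇒∃ (σ - v) ρ (subst₂ _<_ (sym card) (sym size) m<s)
    ... | y , y∈ρ , y∉ = (ρ - y) ∪ ⁅ v ⁆ , ∪⁅⁆-⊆ (ρ⊆W ∘ p─q⊆p ρ ⁅ y ⁆) v∈W ,
      subst (_⊆ (ρ - y) ∪ ⁅ v ⁆) (p-x∪⁅x⁆≡p v∈σ) (∪⁅⁆-mono λ x∈ → x∈p∧x≢y⇒x∈p-y (σv⊆ρ x∈) λ { refl → y∉ x∈ }) ,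
      trans (∣p∪⁅x⁆∣ (ρ - y) (v∉ρ ∘ p─q⊆p ρ ⁅ y ⁆)) (trans (sym (∣p∣≡1+∣p-x∣ ρ y∈ρ)) size)

module _ {n} {K : SC n} (cl : Closed K) (v : Fin n) where

  pureSkel-lk⁺ : ∀ {s σ} → PureSkel (Lk K v) s σ → PureSkel K (suc s) (σ ∪ ⁅ v ⁆)
  pureSkel-lk⁺ (ρ , (v∉ρ , k) , σ⊆ρ , size) = ρ ∪ ⁅ v ⁆ , k , ∪⁅⁆-mono σ⊆ρ , trans (∣p∪⁅x⁆∣ ρ v∉ρ) (cong suc size)

  pureSkel-lk⁻ : ∀ {s σ} → v ∉ σ → PureSkel K (suc s) (σ ∪ ⁅ v ⁆) → PureSkel (Lk K v) s σ
  pureSkel-lk⁻ {σ = σ} v∉σ (ρ , k , sub , size) = ρ - v , lk-minus cl v k v∈ρ ,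
    (λ x∈σ → x∈p∧x≢y⇒x∈p-y (sub (p⊆p∪⁅x⁆ x∈σ)) λ { refl → v∉σ x∈σ }) ,
    suc-injective (trans (sym (∣p∣≡1+∣p-x∣ ρ v∈ρ)) size)
    where
    v∈ρ = sub (x∈p∪⁅x⁆ σ)

  module _ (sh : Shedding K v) where

    -- Shedding makes up for the vertex lost in the link. Without it, faces of a skeleton that avoid
    -- `v` need not extend to full size in the deletion.
    pureSkel-lk⇒del : ∀ {s σ} → PureSkel (Lk K v) s σ → PureSkel (Del K v) (suc s) σ
    pureSkel-lk⇒del (ρ , l , σ⊆ρ , size) with sh ρ l
    ... | u , u∉ρ , d = ρ ∪ ⁅ u ⁆ , d , p⊆p∪⁅x⁆ ∘ σ⊆ρ , trans (∣p∪⁅x⁆∣ ρ u∉ρ) (cong suc size)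

    pureSkel-del⁻ : ∀ {s σ} → v ∉ σ → PureSkel K (suc s) σ → PureSkel (Del K v) (suc s) σ
    pureSkel-del⁻ {s} {σ} v∉σ (ρ , k , σ⊆ρ , size) with v ∈? ρ
    ... | no v∉ρ = ρ , (v∉ρ , k) , σ⊆ρ , size
    ... | yes v∈ρ = pureSkel-lk⇒del (pureSkel-lk⁻ v∉σ (ρ , k , ∪⁅⁆-⊆ σ⊆ρ v∈ρ , size))

  pureSkel-del⁺ : ∀ {s σ} → PureSkel (Del K v) s σ → PureSkel K s σ
  pureSkel-del⁺ (ρ , (_ , k) , r) = ρ , k , r

-- A cycle c splits as ι v (ε v c) + ε v (ι v c).  The part on v is filled by
-- coning a filling d₁ of the cycle ι v c of the link; the rest is then homologous
-- to a cycle of the deletion, which is filled there by d₀.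
vd⇒acyclic : ∀ {n} {K : SC n} → Closed K → VertexDecomposable K → ∀ s m → m < s → HomologyVanishes (PureSkel K s) m
vd⇒acyclic cl (simplex W eq) s m m<s = homologyVanishes-≐ (pureSkel-≐ (≐-sym eq) s) (simplex-acyclic W s m m<s)
vd⇒acyclic {n} {K} cl (shed {D} {L} v sh eqD vdD eqL vdL) (suc s) m m<s c chain cycle = fill
  where
  open ≡-Reasoning

  c₁ : Chain n
  c₁ = ι v c

  ∂′c : ∀ ρ → ∂′ c ρ ≡ 0ℤ
  ∂′c ρ = trans (sym (∂≡∂′ c ρ)) (cycle ρ)

  ∂′c₁ : ∀ ρ → ∂′ c₁ ρ ≡ 0ℤ
  ∂′c₁ ρ = trans (∂′-ι v c ρ) (cong ℤ.-_ (trans (Linear.≗-cong (ι-linear v) ∂′c ρ) (Linear.zero-map (ι-linear v) ρ)))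

  fill-link : ∀ m → m < suc s → IsChain (PureSkel K (suc s)) m c →
    ∃[ d₁ ] (IsChain (PureSkel (Lk K v) s) m d₁ × (∀ ρ → ∂′ d₁ ρ ≡ c₁ ρ))
  -- A chain in size 0 lives on ∅ and has no part on `v`; in positive size the induction hypothesis
  -- for the link applies one size lower.
  fill-link zero _ chain = (λ _ → 0ℤ) , (λ _ h → contradiction refl h) ,
    λ ρ → trans (Linear.zero-map ∂′-linear ρ) (sym (decidable-stable (c₁ ρ ℤP.≟ 0ℤ) (off ρ)))
    where
    off : ∀ ρ → ¬ (c₁ ρ ≢ 0ℤ)
    off ρ h with ι-support v c ρ h
    ... | v∉ρ , h′ = contradiction (trans (sym (∣p∪⁅x⁆∣ ρ v∉ρ)) (proj₂ (chain _ h′))) λ ()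
  fill-link (suc m) m<s chain
    with homologyVanishes-≐ (pureSkel-≐ eqL s)
        (vd⇒acyclic (closed-≐ (≐-sym eqL) (lk-closed cl v)) vdL s m (s<s⁻¹ m<s))
           c₁ chain₁ (λ ρ → trans (∂≡∂′ c₁ ρ) (∂′c₁ ρ))
    where
    chain₁ : IsChain (PureSkel (Lk K v) s) m c₁
    chain₁ σ h with ι-support v c σ h
    ... | v∉σ , h′ with chain _ h′
    ... | face , card = pureSkel-lk⁻ cl v v∉σ face , suc-injective (trans (sym (∣p∪⁅x⁆∣ σ v∉σ)) card)
  ... | d₁ , chain′ , ∂d₁ = d₁ , chain′ , λ ρ → trans (sym (∂≡∂′ d₁ ρ)) (∂d₁ ρ)

  fill : Σ[ d ∈ Chain n ] (IsChain (PureSkel K (suc s)) (suc m) d × (∀ ρ → ∂ d ρ ≡ c ρ))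
  fill with fill-link m m<s chain
  ... | d₁ , chain₁ , ∂d₁ with homologyVanishes-≐ (pureSkel-≐ eqD (suc s))
        (vd⇒acyclic (closed-≐ (≐-sym eqD) (del-closed cl v)) vdD (suc s) m m<s) c₀ chain₀
            (λ ρ → trans (∂≡∂′ c₀ ρ) (∂′c₀ ρ))
    where
    c₀ : Chain n
    c₀ σ = ι v (ε v c) σ ℤ.+ d₁ σ

    chain₀ : IsChain (PureSkel (Del K v) (suc s)) m c₀
    chain₀ σ h with +-≢0 h
    ... | inj₂ h₁ = pureSkel-lk⇒del cl v sh (proj₁ (chain₁ σ h₁)) , proj₂ (chain₁ σ h₁)
    ... | inj₁ h₀ with ι-support v (ε v c) σ h₀
    ... | v∉σ , h′ with chain σ (subst (λ τ → c τ ≢ 0ℤ) (p∪⁅x⁆-x≡p v∉σ) (proj₂ (ε-support v c _ h′)))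
    ... | face , card = pureSkel-del⁻ cl v sh v∉σ face , card

    ∂′c₀ : ∀ ρ → ∂′ c₀ ρ ≡ 0ℤ
    ∂′c₀ ρ = begin
      ∂′ c₀ ρ ≡⟨ Linear.additive ∂′-linear (ι v (ε v c)) d₁ ρ ⟩
      ∂′ (ι v (ε v c)) ρ ℤ.+ ∂′ d₁ ρ ≡⟨ cong₂ ℤ._+_ (∂′-ι v (ε v c) ρ) (∂d₁ ρ) ⟩
      ℤ.- ι v (∂′ (ε v c)) ρ ℤ.+ c₁ ρ ≡⟨ cong (λ z → ℤ.- z ℤ.+ c₁ ρ) (Linear.≗-cong (ι-linear v) ∂′εc ρ) ⟩
      ℤ.- c₁ ρ ℤ.+ c₁ ρ ≡⟨ ℤP.+-inverseˡ (c₁ ρ) ⟩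
      0ℤ ∎
      where
      ∂′εc : ∀ ρ → ∂′ (ε v c) ρ ≡ c ρ
      ∂′εc ρ = trans (∂′-ε v c ρ) (trans (cong (λ z → c ρ ℤ.- z)
          (trans (Linear.≗-cong (ε-linear v) ∂′c ρ) (Linear.zero-map (ε-linear v) ρ))) (ℤP.+-identityʳ (c ρ)))
  ... | d₀ , chain₀′ , ∂d₀ = d , chain-d , λ ρ → begin
      ∂ d ρ ≡⟨ ∂≡∂′ d ρ ⟩
      ∂′ d ρ ≡⟨ Linear.subtractive ∂′-linear d₀ (ε v d₁) ρ ⟩
      ∂′ d₀ ρ ℤ.- ∂′ (ε v d₁) ρ ≡⟨ cong₂ ℤ._-_ (trans (sym (∂≡∂′ d₀ ρ)) (∂d₀ ρ)) (∂′-ε v d₁ ρ) ⟩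
      (ι v (ε v c) ρ ℤ.+ d₁ ρ) ℤ.- (d₁ ρ ℤ.- ε v (∂′ d₁) ρ) ≡⟨ cong₂ (λ a b → (a ℤ.+ d₁ ρ) ℤ.- (d₁ ρ ℤ.- b))
          (ι-ε-same v c ρ) (Linear.≗-cong (ε-linear v) ∂d₁ ρ) ⟩
      ((c ρ ℤ.- ε v c₁ ρ) ℤ.+ d₁ ρ) ℤ.- (d₁ ρ ℤ.- ε v c₁ ρ) ≡⟨ cancel (c ρ) (ε v c₁ ρ) (d₁ ρ) ⟩
      c ρ ∎
    where
    d : Chain n
    d σ = d₀ σ ℤ.- ε v d₁ σ

    cancel : ∀ a b e → ((a ℤ.- b) ℤ.+ e) ℤ.- (e ℤ.- b) ≡ a
    cancel = solve-∀

    chain-d : IsChain (PureSkel K (suc s)) (suc m) d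
    chain-d σ h with subtract-≢0 h
    ... | inj₁ h₀ = pureSkel-del⁺ cl v (proj₁ (chain₀′ σ h₀)) , proj₂ (chain₀′ σ h₀)
    ... | inj₂ h₁ with ε-support v d₁ σ h₁
    ... | v∈σ , h′ with chain₁ _ h′
    ... | face , card = subst (PureSkel K (suc s)) (p-x∪⁅x⁆≡p v∈σ) (pureSkel-lk⁺ cl v face) ,
      trans (∣p∣≡1+∣p-x∣ σ v∈σ) (cong suc card)

-- Graphs without bad cycles

record Graph (n : ℕ) : Set₁ where
  infix 4 _~_ _#_
  field
    _~_ : Fin n → Fin n → Set
    _~?_ : ∀ x y → Dec (x ~ y)
    ~-sym : ∀ {x y} → x ~ y → y ~ x
    ~-irrefl : ∀ {x} → ¬ (x ~ x)

  _#_ : Fin n → Fin n → Set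
  x # y = x ≢ y × ¬ (x ~ y)

  _#?_ : ∀ x y → Dec (x # y)
  x #? y = ¬? (x Fin.≟ y) ×-dec ¬? (x ~? y)

  #-sym : ∀ {x y} → x # y → y # x
  #-sym (x≢y , x≁y) = x≢y ∘ sym , x≁y ∘ ~-sym

  data Compare (x y : Fin n) : Set where
    same : x ≡ y → Compare x y
    adjacent : x ~ y → Compare x y
    apart : x # y → Compare x y

  compare : ∀ x y → Compare x y
  compare x y with x Fin.≟ y | x ~? y
  ... | yes e | _ = same e
  ... | no _ | yes a = adjacent a
  ... | no e | no a = apart (e , a)

module _ {n} (G : Graph n) where
  open Graph G

  -- Indices run over ℕ with period `m`, so that subscripts need no reduction. Injectivity within a
  -- period is implied: neighbours differ because `~` is irreflexive, other vertices because `#`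
  -- includes distinctness.
  record BadCycle (c : ℕ → Fin n) (m : ℕ) : Set where
    field
      4≤m : 4 ≤ m
      m≢5 : m ≢ 5
      period : ∀ i → c (i + m) ≡ c i
      consecutive : ∀ i → c i ~ c (suc i)
      chordless : ∀ i j → 2 ≤ j → j + 2 ≤ m → c i # c (i + j)

  NoBadCycle : Subset n → Set
  NoBadCycle W = ∀ c m → BadCycle c m → (∀ i → c i ∈ W) → ⊥

  -- Periodic extension of a finite list. A pair that straddles the end of the list is read in
  -- reverse order; the last condition in `far` exempts the pair that `last` makes adjacent.
  close-up : ∀ (b : ℕ → Fin n) m .{{_ : NonZero m}} → 4 ≤ m → m ≢ 5 →
    (∀ i → suc i < m → b i ~ b (suc i)) → (∀ i → suc i ≡ m → b i ~ b 0) →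
    (∀ i j → i + 2 ≤ j → j < m → (i ≡ 0 → suc j < m) → b i # b j) →
    BadCycle (λ i → b (i % m)) m
  close-up b m 4≤m m≢5 step last far = record
    { 4≤m = 4≤m ; m≢5 = m≢5
    ; period = λ i → cong b ([m+n]%n≡m%n i m)
    ; consecutive = consecutive
    ; chordless = chordless }
    where
    reduce : ∀ i j → (i + j) % m ≡ (i % m + j) % m
    reduce i j = begin
      (i + j) % m ≡⟨ cong (λ k → (k + j) % m) (m≡m%n+[m/n]*n i m) ⟩
      (i % m + i / m * m + j) % m ≡⟨ cong (_% m) (+-assoc (i % m) _ j) ⟩
      (i % m + (i / m * m + j)) % m ≡⟨ cong (λ k → (i % m + k) % m) (+-comm _ j) ⟩
      (i % m + (j + i / m * m)) % m ≡⟨ cong (_% m) (+-assoc (i % m) j _) ⟨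
      (i % m + j + i / m * m) % m ≡⟨ [m+kn]%n≡m%n (i % m + j) (i / m) m ⟩
      (i % m + j) % m ∎
      where open ≡-Reasoning

    consecutive : ∀ i → b (i % m) ~ b (suc i % m)
    consecutive i with m≤n⇒m<n∨m≡n (m%n<n i m)
    ... | inj₁ lt = subst (λ k → b (i % m) ~ b k) (sym (trans (cong (_% m) (sym (+-comm i 1)))
      (trans (reduce i 1) (trans (cong (_% m) (+-comm (i % m) 1)) (m<n⇒m%n≡m lt))))) (step _ lt)
    ... | inj₂ eq = subst (λ k → b (i % m) ~ b k) (sym (trans (cong (_% m) (sym (+-comm i 1)))
      (trans (reduce i 1) (trans (cong (_% m) (trans (+-comm (i % m) 1) eq)) (n%n≡0 m))))) (last _ eq)

    chordless : ∀ i j → 2 ≤ j → j + 2 ≤ m → b (i % m) # b ((i + j) % m)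
    chordless i j 2≤j j+2≤m with i % m + j <? m
    ... | yes lt = subst (λ k → b (i % m) # b k) (sym (trans (reduce i j) (m<n⇒m%n≡m lt)))
      (far (i % m) (i % m + j) (+-monoʳ-≤ (i % m) 2≤j) lt λ r≡0 →
          subst (λ r → suc (r + j) < m) (sym r≡0) (subst (_≤ m) (+-comm j 2) j+2≤m))
    ... | no ≮ with m≤n⇒∃[o]m+o≡n (≮⇒≥ ≮)
    ... | t , m+t≡ = subst (λ k → b (i % m) # b k)
          (sym (trans (reduce i j) (trans (cong (_% m) (trans (sym m+t≡) (+-comm m t)))
          (trans ([m+n]%n≡m%n t m) (m<n⇒m%n≡m t<m)))))
      (#-sym (far t (i % m) t+2≤r (m%n<n i m) wrap))
      where
      r = i % m
      t+2≤r : t + 2 ≤ r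
      t+2≤r = +-cancelʳ-≤ j _ _ (begin
        t + 2 + j ≡⟨ trans (+-assoc t 2 j) (cong (t +_) (+-comm 2 j)) ⟩
        t + (j + 2) ≤⟨ +-monoʳ-≤ t j+2≤m ⟩
        t + m ≡⟨ +-comm t m ⟩
        m + t ≡⟨ m+t≡ ⟩
        r + j ∎)
        where open ≤-Reasoning
      t<m : t < m
      t<m = ≤-<-trans (≤-trans (m≤m+n t 2) t+2≤r) (m%n<n i m)
      wrap : t ≡ 0 → suc r < m
      wrap refl = begin-strict
        suc r <⟨ ≤-refl ⟩
        2 + r ≤⟨ +-monoˡ-≤ r 2≤j ⟩
        j + r ≡⟨ +-comm j r ⟩
        r + j ≡⟨ m+t≡ ⟨
        m + 0 ≡⟨ +-identityʳ m ⟩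
        m ∎
        where open ≤-Reasoning

  -- Induced paths and simplicial P₃

  P3 : Subset n → Fin n → Fin n → Fin n → Set
  P3 W a b c = (a ∈ W × b ∈ W × c ∈ W) × a ~ b × b ~ c × a # c

  HasP3 : Subset n → Set
  HasP3 W = ∃[ a ] ∃[ b ] ∃[ c ] P3 W a b c

  hasP3? : ∀ W → Dec (HasP3 W)
  hasP3? W = FinP.any? λ a → FinP.any? λ b → FinP.any? λ c →
    ((a ∈? W) ×-dec (b ∈? W) ×-dec (c ∈? W)) ×-dec (a ~? b) ×-dec (b ~? c) ×-dec (a #? c)

  -- If this fails for `x` and `y`, then x-a-b-c-y is an induced P₅.
  Simplicial : Subset n → Fin n → Fin n → Fin n → Set
  Simplicial W a b c = ∀ x y → x ∈ W → y ∈ W → x ~ a → x # b → x # c → y ~ c → y # b → y # a → ¬ (x # y)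

  record IPath (S : Fin n → Set) (x y : Fin n) (ℓ : ℕ) (p : ℕ → Fin n) : Set where
    field
      start : p 0 ≡ x
      end : p ℓ ≡ y
      inside-S : ∀ i → i ≤ ℓ → S (p i)
      step : ∀ i → i < ℓ → p i ~ p (suc i)
      far : ∀ i j → i + 2 ≤ j → j ≤ ℓ → p i # p j

    distinct : ∀ i j → i < j → j ≤ ℓ → p i ≢ p j
    distinct i j i<j j≤ℓ eq with m≤n⇒m<n∨m≡n i<j
    ... | inj₂ refl = ~-irrefl (subst (p i ~_) (sym eq) (step i j≤ℓ))
    ... | inj₁ lt = proj₁ (far i j (subst (_≤ j) (+-comm 2 i) lt) j≤ℓ) eq

  suffix : ∀ {S x y p} k {ℓ m} → k + ℓ ≡ m → IPath S x y m p → IPath S (p k) y ℓ (λ i → p (k + i))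
  suffix {p = p} k {ℓ} refl path = record
    { start = cong p (+-identityʳ k)
    ; end = end
    ; inside-S = λ i i≤ℓ → inside-S (k + i) (+-monoʳ-≤ k i≤ℓ)
    ; step = λ i i<ℓ → subst (λ j → p (k + i) ~ p j) (sym (+-suc k i)) (step (k + i) (+-monoʳ-< k i<ℓ))
    ; far = λ i j i+2≤j j≤ℓ → far (k + i) (k + j) (subst (_≤ k + j) (sym (+-assoc k i 2)) (+-monoʳ-≤ k i+2≤j))
        (+-monoʳ-≤ k j≤ℓ) }
    where open IPath path

  InducedPath : (Fin n → Set) → Fin n → Fin n → Set
  InducedPath S x y = ∃[ ℓ ] ∃[ p ] IPath S x y ℓ p

  -- If `x` touches the path beyond its first vertex, the part before the contact is cut off. After
  -- a contact by adjacency the argument restarts on the shorter path, and `fuel` bounds the number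
  -- of restarts.
  extend : ∀ {S x y} fuel ℓ p → ℓ ≤ fuel → S x → x ~ p 0 → IPath S (p 0) y ℓ p → InducedPath S x y
  extend {S} {x} fuel ℓ p ℓ≤ sx x~p path with FinP.any? {n = ℓ} (λ i → ¬? (x #? p (suc (toℕ i))))
  ... | no none = suc ℓ , p′ , record
    { start = refl ; end = end
    ; inside-S = λ { zero _ → sx ; (suc i) (s≤s i≤ℓ) → inside-S i i≤ℓ }
    ; step = λ { zero _ → x~p ; (suc i) (s≤s i<ℓ) → step i i<ℓ }
    ; far = λ { zero (suc zero) (s≤s ()) _ ; zero (suc (suc j)) _ (s≤s j<ℓ) → apart-from j j<ℓ
              ; (suc i) (suc j) (s≤s i+2≤j) (s≤s j≤ℓ) → far i j i+2≤j j≤ℓ } }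
    where
    open IPath path
    p′ : ℕ → Fin n
    p′ zero = x
    p′ (suc i) = p i
    apart-from : ∀ j → j < ℓ → x # p (suc j)
    apart-from j j<ℓ = decidable-stable (x #? p (suc j)) λ h →
      none (fromℕ< j<ℓ , subst (λ k → ¬ (x # p (suc k))) (sym (FinP.toℕ-fromℕ< j<ℓ)) h)
  ... | yes (i , ¬#) with m≤n⇒∃[o]m+o≡n (FinP.toℕ<n i) | compare x (p (suc (toℕ i)))
  ... | ℓ′ , eq | apart h = contradiction h ¬#
  ... | ℓ′ , eq | same refl = ℓ′ , _ , suffix (suc (toℕ i)) eq path
  extend {S} {x} {y} (suc fuel) ℓ p ℓ≤ sx x~p path | yes (i , ¬#) | ℓ′ , eq | adjacent x~ =
    extend fuel ℓ′ (λ j → p (suc (toℕ i) + j))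
        (≤-trans (m≤n+m ℓ′ (toℕ i)) (s≤s⁻¹ (subst (_≤ suc fuel) (sym eq) ℓ≤))) sx
      (subst (λ k → x ~ p k) (sym (+-identityʳ (suc (toℕ i)))) x~)
      (subst (λ k → IPath S (p k) y ℓ′ (λ j → p (suc (toℕ i) + j))) (sym (+-identityʳ (suc (toℕ i))))
          (suffix (suc (toℕ i)) eq path))
  extend zero ℓ p ℓ≤ sx x~p path | yes (i , ¬#) | ℓ′ , eq | adjacent x~ =
    contradiction (subst (_≤ 0) (sym eq) ℓ≤) λ ()

  data Walk (S : Fin n → Set) : Fin n → Fin n → Set where
    stop : ∀ {x} → S x → Walk S x x
    move : ∀ {x y z} → S x → x ~ y → Walk S y z → Walk S x z

  map-walk : ∀ {S T x y} → (∀ {z} → S z → T z) → Walk S x y → Walk T x y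
  map-walk f (stop s) = stop (f s)
  map-walk f (move s x~y w) = move (f s) x~y (map-walk f w)

  snoc : ∀ {S x y z} → Walk S x y → y ~ z → S z → Walk S x z
  snoc (stop s) y~z t = move s y~z (stop t)
  snoc (move s x~y w) y~z t = move s x~y (snoc w y~z t)

  induced-path : ∀ {S x y} → Walk S x y → InducedPath S x y
  induced-path {x = x} (stop s) = 0 , (λ _ → x) , record
    { start = refl ; end = refl ; inside-S = λ _ _ → s ; step = λ _ ()
    ; far = λ i j i+2≤j j≤0 → contradiction (≤-trans (m≤n+m 2 i) (≤-trans i+2≤j j≤0)) λ () }
  induced-path (move s x~y w) with induced-path w
  ... | ℓ , p , path with IPath.start path
  ... | refl = extend ℓ ℓ p ≤-refl s x~y path

  Joined : Subset n → Set
  Joined A = ∀ {x y} → x ∈ A → y ∈ A → Walk (_∈ A) x y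

  joined-⁅⁆ : ∀ v → Joined ⁅ v ⁆
  joined-⁅⁆ v x∈ y∈ with x∈⁅y⁆⇒x≡y v x∈ | x∈⁅y⁆⇒x≡y v y∈
  ... | refl | refl = stop x∈

  joined-∪ : ∀ {A a z} → Joined A → a ∈ A → z ~ a → Joined (A ∪ ⁅ z ⁆)
  joined-∪ {A} {a} {z} j a∈ z~a x∈ y∈ with x∈p∪⁅y⁆⁻ A x∈ | x∈p∪⁅y⁆⁻ A y∈
  ... | inj₁ x∈A | inj₁ y∈A = map-walk p⊆p∪⁅x⁆ (j x∈A y∈A)
  ... | inj₁ x∈A | inj₂ refl = snoc (map-walk p⊆p∪⁅x⁆ (j x∈A a∈)) (~-sym z~a) y∈
  ... | inj₂ refl | inj₁ y∈A = move x∈ z~a (map-walk p⊆p∪⁅x⁆ (j a∈ y∈A))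
  ... | inj₂ refl | inj₂ refl = stop x∈

  -- ℓ = 0 gives a 4-cycle, and ℓ ≥ 2 a cycle of length at least 6.
  cycle-through-P3 : ∀ {W a b c} ℓ (p : ℕ → Fin n) → NoBadCycle W → P3 W a b c → ℓ ≢ 1 →
    (∀ i → i ≤ ℓ → p i ∈ W) → p 0 ~ c → p ℓ ~ a →
    (∀ i → i < ℓ → p i ~ p (suc i)) → (∀ i j → i + 2 ≤ j → j ≤ ℓ → p i # p j) →
    (∀ i → i ≤ ℓ → p i # b) → (∀ i → i < ℓ → p (suc i) # c) → (∀ i → i < ℓ → p i # a) → ⊥
  cycle-through-P3 {W} {a} {b} {c} ℓ p noBad ((a∈ , b∈ , c∈) , a~b , b~c , a#c) ℓ≢1 p∈ p0~c pℓ~a step far p#b p#c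
      p#a =
    noBad _ (4 + ℓ) (close-up base (4 + ℓ) (m≤m+n 4 ℓ) (λ { refl → ℓ≢1 refl }) step′ last far′)
      λ i → base∈ (i % (4 + ℓ)) (m%n<n i (4 + ℓ))
    where
    base : ℕ → Fin n
    base 0 = a
    base 1 = b
    base 2 = c
    base (suc (suc (suc i))) = p i
    base∈ : ∀ i → i < 4 + ℓ → base i ∈ W
    base∈ 0 _ = a∈
    base∈ 1 _ = b∈
    base∈ 2 _ = c∈
    base∈ (suc (suc (suc i))) (s≤s (s≤s (s≤s (s≤s i≤ℓ)))) = p∈ i i≤ℓ
    step′ : ∀ i → suc i < 4 + ℓ → base i ~ base (suc i)
    step′ 0 _ = a~b
    step′ 1 _ = b~c
    step′ 2 _ = ~-sym p0~c
    step′ (suc (suc (suc i))) (s≤s (s≤s (s≤s (s≤s i<ℓ)))) = step i i<ℓ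
    last : ∀ i → suc i ≡ 4 + ℓ → base i ~ base 0
    last _ refl = pℓ~a
    far′ : ∀ i j → i + 2 ≤ j → j < 4 + ℓ → (i ≡ 0 → suc j < 4 + ℓ) → base i # base j
    far′ 0 2 _ _ _ = a#c
    far′ 0 (suc (suc (suc j))) _ _ wrap = #-sym (p#a j (s≤s⁻¹ (s≤s⁻¹ (s≤s⁻¹ (s≤s⁻¹ (wrap refl))))))
    far′ 1 (suc (suc (suc j))) _ (s≤s (s≤s (s≤s (s≤s j≤ℓ)))) _ = #-sym (p#b j j≤ℓ)
    far′ 2 (suc (suc (suc (suc j)))) _ (s≤s (s≤s (s≤s (s≤s j<ℓ)))) _ = #-sym (p#c j j<ℓ)
    far′ (suc (suc (suc i))) (suc (suc (suc j))) (s≤s (s≤s (s≤s i+2≤j))) (s≤s (s≤s (s≤s (s≤s j≤ℓ)))) _ =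
        far i j i+2≤j j≤ℓ
    far′ 0 0 () _ _
    far′ 0 1 (s≤s ()) _ _
    far′ 1 0 () _ _
    far′ 1 1 (s≤s ()) _ _
    far′ 1 2 (s≤s (s≤s ())) _ _
    far′ 2 0 () _ _
    far′ 2 1 (s≤s ()) _ _
    far′ 2 2 (s≤s (s≤s ())) _ _
    far′ 2 3 (s≤s (s≤s (s≤s ()))) _ _
    far′ (suc (suc (suc i))) 0 () _ _
    far′ (suc (suc (suc i))) 1 (s≤s ()) _ _
    far′ (suc (suc (suc i))) 2 (s≤s (s≤s ())) _ _

  away : Subset n → Fin n → Subset n
  away W v = ⟦ (λ x → (x ∈? W) ×-dec (x #? v)) ⟧

  module _ {W : Subset n} {v : Fin n} where

    ∈away⁺ : ∀ {x} → x ∈ W → x # v → x ∈ away W v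
    ∈away⁺ x∈ x#v = ∈⟦⟧⁺ (λ x → (x ∈? W) ×-dec (x #? v)) (x∈ , x#v)

    ∈away⁻ : ∀ {x} → x ∈ away W v → x ∈ W × x # v
    ∈away⁻ = ∈⟦⟧⁻ (λ x → (x ∈? W) ×-dec (x #? v))

  noBadCycle-⊆ : ∀ {V W} → V ⊆ W → NoBadCycle W → NoBadCycle V
  noBadCycle-⊆ V⊆W noBad c m bad c∈ = noBad c m bad (V⊆W ∘ c∈)

  HasSimplicial : Subset n → Set
  HasSimplicial W = ∃[ a ] ∃[ b ] ∃[ c ] (P3 W a b c × Simplicial W a b c)

  -- Dirac-type argument: A is connected and R is what is left of W after removing
  -- A and its neighbours.  Once no neighbour of A can be added to A without losing
  -- all induced P₃ in R, a P₃ that is simplicial in R is simplicial in W, since both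
  -- ends of an extending P₅ would be neighbours of A and close a long cycle through A.
  simplicial-P3 : ∀ k W → ∣ W ∣ < k → NoBadCycle W → HasP3 W → HasSimplicial W
  simplicial-P3 (suc k) W W<k noBad has@(a , b , c , path@((a∈ , b∈ , c∈) , a~b , b~c , a#c))
    with FinP.any? (λ v → (v ∈? W) ×-dec hasP3? (away W v))
  -- In an induced P₅ x-a-b-c-y the P₃ b-c-y is apart from `x`. If no vertex has a P₃ apart from it,
  -- every P₃ is simplicial.
  ... | no none = a , b , c , path , λ x y x∈ y∈ x~a x#b x#c y~c y#b y#a x#y →
      none (x , x∈ , b , c , y , (∈away⁺ b∈ (#-sym x#b) , ∈away⁺ c∈ (#-sym x#c) , ∈away⁺ y∈ (#-sym x#y)) , b~c ,
          ~-sym y~c , #-sym y#b)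
  ... | yes (v , v∈W , hasR) = grow n ⁅ v ⁆ (away W v) (m≤n+m n ∣ ⁅ v ⁆ ∣) (joined-⁅⁆ v)
        (λ x∈ → subst (_∈ W) (sym (x∈⁅y⁆⇒x≡y v x∈)) v∈W)
      (proj₁ ∘ ∈away⁻) (v , x∈⁅x⁆ v) (λ x∈ r∈ → subst (_# _) (sym (x∈⁅y⁆⇒x≡y v x∈)) (#-sym (proj₂ (∈away⁻ r∈))))
          complete hasR
    where
    Neighbour : Subset n → Fin n → Set
    Neighbour A x = ∃[ a ] (a ∈ A × x ~ a)

    neighbour? : ∀ A x → Dec (Neighbour A x)
    neighbour? A x = FinP.any? (λ a → (a ∈? A) ×-dec (x ~? a))

    complete : ∀ {x} → x ∈ W → x ∈ away W v ⊎ x ∈ ⁅ v ⁆ ⊎ Neighbour ⁅ v ⁆ x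
    complete {x} x∈ with compare x v
    ... | same refl = inj₂ (inj₁ (x∈⁅x⁆ v))
    ... | adjacent x~v = inj₂ (inj₂ (v , x∈⁅x⁆ v , x~v))
    ... | apart x#v = inj₁ (∈away⁺ x∈ x#v)

    grow : ∀ fuel A R → n ≤ ∣ A ∣ + fuel → Joined A → A ⊆ W → R ⊆ W → ∃[ a ] (a ∈ A) →
        (∀ {a r} → a ∈ A → r ∈ R → a # r) →
      (∀ {x} → x ∈ W → x ∈ R ⊎ x ∈ A ⊎ Neighbour A x) → HasP3 R → HasSimplicial W
    grow fuel A R le joined A⊆W R⊆W (a₀ , a₀∈A) A#R complete hasR
      with FinP.any? (λ x → (x ∈? W) ×-dec ¬? (x ∈? A) ×-dec neighbour? A x ×-dec hasP3? (away R x))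
    grow zero A R le joined A⊆W R⊆W _ A#R complete hasR | yes (x , x∈W , x∉A , _) =
      contradiction (subst (n <_) (sym (∣p∪⁅x⁆∣ A x∉A)) (s≤s (subst (n ≤_) (+-identityʳ _) le)))
          (≤⇒≯ (∣p∣≤n (A ∪ ⁅ x ⁆)))
    grow (suc fuel) A R le joined A⊆W R⊆W (a₀ , a₀∈A) A#R complete hasR | yes
        (x , x∈W , x∉A , (a , a∈A , x~a) , has′) =
      grow fuel (A ∪ ⁅ x ⁆) (away R x) (subst (n ≤_) (trans (+-suc _ fuel) (cong (_+ fuel) (sym (∣p∪⁅x⁆∣ A x∉A)))) le)
        (joined-∪ joined a∈A x~a) (∪⁅⁆-⊆ A⊆W x∈W) (R⊆W ∘ proj₁ ∘ ∈away⁻) (a₀ , p⊆p∪⁅x⁆ a₀∈A) apart′ complete′ has′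
      where
      apart′ : ∀ {a r} → a ∈ A ∪ ⁅ x ⁆ → r ∈ away R x → a # r
      apart′ a∈ r∈ with x∈p∪⁅y⁆⁻ A a∈ | ∈away⁻ r∈
      ... | inj₁ a∈A | r∈R , _ = A#R a∈A r∈R
      ... | inj₂ refl | _ , r#x = #-sym r#x
      complete′ : ∀ {z} → z ∈ W → z ∈ away R x ⊎ z ∈ A ∪ ⁅ x ⁆ ⊎ Neighbour (A ∪ ⁅ x ⁆) z
      complete′ {z} z∈ with complete z∈ | compare z x
      ... | inj₂ (inj₁ z∈A) | _ = inj₂ (inj₁ (p⊆p∪⁅x⁆ z∈A))
      ... | inj₂ (inj₂ (a , a∈A , z~a)) | _ = inj₂ (inj₂ (a , p⊆p∪⁅x⁆ a∈A , z~a))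
      ... | inj₁ z∈R | same refl = inj₂ (inj₁ (x∈p∪⁅x⁆ A))
      ... | inj₁ z∈R | adjacent z~x = inj₂ (inj₂ (x , x∈p∪⁅x⁆ A , z~x))
      ... | inj₁ z∈R | apart z#x = inj₁ (∈away⁺ z∈R z#x)
    grow fuel A R le joined A⊆W R⊆W (a₀ , a₀∈A) A#R complete hasR | no maximal
      with simplicial-P3 k R (<-≤-trans (p⊂q⇒∣p∣<∣q∣ (R⊆W , a₀ , A⊆W a₀∈A , λ a₀∈R → proj₁ (A#R a₀∈A a₀∈R) refl))
          (s≤s⁻¹ W<k)) (noBadCycle-⊆ R⊆W noBad) hasR
    ... | a , b , c , path@((a∈ , b∈ , c∈) , a~b , b~c , a#c) , simp = a , b , c ,
          ((R⊆W a∈ , R⊆W b∈ , R⊆W c∈) , a~b , b~c , a#c) , simp′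
      where
      not-in-A : ∀ {x r} → r ∈ R → x ~ r → x ∉ A
      not-in-A r∈R x~r x∈A = proj₂ (A#R x∈A r∈R) x~r

      -- if the other end y of the extension lies in R, then b, c, y is a P₃ in R far from x
      blocked : ∀ {a b c x y} → a ∈ R → b ∈ R → c ∈ R → b ~ c → x ∈ W → x ~ a → Neighbour A x → y ∈ R →
        x # b → x # c → y ~ c → y # b → ¬ (x # y)
      blocked {a} {b} {c} {x} {y} a∈ b∈ c∈ b~c x∈W x~a nb y∈R x#b x#c y~c y#b x#y =
          maximal (x , x∈W , not-in-A a∈ x~a , nb ,
        b , c , y , (∈away⁺ b∈ (#-sym x#b) , ∈away⁺ c∈ (#-sym x#c) , ∈away⁺ y∈R (#-sym x#y)) , b~c , ~-sym y~c ,
            #-sym y#b)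

      simp′ : Simplicial W a b c
      simp′ x y x∈ y∈ x~a x#b x#c y~c y#b y#a x#y with complete x∈ | complete y∈
      ... | inj₂ (inj₁ x∈A) | _ = not-in-A a∈ x~a x∈A
      ... | _ | inj₂ (inj₁ y∈A) = not-in-A c∈ y~c y∈A
      ... | inj₁ x∈R | inj₁ y∈R = simp x y x∈R y∈R x~a x#b x#c y~c y#b y#a x#y
      ... | inj₂ (inj₂ nb) | inj₁ y∈R = blocked a∈ b∈ c∈ b~c x∈ x~a nb y∈R x#b x#c y~c y#b x#y
      ... | inj₁ x∈R | inj₂ (inj₂ nb) = blocked c∈ b∈ a∈ (~-sym a~b) y∈ y~c nb x∈R y#b y#a x~a x#b (#-sym x#y)
      ... | inj₂ (inj₂ (a₁ , a₁∈ , x~a₁)) | inj₂ (inj₂ (a₂ , a₂∈ , y~a₂))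
        with induced-path (move {S = λ z → z ∈ A ⊎ z ≡ x ⊎ z ≡ y} (inj₂ (inj₂ refl)) y~a₂
            (snoc (map-walk inj₁ (joined a₂∈ a₁∈)) (~-sym x~a₁) (inj₂ (inj₁ refl))))
      ... | ℓ , p , ip = cycle-through-P3 ℓ p noBad ((R⊆W a∈ , R⊆W b∈ , R⊆W c∈) , a~b , b~c , a#c) ℓ≢1
          (λ i i≤ → in-W (inside-S i i≤)) (subst (_~ c) (sym start) y~c) (subst (_~ a) (sym end) x~a) step far
          (λ i i≤ → near-b (inside-S i i≤)) (λ i i<ℓ → near-c i i<ℓ (inside-S (suc i) i<ℓ))
              (λ i i<ℓ → near-a i i<ℓ (inside-S i (<⇒≤ i<ℓ)))
        where
        open IPath ip
        ℓ≢1 : ℓ ≢ 1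
        ℓ≢1 refl = proj₂ x#y (~-sym (subst₂ _~_ start end (step 0 (s≤s z≤n))))
        in-W : ∀ {z} → z ∈ A ⊎ z ≡ x ⊎ z ≡ y → z ∈ W
        in-W (inj₁ z∈A) = A⊆W z∈A
        in-W (inj₂ (inj₁ refl)) = x∈
        in-W (inj₂ (inj₂ refl)) = y∈
        near-b : ∀ {z} → z ∈ A ⊎ z ≡ x ⊎ z ≡ y → z # b
        near-b (inj₁ z∈A) = A#R z∈A b∈
        near-b (inj₂ (inj₁ refl)) = x#b
        near-b (inj₂ (inj₂ refl)) = y#b
        near-c : ∀ i → i < ℓ → p (suc i) ∈ A ⊎ p (suc i) ≡ x ⊎ p (suc i) ≡ y → p (suc i) # c
        near-c i i<ℓ (inj₁ z∈A) = A#R z∈A c∈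
        near-c i i<ℓ (inj₂ (inj₁ e)) = subst (_# c) (sym e) x#c
        near-c i i<ℓ (inj₂ (inj₂ e)) = contradiction (trans start (sym e)) (distinct 0 (suc i) (s≤s z≤n) i<ℓ)
        near-a : ∀ i → i < ℓ → p i ∈ A ⊎ p i ≡ x ⊎ p i ≡ y → p i # a
        near-a i i<ℓ (inj₁ z∈A) = A#R z∈A a∈
        near-a i i<ℓ (inj₂ (inj₁ e)) = contradiction (trans e (sym end)) (distinct i ℓ i<ℓ ≤-refl)
        near-a i i<ℓ (inj₂ (inj₂ e)) = subst (_# a) (sym e) y#a

  -- Shedding vertices in graph terms

  Independent : Subset n → Set
  Independent S = ∀ {x y} → x ∈ S → y ∈ S → ¬ (x ~ y)

  GraphShedding : Subset n → Fin n → Set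
  GraphShedding W v = ∀ (S : Subset n) → S ⊆ away W v → Independent S →
    ∃[ u ] (u ∈ W × u ≢ v × u ∉ S × ∀ {s} → s ∈ S → ¬ (s ~ u))

  -- A simplicial P₃ makes its middle `b` shedding: an independent set that blocks both `a` and `c`
  -- contains some `x ~ a` and `y ~ c`, distinct because there is no 4-cycle, and x-a-b-c-y would be
  -- an induced P₅. Without P₃ the components are cliques, and for an edge u-v the vertex `u` always
  -- extends a set of non-neighbours of `v`.
  shedding-vertex : ∀ W → NoBadCycle W → Independent W ⊎ ∃[ v ] (v ∈ W × GraphShedding W v)
  shedding-vertex W noBad with hasP3? W
  ... | yes has with simplicial-P3 (suc ∣ W ∣) W ≤-refl noBad has
  ... | a , b , c , path@((a∈ , b∈ , c∈) , a~b , b~c , a#c) , simp = inj₂ (b , b∈ , sh)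
    where
    apart-from-b : ∀ {S s} → S ⊆ away W b → s ∈ S → s ∈ W × s # b
    apart-from-b S⊆ s∈ = ∈away⁻ (S⊆ s∈)
    no-square : ∀ {s} → s ∈ W → s # b → s ~ c → s ~ a → ⊥
    -- The path of length 0 at `s` stands for the 4-cycle a-b-c-s.
    no-square {s} s∈ s#b s~c s~a = cycle-through-P3 0 (λ _ → s) noBad path (λ ()) (λ _ _ → s∈) s~c s~a (λ _ ())
      (λ i j i+2≤j j≤0 → contradiction (≤-trans (m≤n+m 2 i) (≤-trans i+2≤j j≤0)) λ ()) (λ _ _ → s#b) (λ _ ()) (λ _ ())
    sh : GraphShedding W b
    sh S S⊆ ind with FinP.any? (λ s → (s ∈? S) ×-dec (s ~? a)) | FinP.any? (λ s → (s ∈? S) ×-dec (s ~? c))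
    ... | no none | _ = a , a∈ , (λ { refl → ~-irrefl a~b }) , (λ a∈S → proj₂ (proj₂ (apart-from-b S⊆ a∈S)) a~b) ,
          λ s∈ s~a → none (_ , s∈ , s~a)
    ... | yes _ | no none = c , c∈ , (λ { refl → ~-irrefl b~c }) ,
          (λ c∈S → proj₂ (proj₂ (apart-from-b S⊆ c∈S)) (~-sym b~c)) , λ s∈ s~c → none (_ , s∈ , s~c)
    ... | yes (x , x∈S , x~a) | yes (y , y∈S , y~c) with apart-from-b S⊆ x∈S | apart-from-b S⊆ y∈S
    ... | x∈ , x#b | y∈ , y#b = ⊥-elim (simp x y x∈ y∈ x~a x#b x#c y~c y#b y#a x#y)
      where
      x#c : x # c
      x#c = (λ { refl → proj₂ x#b (~-sym b~c) }) , λ x~c → no-square x∈ x#b x~c x~a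
      y#a : y # a
      y#a = (λ { refl → proj₂ y#b a~b }) , λ y~a → no-square y∈ y#b y~c y~a
      x#y : x # y
      x#y = (λ { refl → proj₂ y#a x~a }) , ind x∈S y∈S
  shedding-vertex W noBad | no noP3
    with FinP.any? (λ u → FinP.any? (λ v → (u ∈? W) ×-dec (v ∈? W) ×-dec (u ~? v)))
  ... | no none = inj₁ λ x∈ y∈ x~y → none (_ , _ , x∈ , y∈ , x~y)
  ... | yes (u , v , u∈ , v∈ , u~v) = inj₂ (v , v∈ , λ S S⊆ ind → u , u∈ , (λ { refl → ~-irrefl u~v }) ,
      (λ u∈S → proj₂ (proj₂ (∈away⁻ (S⊆ u∈S))) u~v) ,
      λ {s} s∈ s~u → noP3 (s , u , v , (proj₁ (∈away⁻ (S⊆ s∈)) , u∈ , v∈) , s~u , u~v , proj₂ (∈away⁻ (S⊆ s∈))))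

-- Flag complexes

∣p∪q∣≡∣p∣+∣q∣ : ∀ {n} (p q : Subset n) → (∀ {x} → x ∈ p → x ∉ q) → ∣ p ∪ q ∣ ≡ ∣ p ∣ + ∣ q ∣
∣p∪q∣≡∣p∣+∣q∣ [] [] _ = refl
∣p∪q∣≡∣p∣+∣q∣ (inside ∷ p) (inside ∷ q) dis = contradiction here (dis here)
∣p∪q∣≡∣p∣+∣q∣ (inside ∷ p) (outside ∷ q) dis = cong suc (∣p∪q∣≡∣p∣+∣q∣ p q λ h h′ → dis (there h) (there h′))
∣p∪q∣≡∣p∣+∣q∣ (outside ∷ p) (inside ∷ q) dis =
    trans (cong suc (∣p∪q∣≡∣p∣+∣q∣ p q λ h h′ → dis (there h) (there h′))) (sym (+-suc ∣ p ∣ ∣ q ∣))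
∣p∪q∣≡∣p∣+∣q∣ (outside ∷ p) (outside ∷ q) dis = ∣p∪q∣≡∣p∣+∣q∣ p q λ h h′ → dis (there h) (there h′)

x∈p─q⇒x∉q : ∀ {n} (p q : Subset n) {x} → x ∈ p ─ q → x ∉ q
x∈p─q⇒x∉q (_ ∷ p) (_ ∷ q) (there h) (there h′) = x∈p─q⇒x∉q p q h h′
x∈p─q⇒x∉q (_ ∷ p) (_ ∷ q) {Fin.zero} () here

module Flag {n} (Γ : SC n) (Γ? : Decidable Γ) (cl : Closed Γ) (flag : IsFlag Γ) where

  -- An element of the ground set that is not a vertex of Γ is adjacent to all others; this is why
  -- the results below speak of subsets of `vertices`.
  incompatibility : Graph n
  incompatibility = record
    { _~_ = λ u v → u ≢ v × ¬ Γ (⁅ u ⁆ ∪ ⁅ v ⁆)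
    ; _~?_ = λ u v → ¬? (u Fin.≟ v) ×-dec ¬? (Γ? (⁅ u ⁆ ∪ ⁅ v ⁆))
    ; ~-sym = λ {u} {v} (u≢v , non) → u≢v ∘ sym , non ∘ subst Γ (∪-comm ⁅ v ⁆ ⁅ u ⁆)
    ; ~-irrefl = λ (x≢x , _) → x≢x refl }

  open Graph incompatibility

  vertex? : ∀ v → Dec (IsVertex Γ v)
  vertex? v = Γ? ⁅ v ⁆

  vertices : Subset n
  vertices = ⟦ vertex? ⟧

  ⁅⁆⊆ : ∀ {p : Subset n} {x} → x ∈ p → ⁅ x ⁆ ⊆ p
  ⁅⁆⊆ {p} {x} x∈p h = subst (_∈ p) (sym (x∈⁅y⁆⇒x≡y x h)) x∈p

  face⇒vertices : ∀ {σ} → Γ σ → σ ⊆ vertices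
  face⇒vertices {σ} γ x∈σ = ∈⟦⟧⁺ vertex? (cl σ _ (⁅⁆⊆ x∈σ) γ)

  face⇒independent : ∀ {σ} → Γ σ → Independent incompatibility σ
  face⇒independent {σ} γ {x} {y} x∈ y∈ (_ , non) = non (cl σ _ (∪⁅⁆-⊆ (⁅⁆⊆ x∈) y∈) γ)

  independent-⊆ : ∀ {σ τ} → τ ⊆ σ → Independent incompatibility σ → Independent incompatibility τ
  independent-⊆ τ⊆σ ind x∈ y∈ = ind (τ⊆σ x∈) (τ⊆σ y∈)

  -- Induction on size: the proper subsets are faces, so flagness leaves only pairs, and those the
  -- graph decides.
  independent⇒face : ∀ {σ} → σ ⊆ vertices → Independent incompatibility σ → Γ σ
  independent⇒face {σ} = go (suc ∣ σ ∣) σ ≤-refl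
    where
    go : ∀ k σ → ∣ σ ∣ < k → σ ⊆ vertices → Independent incompatibility σ → Γ σ
    go (suc k) σ σ<k σ⊆V ind with Γ? σ
    ... | yes γ = γ
    ... | no ¬γ = contradiction edge ¬γ
      where
      two : ∣ σ ∣ ≡ 2
      two = flag σ (∈⟦⟧⁻ vertex? ∘ σ⊆V) ¬γ λ τ τ⊂σ →
        go k τ (<-≤-trans (p⊂q⇒∣p∣<∣q∣ τ⊂σ) (s≤s⁻¹ σ<k)) (σ⊆V ∘ proj₁ τ⊂σ) (independent-⊆ (proj₁ τ⊂σ) ind)
      edge : Γ σ
      edge with ∣p∣<∣q∣⇒∃ ∅ σ (subst₂ _<_ (sym (∣⊥∣≡0 n)) (sym two) (s≤s z≤n))
      ... | u , u∈σ , _ with ∣p∣<∣q∣⇒∃ ⁅ u ⁆ σ (subst₂ _<_ (sym (∣⁅x⁆∣≡1 u)) (sym two) ≤-refl)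
      ... | v , v∈σ , v∉⁅u⁆ = subst Γ (⊆∧∣∣≡⇒≡ (∪⁅⁆-⊆ (⁅⁆⊆ u∈σ) v∈σ)
              (≤-reflexive (trans two (sym (trans (∣p∪⁅x⁆∣ ⁅ u ⁆ v∉⁅u⁆) (cong suc (∣⁅x⁆∣≡1 u)))))))
            (decidable-stable (Γ? _) λ non → ind u∈σ v∈σ ((λ { refl → v∉⁅u⁆ (x∈⁅x⁆ u) }) , non))

  induced-closed : ∀ W → Closed (Induced Γ W)
  induced-closed W σ τ τ⊆σ (σ⊆W , γ) = σ⊆W ∘ τ⊆σ , cl σ τ τ⊆σ γ

  induced? : ∀ W → Decidable (Induced Γ W)
  induced? W σ = (σ ⊆? W) ×-dec Γ? σ

  -- Deletion and link of `v` are induced again, on `W - v` and on the non-neighbours of `v`, so the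
  -- recursion stays among subsets of `W`.
  noBadCycle⇒vd : ∀ k W → ∣ W ∣ < k → W ⊆ vertices → NoBadCycle incompatibility W → VertexDecomposable (Induced Γ W)
  noBadCycle⇒vd (suc k) W W<k W⊆V noBad with shedding-vertex incompatibility W noBad
  ... | inj₁ ind = simplex W λ σ → proj₁ , λ σ⊆W → σ⊆W , cl W σ σ⊆W (independent⇒face W⊆V ind)
  ... | inj₂ (v , v∈W , sh) = shed v shedding
      deletion (noBadCycle⇒vd k (W - v) (<-≤-trans (x∈p⇒∣p-x∣<∣p∣ v∈W) (s≤s⁻¹ W<k)) (W⊆V ∘ p─q⊆p W ⁅ v ⁆)
          (noBadCycle-⊆ incompatibility (p─q⊆p W ⁅ v ⁆) noBad))
      link (noBadCycle⇒vd k R (<-≤-trans (p⊂q⇒∣p∣<∣q∣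
          (R⊆W , v , v∈W , λ v∈R → proj₁ (proj₂ (∈away⁻ incompatibility v∈R)) refl)) (s≤s⁻¹ W<k)) (W⊆V ∘ R⊆W)
          (noBadCycle-⊆ incompatibility R⊆W noBad))
    where
    R : Subset n
    R = away incompatibility W v

    R⊆W : R ⊆ W
    R⊆W = proj₁ ∘ ∈away⁻ incompatibility

    deletion : Induced Γ (W - v) ≐ Del (Induced Γ W) v
    deletion σ = (λ (σ⊆ , γ) → x∉p-x W ∘ σ⊆ , p─q⊆p W ⁅ v ⁆ ∘ σ⊆ , γ) ,
      λ (v∉σ , σ⊆W , γ) → (λ x∈ → x∈p∧x≢y⇒x∈p-y (σ⊆W x∈) λ { refl → v∉σ x∈ }) , γ

    link : Induced Γ R ≐ Lk (Induced Γ W) v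
    link σ = to , from
      where
      to : Induced Γ R σ → Lk (Induced Γ W) v σ
      to (σ⊆R , γ) = (λ v∈σ → proj₁ (proj₂ (∈away⁻ incompatibility (σ⊆R v∈σ))) refl) , σv⊆W ,
          independent⇒face (W⊆V ∘ σv⊆W) ind
        where
        σv⊆W : σ ∪ ⁅ v ⁆ ⊆ W
        σv⊆W = ∪⁅⁆-⊆ (R⊆W ∘ σ⊆R) v∈W
        ind : Independent incompatibility (σ ∪ ⁅ v ⁆)
        ind x∈ y∈ x~y with x∈p∪⁅y⁆⁻ σ x∈ | x∈p∪⁅y⁆⁻ σ y∈
        ... | inj₁ x∈σ | inj₁ y∈σ = face⇒independent γ x∈σ y∈σ x~y
        ... | inj₁ x∈σ | inj₂ refl = proj₂ (proj₂ (∈away⁻ incompatibility (σ⊆R x∈σ))) x~y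
        ... | inj₂ refl | inj₁ y∈σ = proj₂ (proj₂ (∈away⁻ incompatibility (σ⊆R y∈σ))) (~-sym x~y)
        ... | inj₂ refl | inj₂ refl = ~-irrefl x~y
      from : Lk (Induced Γ W) v σ → Induced Γ R σ
      from (v∉σ , σv⊆W , γ) = (λ x∈ → ∈away⁺ incompatibility (σv⊆W (p⊆p∪⁅x⁆ x∈))
          ((λ { refl → v∉σ x∈ }) , face⇒independent γ (p⊆p∪⁅x⁆ x∈) (x∈p∪⁅x⁆ σ))) , cl _ σ p⊆p∪⁅x⁆ γ

    shedding : Shedding (Induced Γ W) v
    shedding σ lk@(v∉σ , _) with proj₂ (link σ) lk
    ... | σ⊆R , γ with sh σ σ⊆R (face⇒independent γ)
    ... | u , u∈W , u≢v , u∉σ , σ≁u = u , u∉σ , v∉ , σu⊆W , independent⇒face (W⊆V ∘ σu⊆W) ind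
      where
      σu⊆W : σ ∪ ⁅ u ⁆ ⊆ W
      σu⊆W = ∪⁅⁆-⊆ (R⊆W ∘ σ⊆R) u∈W
      v∉ : v ∉ σ ∪ ⁅ u ⁆
      v∉ h with x∈p∪⁅y⁆⁻ σ h
      ... | inj₁ v∈σ = v∉σ v∈σ
      ... | inj₂ e = u≢v (sym e)
      ind : Independent incompatibility (σ ∪ ⁅ u ⁆)
      ind x∈ y∈ x~y with x∈p∪⁅y⁆⁻ σ x∈ | x∈p∪⁅y⁆⁻ σ y∈
      ... | inj₁ x∈σ | inj₁ y∈σ = face⇒independent γ x∈σ y∈σ x~y
      ... | inj₁ x∈σ | inj₂ refl = σ≁u x∈σ x~y
      ... | inj₂ refl | inj₁ y∈σ = σ≁u y∈σ (~-sym x~y)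
      ... | inj₂ refl | inj₂ refl = ~-irrefl x~y

  module _ {W} (W⊆V : W ⊆ vertices) (noBad : NoBadCycle incompatibility W) where

    induced-vd : VertexDecomposable (Induced Γ W)
    induced-vd = noBadCycle⇒vd (suc ∣ W ∣) W ≤-refl W⊆V noBad

    noBadCycle⇒shellable : Shellable (Induced Γ W)
    noBadCycle⇒shellable = vd⇒shellable (induced? W) (induced-closed W) induced-vd

    noBadCycle⇒partitionable : Partitionable (Induced Γ W)
    noBadCycle⇒partitionable = vd⇒partitionable (induced-closed W) induced-vd

  -- Links in a flag complex are induced subcomplexes.
  linkVertex? : ∀ W τ v → Dec (v ∈ W × v ∉ τ × Γ (τ ∪ ⁅ v ⁆))
  linkVertex? W τ v = (v ∈? W) ×-dec ¬? (v ∈? τ) ×-dec Γ? (τ ∪ ⁅ v ⁆)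

  linkVertices : Subset n → Subset n → Subset n
  linkVertices W τ = ⟦ linkVertex? W τ ⟧

  linkVertices⊆ : ∀ W τ → linkVertices W τ ⊆ W
  linkVertices⊆ W τ = proj₁ ∘ ∈⟦⟧⁻ (linkVertex? W τ)

  -- Removing and adding `τ` are inverse to each other here; flagness makes the union with `τ` a
  -- face. As `τ` lies in a face of size `s`, the subtraction does not truncate.
  pureSkel-link : ∀ {W s τ} → W ⊆ vertices → PureSkel (Induced Γ W) s τ →
    Link (PureSkel (Induced Γ W) s) τ ≐ PureSkel (Induced Γ (linkVertices W τ)) (s ∸ ∣ τ ∣)
  pureSkel-link {W} {s} {τ} W⊆V (ρ₀ , (ρ₀⊆W , γ₀) , τ⊆ρ₀ , size₀) η = to , from
    where
    X = linkVertices W τ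

    split : ∀ ρ → τ ⊆ ρ → (ρ ─ τ) ∪ τ ≡ ρ
    split ρ τ⊆ρ = ⊆-antisym (λ h → [ p─q⊆p ρ τ , τ⊆ρ ]′ (x∈p∪q⁻ (ρ ─ τ) τ h)) back
      where
      back : ρ ⊆ (ρ ─ τ) ∪ τ
      back {x} x∈ρ with x ∈? τ
      ... | yes x∈τ = q⊆p∪q (ρ ─ τ) τ x∈τ
      ... | no x∉τ = p⊆p∪q τ (x∈p∧x∉q⇒x∈p─q x∈ρ x∉τ)

    to : Link (PureSkel (Induced Γ W) s) τ η → PureSkel (Induced Γ X) (s ∸ ∣ τ ∣) η
    to (η∩τ≡∅ , ρ , (ρ⊆W , γ) , ητ⊆ρ , size) = ρ ─ τ , (in-X , cl ρ _ (p─q⊆p ρ τ) γ) ,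
        (λ x∈η → x∈p∧x∉q⇒x∈p─q (ητ⊆ρ (p⊆p∪q τ x∈η)) λ x∈τ → ∉⊥ (subst (_ ∈_) η∩τ≡∅ (x∈p∩q⁺ (x∈η , x∈τ)))) ,
        sym (trans (cong (_∸ ∣ τ ∣) (trans (sym size)
            (trans (cong ∣_∣ (sym (split ρ τ⊆ρ))) (∣p∪q∣≡∣p∣+∣q∣ (ρ ─ τ) τ (x∈p─q⇒x∉q ρ τ)))))
            (m+n∸n≡m ∣ ρ ─ τ ∣ ∣ τ ∣))
      where
      τ⊆ρ : τ ⊆ ρ
      τ⊆ρ x∈τ = ητ⊆ρ (q⊆p∪q η τ x∈τ)
      in-X : ρ ─ τ ⊆ X
      in-X x∈ = ∈⟦⟧⁺ (linkVertex? W τ) (ρ⊆W (p─q⊆p ρ τ x∈) , x∈p─q⇒x∉q ρ τ x∈ , cl ρ _ (∪⁅⁆-⊆ τ⊆ρ (p─q⊆p ρ τ x∈)) γ)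

    from : PureSkel (Induced Γ X) (s ∸ ∣ τ ∣) η → Link (PureSkel (Induced Γ W) s) τ η
    from (ρ , (ρ⊆X , γ) , η⊆ρ , size) =
        Empty-unique (λ (x , h) → ρ∌τ (η⊆ρ (proj₁ (x∈p∩q⁻ η τ h))) (proj₂ (x∈p∩q⁻ η τ h))) ,
        ρ ∪ τ , (ρτ⊆W , independent⇒face (W⊆V ∘ ρτ⊆W) ind) ,
        (λ h → [ p⊆p∪q τ ∘ η⊆ρ , q⊆p∪q ρ τ ]′ (x∈p∪q⁻ η τ h)) ,
        trans (∣p∪q∣≡∣p∣+∣q∣ ρ τ ρ∌τ) (trans (cong (_+ ∣ τ ∣) size)
            (m∸n+n≡m (subst (∣ τ ∣ ≤_) size₀ (p⊆q⇒∣p∣≤∣q∣ τ⊆ρ₀))))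
      where
      in-X : ∀ {x} → x ∈ ρ → x ∈ W × x ∉ τ × Γ (τ ∪ ⁅ x ⁆)
      in-X x∈ = ∈⟦⟧⁻ (linkVertex? W τ) (ρ⊆X x∈)
      ρ∌τ : ∀ {x} → x ∈ ρ → x ∉ τ
      ρ∌τ x∈ = proj₁ (proj₂ (in-X x∈))
      ρτ⊆W : ρ ∪ τ ⊆ W
      ρτ⊆W h = [ proj₁ ∘ in-X , ρ₀⊆W ∘ τ⊆ρ₀ ]′ (x∈p∪q⁻ ρ τ h)
      cross : ∀ {x y} → x ∈ ρ → y ∈ τ → ¬ (y ~ x)
      cross x∈ y∈ = face⇒independent (proj₂ (proj₂ (in-X x∈))) (p⊆p∪⁅x⁆ y∈) (x∈p∪⁅x⁆ τ)
      ind : Independent incompatibility (ρ ∪ τ)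
      ind x∈ y∈ x~y with x∈p∪q⁻ ρ τ x∈ | x∈p∪q⁻ ρ τ y∈
      ... | inj₁ x∈ρ | inj₁ y∈ρ = face⇒independent γ x∈ρ y∈ρ x~y
      ... | inj₁ x∈ρ | inj₂ y∈τ = cross x∈ρ y∈τ (~-sym x~y)
      ... | inj₂ x∈τ | inj₁ y∈ρ = cross y∈ρ x∈τ x~y
      ... | inj₂ x∈τ | inj₂ y∈τ = face⇒independent γ₀ (τ⊆ρ₀ x∈τ) (τ⊆ρ₀ y∈τ) x~y

  -- The top size `s′` of the link is forced to be `s ∸ ∣ τ ∣`. Below it the link is acyclic as the
  -- skeleton of a vertex decomposable complex, above it there are no faces.
  noBadCycle⇒seqCohenMacaulay : ∀ {W} → W ⊆ vertices → NoBadCycle incompatibility W → SeqCohenMacaulay (Induced Γ W)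
  noBadCycle⇒seqCohenMacaulay {W} W⊆V noBad s τ face@(ρ₀ , γ₀ , τ⊆ρ₀ , size₀) s′ (top , (top∈ , top-size) , bound) m
      m≢s′ =
    homologyVanishes-≐ (≐-sym link≐) vanishes
    where
    X = linkVertices W τ
    X⊆W : X ⊆ W
    X⊆W = linkVertices⊆ W τ
    link≐ = pureSkel-link W⊆V face
    s′≤ : s′ ≤ s ∸ ∣ τ ∣
    s′≤ with proj₁ (link≐ top) top∈
    ... | ρ , _ , top⊆ρ , size = subst₂ _≤_ top-size size (p⊆q⇒∣p∣≤∣q∣ top⊆ρ)
    ≤s′ : s ∸ ∣ τ ∣ ≤ s′
    ≤s′ with proj₁ (link≐ ∅) (∩-zeroˡ τ , subst (PureSkel (Induced Γ W) s) (sym (∪-identityˡ τ)) face)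
    ... | ρ , ρ∈ , _ , size = subst (_≤ s′) size (bound ρ (proj₂ (link≐ ρ) (ρ , ρ∈ , ⊆-refl , size)))
    vanishes : HomologyVanishes (PureSkel (Induced Γ X) (s ∸ ∣ τ ∣)) m
    vanishes with m <? s ∸ ∣ τ ∣
    ... | yes m< = vd⇒acyclic (induced-closed X) (induced-vd (W⊆V ∘ X⊆W) (noBadCycle-⊆ incompatibility X⊆W noBad))
          (s ∸ ∣ τ ∣) m m<
    ... | no m≮ = λ c chain _ → (λ _ → 0ℤ) , (λ _ h → contradiction refl h) , λ ρ →
        trans (∂≡∂′ (λ _ → 0ℤ) ρ) (trans (Linear.zero-map ∂′-linear ρ)
            (sym (decidable-stable (c ρ ℤP.≟ 0ℤ) λ h → too-big (chain ρ h))))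
      where
      s′<m : s′ < m
      s′<m = ≤∧≢⇒< (≤-trans s′≤ (≮⇒≥ m≮)) (m≢s′ ∘ sym)
      too-big : ∀ {ρ} → ¬ (PureSkel (Induced Γ X) (s ∸ ∣ τ ∣) ρ × ∣ ρ ∣ ≡ m)
      too-big ((σ , _ , ρ⊆σ , size) , card) = <⇒≱ s′<m (≤-trans (subst₂ _≤_ card size (p⊆q⇒∣p∣≤∣q∣ ρ⊆σ)) ≤s′)

-- Even cycles

parity : ∀ j → (∃[ i ] j ≡ i + i) ⊎ (∃[ i ] j ≡ suc (i + i))
parity zero = inj₁ (0 , refl)
parity (suc j) with parity j
... | inj₁ (i , e) = inj₂ (i , cong suc e)
... | inj₂ (i , e) = inj₁ (suc i , trans (cong suc e) (cong suc (sym (+-suc i i))))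

double-<⁻ : ∀ {i k} → i + i < k + k → i < k
double-<⁻ {i} {k} lt with i <? k
... | yes i<k = i<k
... | no i≮k = contradiction (+-mono-≤ (≮⇒≥ i≮k) (≮⇒≥ i≮k)) (<⇒≱ lt)

double-<-suc : ∀ {i k} → suc (i + i) < suc (k + k) → i < k
double-<-suc = double-<⁻ ∘ s<s⁻¹

IndependenceComplex : ∀ {n} → Graph n → Subset n → SC n
IndependenceComplex G W σ = σ ⊆ W × Independent G σ

module Cycle {n} (G : Graph n) {c : ℕ → Fin n} {m} (bad : BadCycle G c m) where
  open Graph G
  open BadCycle bad

  1≤m : 1 ≤ m
  1≤m = ≤-trans (s≤s z≤n) 4≤m

  instance
    m-nonZero : NonZero m
    m-nonZero = >-nonZero 1≤m

  image : Subset n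
  image = imgs c m

  period* : ∀ q i → c (i + q * m) ≡ c i
  period* zero i = cong c (+-identityʳ i)
  period* (suc q) i = trans (cong c (trans (cong (i +_) (+-comm m (q * m))) (sym (+-assoc i (q * m) m))))
      (trans (period (i + q * m)) (period* q i))

  c-% : ∀ p t → c (p + t % m) ≡ c (p + t)
  c-% p t = sym (trans (cong c (trans (cong (p +_) (m≡m%n+[m/n]*n t m)) (sym (+-assoc p (t % m) _))))
      (period* (t / m) (p + t % m)))

  c∈image : ∀ i → c i ∈ image
  c∈image i = subst (_∈ image) (c-% 0 i) (∈imgs⁺ c (m%n<n i m))

  reach : ∀ {x} → x ∈ image → ∀ p → ∃[ j ] (j < m × x ≡ c (p + j))
  reach x∈ p with ∈imgs⁻ c m x∈
  ... | i , _ , refl with m≤n⇒∃[o]m+o≡n (m≤n⇒m≤o+n i (m≤m*n p m))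
  ... | t , eq = t % m , m%n<n t m , sym (trans (c-% p t) (trans (cong c eq) (period* p i)))

  wrap-adjacent : ∀ i j → suc j ≡ m → c (i + j) ~ c i
  wrap-adjacent i j eq = subst (c (i + j) ~_) (trans (cong c (trans (sym (+-suc i j)) (cong (i +_) eq))) (period i))
      (consecutive (i + j))

  K : SC n
  K = IndependenceComplex G image

  K-closed : Closed K
  K-closed σ τ τ⊆σ (σ⊆ , ind) = σ⊆ ∘ τ⊆σ , λ x∈ y∈ → ind (τ⊆σ x∈) (τ⊆σ y∈)

  ⟨_⟩ : ℕ → ℕ → Subset n
  ⟨ k ⟩ p = imgs (λ i → c (p + (i + i))) k

  module _ {k} (2k≤m : k + k ≤ m) where

    even-chordless : ∀ p {i j} → i < j → j < k → c (p + (i + i)) # c (p + (j + j))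
    even-chordless p {i} {j} i<j j<k with m≤n⇒∃[o]m+o≡n i<j
    ... | t , refl = subst (λ q → c (p + (i + i)) # c q) (shape p i t)
          (chordless (p + (i + i)) (suc t + suc t)
          (≤-trans (m≤m+n 2 (t + t)) (≤-reflexive (cong suc (sym (+-suc t t)))))
      (≤-trans (subst (_≤ k + k) (shape′ t) (+-mono-≤ t<k t<k)) 2k≤m))
      where
      shape : ∀ p i t → p + (i + i) + (suc t + suc t) ≡ p + (suc i + t + (suc i + t))
      shape = ℕ-solve-∀
      shape′ : ∀ t → suc (suc t) + suc (suc t) ≡ suc t + suc t + 2
      shape′ = ℕ-solve-∀
      t<k : suc (suc t) ≤ k
      t<k = ≤-trans (s≤s (s≤s (m≤n+m t i))) j<k

    ⟨⟩-size : ∀ p → ∣ ⟨ k ⟩ p ∣ ≡ k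
    ⟨⟩-size p = ∣imgs∣ _ k λ i j i<j j<k → proj₁ (even-chordless p i<j j<k)

    ⟨⟩-face : ∀ p → K (⟨ k ⟩ p)
    ⟨⟩-face p = (λ x∈ → let (i , _ , e) = ∈imgs⁻ _ k x∈ in subst (_∈ image) (sym e) (c∈image _)) , ind
      where
      ind : Independent G (⟨ k ⟩ p)
      ind x∈ y∈ x~y with ∈imgs⁻ _ k x∈ | ∈imgs⁻ _ k y∈
      ... | i , i<k , refl | j , j<k , refl with <-cmp i j
      ... | tri< i<j _ _ = proj₂ (even-chordless p i<j j<k) x~y
      ... | tri≈ _ refl _ = ~-irrefl x~y
      ... | tri> _ _ j<i = proj₂ (even-chordless p j<i i<k) (~-sym x~y)

    -- A window of `2k` consecutive vertices falls into `k` adjacent pairs. An independent set takes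
    -- at most one vertex of each, so with `k` elements it meets them all.
    pair-hit : ∀ {ρ} → K ρ → ∣ ρ ∣ ≡ k → ∀ q → (∀ {x} → x ∈ ρ → ∃[ j ] (j < k + k × x ≡ c (q + j))) →
      ∀ {i} → i < k → c (q + (i + i)) ∈ ρ ⊎ c (suc (q + (i + i))) ∈ ρ
    pair-hit {ρ} (_ , ind) size q cov {i} i<k =
        conclude (all-hit Pair pair? k ρ covered separated (≤-reflexive (sym size)) i<k)
      where
      Pair : Fin n → ℕ → Set
      Pair x i = x ≡ c (q + (i + i)) ⊎ x ≡ c (suc (q + (i + i)))
      pair? : ∀ x i → Dec (Pair x i)
      pair? x i = (x Fin.≟ _) ⊎-dec (x Fin.≟ _)
      covered : Covered Pair pair? ρ k
      covered x∈ with cov x∈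
      ... | j , j<2k , e with parity j
      ... | inj₁ (i , refl) = i , double-<⁻ j<2k , inj₁ e
      ... | inj₂ (i , refl) = i , double-<⁻ (<-trans ≤-refl j<2k) , inj₂ (trans e (cong c (+-suc q (i + i))))
      separated : Separated Pair pair? ρ
      separated j x∈ y∈ (inj₁ refl) (inj₁ refl) = refl
      separated j x∈ y∈ (inj₁ refl) (inj₂ refl) = contradiction (consecutive _) (ind x∈ y∈)
      separated j x∈ y∈ (inj₂ refl) (inj₁ refl) = contradiction (consecutive _) (ind y∈ x∈)
      separated j x∈ y∈ (inj₂ refl) (inj₂ refl) = refl
      conclude : Hit Pair pair? ρ i → c (q + (i + i)) ∈ ρ ⊎ c (suc (q + (i + i))) ∈ ρ
      conclude (x , x∈ , inj₁ refl) = inj₁ x∈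
      conclude (x , x∈ , inj₂ refl) = inj₂ x∈

  alternate : ∀ {ρ} → (∀ q → c q ∈ ρ ⊎ c (suc q) ∈ ρ) → Independent G ρ → ∀ {p} i → c p ∈ ρ → c (p + (i + i)) ∈ ρ
  alternate {ρ} either ind {p} zero p∈ = subst (λ q → c q ∈ ρ) (sym (+-identityʳ p)) p∈
  alternate {ρ} either ind {p} (suc i) p∈ with alternate either ind i p∈ | either (suc (p + (i + i)))
  ... | h | inj₁ h′ = contradiction (consecutive _) (ind h h′)
  ... | h | inj₂ h′ = subst (λ q → c q ∈ ρ) (shape p i) h′
    where
    shape : ∀ p i → suc (suc (p + (i + i))) ≡ p + (suc i + suc i)
    shape = ℕ-solve-∀

module EvenCycle {n} (G : Graph n) {c : ℕ → Fin n} {m} (bad : BadCycle G c m) {k} (m≡ : m ≡ k + k) where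
  open Graph G
  open BadCycle bad
  open Cycle G bad

  2k≤m : k + k ≤ m
  2k≤m = ≤-reflexive (sym m≡)

  2≤k : 2 ≤ k
  2≤k with 2 ≤? k
  ... | yes le = le
  ... | no ≰ = contradiction (+-mono-≤ (s≤s⁻¹ (≰⇒> ≰)) (s≤s⁻¹ (≰⇒> ≰)))
        (<⇒≱ (≤-trans (s≤s (s≤s (s≤s z≤n))) (subst (4 ≤_) m≡ 4≤m)))

  -- An odd position has two even neighbours. The one other than `i` is returned, which still
  -- excludes the odd vertex when position `i` is missing. At the end of the turn it is position 0,
  -- and `2 ≤ k` keeps it different from `i`.
  next-even : ∀ p i → i < k → ∃[ i′ ] (i′ < k × i ≢ i′ × c (suc (p + (i + i))) ~ c (p + (i′ + i′)))
  next-even p i i<k with suc i <? k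
  ... | yes lt = suc i , lt , <⇒≢ ≤-refl , subst (λ q → c (suc (p + (i + i))) ~ c q) (shape p i) (consecutive _)
    where
    shape : ∀ p i → suc (suc (p + (i + i))) ≡ p + (suc i + suc i)
    shape = ℕ-solve-∀
  ... | no ≮ with ≤-antisym i<k (≮⇒≥ ≮)
  ... | refl = 0 , s≤s z≤n , (λ { refl → contradiction 2≤k λ { (s≤s ()) } }) ,
      subst₂ _~_ (cong c (shape p i)) (cong c (sym (+-identityʳ p)))
          (wrap-adjacent p (suc (i + i)) (trans (cong suc (sym (+-suc i i))) (sym m≡)))
    where
    shape : ∀ p i → p + suc (i + i) ≡ suc (p + (i + i))
    shape = ℕ-solve-∀

  -- Each odd vertex is adjacent to two of the alternate ones, and `σ` contains at least one of
  -- these. So even with one vertex removed, `⟨ k ⟩ p` lies in no other facet.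
  near-⟨⟩ : ∀ p i {σ} → K σ → (∀ {j} → j < k → j ≢ i → c (p + (j + j)) ∈ σ) → σ ⊆ ⟨ k ⟩ p
  near-⟨⟩ p i {σ} (σ⊆ , ind) h {x} x∈σ with reach (σ⊆ x∈σ) p
  ... | j , j<m , e with parity j
  ... | inj₁ (t , refl) = subst (_∈ ⟨ k ⟩ p) (sym e)
        (∈imgs⁺ (λ i → c (p + (i + i))) (double-<⁻ {t} {k} (subst (t + t <_) m≡ j<m)))
  ... | inj₂ (t , refl) with t<k | t ≟ i
    where
    t<k : t < k
    t<k = double-<⁻ (<-trans ≤-refl (subst (suc (t + t) <_) m≡ j<m))
  ... | t<k | no t≢i = contradiction (subst (c (p + (t + t)) ~_) (trans (cong c (sym (+-suc p (t + t)))) (sym e))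
        (consecutive _)) (ind (h t<k t≢i) x∈σ)
  ... | t<k | yes refl with next-even p t t<k
  ... | t′ , t′<k , t≢t′ , adj = contradiction
        (subst (_~ c (p + (t′ + t′))) (trans (cong c (sym (+-suc p (t + t)))) (sym e)) adj)
        (ind x∈σ (h t′<k (t≢t′ ∘ sym)))

  ⟨⟩-facet : ∀ p → IsFacet K (⟨ k ⟩ p)
  ⟨⟩-facet p = ⟨⟩-face {k} 2k≤m p , λ ρ kρ sub →
      ⊆-antisym (near-⟨⟩ p 0 kρ λ j<k _ → sub (∈imgs⁺ (λ i → c (p + (i + i))) j<k)) sub

  odd∉⟨⟩ : ∀ p → c (suc p) ∉ ⟨ k ⟩ p
  odd∉⟨⟩ p h = proj₂ (⟨⟩-face {k} 2k≤m p)
      (subst (_∈ ⟨ k ⟩ p) (cong c (+-identityʳ p)) (∈imgs⁺ (λ i → c (p + (i + i))) (≤-trans (s≤s z≤n) 2≤k))) h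
      (consecutive p)

  not-partitionable : ¬ Partitionable K
  not-partitionable (r , cover , disjoint) =
      odd∉⟨⟩ 0 (subst (c 1 ∈_) (sym same-facet) (∈imgs⁺ (λ i → c (1 + (i + i))) (≤-trans (s≤s z≤n) 2≤k)))
    where
    -- With `y` in the lower end, the facet minus `y` would have to be covered by another facet, and
    -- there is none.
    r∌ : ∀ p {y} → y ∈ r (⟨ k ⟩ p) → ⊥
    r∌ p {y} y∈ with cover (⟨ k ⟩ p) (⟨⟩-face {k} 2k≤m p)
    ... | σ , (kσ , _) , lo , hi with proj₂ (⟨⟩-facet p) σ kσ hi
    ... | refl with ∈imgs⁻ (λ i → c (p + (i + i))) k (lo y∈)
    ... | i , i<k , refl with cover (⟨ k ⟩ p - c (p + (i + i)))
          (K-closed _ _ (p─q⊆p (⟨ k ⟩ p) ⁅ c (p + (i + i)) ⁆) (⟨⟩-face {k} 2k≤m p))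
    ... | σ′ , (kσ′ , max′) , lo′ , hi′ with max′ _ (⟨⟩-face {k} 2k≤m p)
          (near-⟨⟩ p i kσ′ λ {j} j<k j≢i → hi′
          (x∈p∧x≢y⇒x∈p-y (∈imgs⁺ (λ i → c (p + (i + i))) j<k) (apart-index j<k j≢i)))
      where
      apart-index : ∀ {j} → j < k → j ≢ i → c (p + (j + j)) ≢ c (p + (i + i))
      apart-index {j} j<k j≢i with <-cmp j i
      ... | tri< j<i _ _ = proj₁ (even-chordless {k} 2k≤m p j<i i<k)
      ... | tri≈ _ e _ = contradiction e j≢i
      ... | tri> _ _ i<j = proj₁ (even-chordless {k} 2k≤m p i<j j<k) ∘ sym
    ... | refl = x∉p-x (⟨ k ⟩ p) (lo′ y∈)

    same-facet : ⟨ k ⟩ 0 ≡ ⟨ k ⟩ 1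
    same-facet = disjoint ∅ _ _ (⟨⟩-facet 0) (⟨⟩-facet 1) ((λ x∈ → ⊥-elim (r∌ 0 x∈)) , ⊥⊆)
        ((λ x∈ → ⊥-elim (r∌ 1 x∈)) , ⊥⊆)

  consecutive-hit : ∀ {ρ} → K ρ → ∣ ρ ∣ ≡ k → ∀ q → c q ∈ ρ ⊎ c (suc q) ∈ ρ
  consecutive-hit {ρ} kρ size q = subst (λ q → c q ∈ ρ ⊎ c (suc q) ∈ ρ) (+-identityʳ q)
    (pair-hit {k} 2k≤m kρ size q (λ x∈ → let (j , j<m , e) = reach (proj₁ kρ x∈) q in j , subst (j <_) m≡ j<m , e) (≤-trans (s≤s z≤n) 2≤k))

  -- Membership alternates all the way round, so one element decides the whole set.
  maximum : ∀ {ρ} → K ρ → ∣ ρ ∣ ≡ k → ρ ⊆ ⟨ k ⟩ 0 ⊎ ρ ⊆ ⟨ k ⟩ 1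
  maximum {ρ} kρ size with c 0 ∈? ρ | consecutive-hit kρ size 0
  ... | yes 0∈ | _ = inj₁ (near-⟨⟩ 0 0 kρ λ {j} _ _ → alternate (consecutive-hit kρ size) (proj₂ kρ) j 0∈)
  ... | no _ | inj₂ 1∈ = inj₂ (near-⟨⟩ 1 0 kρ λ {j} _ _ → alternate (consecutive-hit kρ size) (proj₂ kρ) j 1∈)
  ... | no 0∉ | inj₁ 0∈ = contradiction 0∈ 0∉

-- Odd cycles

-- The vertices of an odd cycle of length 2k+1, k = 1+κ, listed with step 2: the
-- non-neighbours of a vertex become an interval, and the independent sets of
-- maximum size are the arcs of length k.
record ArcCycle {n} (G : Graph n) (W : Subset n) (d : ℕ → Fin n) (κ : ℕ) : Set where
  open Graph G
  length : ℕ
  length = suc (suc κ + suc κ)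
  field
    2≤κ : 2 ≤ κ
    d∈W : ∀ i → d i ∈ W
    period : ∀ i → d (i + length) ≡ d i
    opposite : ∀ i → d i ~ d (i + suc κ)
    opposite′ : ∀ i → d i ~ d (i + suc (suc κ))
    close : ∀ i j → 1 ≤ j → j ≤ κ → d i # d (i + j)
    reach : ∀ {x} → x ∈ W → ∀ p → ∃[ j ] (j < length × x ≡ d (p + j))

-- Rotation turns a statement about the arc at 0 into one about every arc.
shift : ∀ {n} {G : Graph n} {W d κ} p → ArcCycle G W d κ → ArcCycle G W (λ i → d (p + i)) κ
shift {G = G} {d = d} p A = record
  { 2≤κ = 2≤κ
  ; d∈W = λ i → d∈W (p + i)
  ; period = λ i → trans (cong d (sym (+-assoc p i _))) (period (p + i))
  ; opposite = λ i → subst (λ q → d (p + i) ~ d q) (+-assoc p i _) (opposite (p + i))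
  ; opposite′ = λ i → subst (λ q → d (p + i) ~ d q) (+-assoc p i _) (opposite′ (p + i))
  ; close = λ i j 1≤j j≤κ → subst (λ q → d (p + i) # d q) (+-assoc p i j) (close (p + i) j 1≤j j≤κ)
  ; reach = λ x∈ q → map₂ (map₂ (λ e → trans e (cong d (+-assoc p q _)))) (reach x∈ (p + q)) }
  where
  open Graph G
  open ArcCycle A

module Arcs {n} {G : Graph n} {W d κ} (A : ArcCycle G W d κ) where
  open Graph G
  open ArcCycle A

  K : SC n
  K = IndependenceComplex G W

  arc : ℕ → Subset n
  arc p = imgs (λ i → d (p + i)) (suc κ)

  ∈arc : ∀ p {i} → i ≤ κ → d (p + i) ∈ arc p
  ∈arc p i≤κ = ∈imgs⁺ (λ i → d (p + i)) (s≤s i≤κ)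

  ∈arc⁻ : ∀ p {x} → x ∈ arc p → ∃[ i ] (i < suc κ × x ≡ d (p + i))
  ∈arc⁻ p = ∈imgs⁻ (λ i → d (p + i)) (suc κ)

  close-< : ∀ p {i j} → i < j → j < suc κ → d (p + i) # d (p + j)
  close-< p {i} {j} i<j j<k with m≤n⇒∃[o]m+o≡n i<j
  ... | t , refl = subst (λ q → d (p + i) # d q) (trans (+-assoc p i (suc t)) (cong (p +_) (+-suc i t)))
    (close (p + i) (suc t) (s≤s z≤n) (≤-trans (s≤s (m≤n+m t i)) (s≤s⁻¹ j<k)))

  index-injective : ∀ p {i j} → i < suc κ → j < suc κ → i ≢ j → d (p + i) ≢ d (p + j)
  index-injective p {i} {j} i<k j<k i≢j with <-cmp i j
  ... | tri< i<j _ _ = proj₁ (close-< p i<j j<k)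
  ... | tri≈ _ e _ = contradiction e i≢j
  ... | tri> _ _ j<i = proj₁ (close-< p j<i i<k) ∘ sym

  arc-face : ∀ p → K (arc p)
  arc-face p = (λ x∈ → let (i , _ , e) = ∈arc⁻ p x∈ in subst (_∈ W) (sym e) (d∈W (p + i))) , ind
    where
    ind : Independent G (arc p)
    ind x∈ y∈ x~y with ∈arc⁻ p x∈ | ∈arc⁻ p y∈
    ... | i , i<k , refl | j , j<k , refl with <-cmp i j
    ... | tri< i<j _ _ = proj₂ (close-< p i<j j<k) x~y
    ... | tri≈ _ refl _ = ~-irrefl x~y
    ... | tri> _ _ j<i = proj₂ (close-< p j<i i<k) (~-sym x~y)

  -- The positions outside the arc are `suc κ + i` with `i ≤ suc κ`, and the neighbours of such a
  -- vertex are at positions `i` and `i - 1`.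
  Excludes : ℕ → Subset n → ℕ → Set
  Excludes p σ i = (i < suc κ × d (p + i) ∈ σ) ⊎ (∃[ i′ ] (i ≡ suc i′ × d (p + i′) ∈ σ)) ⊎ d (p + (suc κ + i)) ∉ σ

  ⊆arc : ∀ p {σ} → K σ → (∀ i → i ≤ suc κ → Excludes p σ i) → σ ⊆ arc p
  ⊆arc p {σ} (σ⊆W , ind) ex {x} x∈σ with reach (σ⊆W x∈σ) p
  ... | j , j<len , refl with j <? suc κ
  ... | yes j<k = ∈arc p (s≤s⁻¹ j<k)
  ... | no j≮k with m≤n⇒∃[o]m+o≡n (≮⇒≥ j≮k)
  ... | i , refl with ex i (+-cancelˡ-≤ (suc κ) i (suc κ) (s≤s⁻¹ j<len))
  ... | inj₁ (_ , i∈σ) = contradiction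
        (subst (λ q → d (p + i) ~ d q) (trans (+-assoc p i _) (cong (p +_) (+-comm i _))) (opposite (p + i)))
        (ind i∈σ x∈σ)
  ... | inj₂ (inj₂ ∉σ) = contradiction x∈σ ∉σ
  ... | inj₂ (inj₁ (i′ , refl , i∈σ)) =
        contradiction (subst (λ q → d (p + i′) ~ d q) (shape p i′ κ) (opposite′ (p + i′))) (ind i∈σ x∈σ)
    where
    shape : ∀ p i κ → p + i + suc (suc κ) ≡ p + (suc κ + suc i)
    shape = ℕ-solve-∀

  arc-facet : ∀ p → IsFacet K (arc p)
  arc-facet p = arc-face p , λ ρ kρ arc⊆ρ → ⊆-antisym (⊆arc p kρ (excl arc⊆ρ)) arc⊆ρ
    where
    excl : ∀ {ρ} → arc p ⊆ ρ → ∀ i → i ≤ suc κ → Excludes p ρ i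
    excl sub i i≤k with m≤n⇒m<n∨m≡n i≤k
    ... | inj₁ i<k = inj₁ (i<k , sub (∈arc p (s≤s⁻¹ i<k)))
    ... | inj₂ refl = inj₂ (inj₁ (κ , refl , sub (∈arc p ≤-refl)))

  -- For an offset up to `suc κ` the vertex `d p` has a neighbour in `arc q`; beyond that, `d q` has
  -- one in `arc p`. A face cannot contain both.
  arc-distinct : ∀ {p q} → p < q → q < p + length → arc p ≢ arc q
  arc-distinct {p} p<q q<p+len eq with m≤n⇒∃[o]m+o≡n p<q
  ... | t , refl with t <? suc κ
  ... | yes t<k with m≤n⇒∃[o]m+o≡n (s≤s⁻¹ t<k)
  ... | s , refl = proj₂ (arc-face p) (subst (λ q → d q ∈ arc p) (+-identityʳ p) (∈arc p z≤n))
        (subst (d (p + suc (t + s)) ∈_) (sym eq)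
      (subst (λ r → d r ∈ arc (suc (p + t))) (shape p t s) (∈arc (suc (p + t)) (m≤n+m s t)))) (opposite p)
    where
    shape : ∀ p t s → suc (p + t) + s ≡ p + suc (t + s)
    shape = ℕ-solve-∀
  arc-distinct {p} p<q q<p+len eq | t , refl | no t≮k with m≤n⇒∃[o]m+o≡n (≮⇒≥ t≮k)
  ... | s , refl = proj₂ (arc-face p) (∈arc p s≤κ) (subst (d (suc (p + (suc κ + s))) ∈_) (sym eq)
      (subst (λ r → d r ∈ arc (suc (p + (suc κ + s)))) (+-identityʳ _) (∈arc _ z≤n)))
      (subst (λ r → d (p + s) ~ d r) (shape p s κ) (opposite′ (p + s)))
    where
    shape : ∀ p s κ → p + s + suc (suc κ) ≡ suc (p + (suc κ + s))
    shape = ℕ-solve-∀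
    s≤κ : s ≤ κ
    s≤κ = s≤s⁻¹ (+-cancelˡ-≤ (suc κ) (suc s) (suc κ)
        (s≤s⁻¹ (subst (_≤ length) (cong suc (sym (+-suc (suc κ) s)))
        (+-cancelˡ-< p _ _ (subst (_< p + length) (sym (+-suc p _)) q<p+len)))))

  -- Write T p for the lower end of the interval of arc p.  Only the two end points of
  -- an arc can lie in T p.  One of the arcs p and 1+p covers their intersection, so
  -- the left end of arc p and the right end of arc 1+p are not both in these lower ends.
  module Partitioned (partition : Partitionable K) where

    r : Subset n → Subset n
    r = proj₁ partition

    cover : ∀ η → K η → ∃[ σ ] (IsFacet K σ × InInterval (r σ) σ η)
    cover = proj₁ (proj₂ partition)

    disjoint : ∀ η σ σ′ → IsFacet K σ → IsFacet K σ′ → InInterval (r σ) σ η → InInterval (r σ′) σ′ η → σ ≡ σ′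
    disjoint = proj₂ (proj₂ partition)

    T : ℕ → Subset n
    T p = r (arc p)

    T⊆arc : ∀ p → T p ⊆ arc p
    T⊆arc p with cover (arc p) (arc-face p)
    ... | σ , (kσ , _) , lo , hi with proj₂ (arc-facet p) σ kσ hi
    ... | refl = lo

    subface : ∀ {p τ} → τ ⊆ arc p → K τ
    subface {p} sub = proj₁ (arc-face p) ∘ sub , λ x∈ y∈ → proj₂ (arc-face p) (sub x∈) (sub y∈)

    -- The remaining vertices of the arc still exclude every vertex outside, so the arc minus an
    -- inner vertex can be covered only by the arc itself.
    T-inner : ∀ p i → i < κ → d (p + suc i) ∉ T p ⊎ suc i ≡ κ
    T-inner p i i<κ with suc i ≟ κ
    ... | yes e = inj₂ e
    ... | no 1+i≢κ with cover (arc p - d (p + suc i)) (subface {p} (p─q⊆p (arc p) ⁅ d (p + suc i) ⁆))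
    ... | σ , (kσ , max) , lo , hi with max (arc p) (arc-face p) (⊆arc p kσ excl)
      where
      present : ∀ {j} → j ≤ κ → j ≢ suc i → d (p + j) ∈ σ
      present j≤κ j≢ = hi (x∈p∧x≢y⇒x∈p-y (∈arc p j≤κ) (index-injective p (s≤s j≤κ) (s≤s i<κ) j≢))
      excl : ∀ j → j ≤ suc κ → Excludes p σ j
      excl j j≤k with j ≟ suc i | m≤n⇒m<n∨m≡n j≤k
      ... | yes refl | _ = inj₂ (inj₁ (i , refl , present (<⇒≤ i<κ) (<⇒≢ ≤-refl)))
      ... | no j≢ | inj₁ j<k = inj₁ (j<k , present (s≤s⁻¹ j<k) j≢)
      ... | no j≢ | inj₂ refl = inj₂ (inj₁ (κ , refl , present ≤-refl (1+i≢κ ∘ sym)))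
    ... | refl = inj₁ λ h → x∉p-x (arc p) (lo h)

    T-ends : ∀ p {x} → x ∈ T p → x ≡ d p ⊎ x ≡ d (p + κ)
    T-ends p x∈ with ∈arc⁻ p (T⊆arc p x∈)
    ... | zero , _ , refl = inj₁ (cong d (+-identityʳ p))
    ... | suc i , s≤s i<κ , refl with T-inner p i i<κ
    ... | inj₁ ∉ = contradiction x∈ ∉
    ... | inj₂ refl = inj₂ refl

    1≤κ : 1 ≤ κ
    1≤κ = ≤-trans (s≤s z≤n) 2≤κ

    common : ℕ → Subset n
    common p = imgs (λ i → d (suc p + i)) κ

    ∈common : ∀ p {i} → i < κ → d (suc p + i) ∈ common p
    ∈common p = ∈imgs⁺ (λ i → d (suc p + i))

    ∈common′ : ∀ p {i} → i < κ → d (p + suc i) ∈ common p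
    ∈common′ p {i} i<κ = subst (λ q → d q ∈ common p) (sym (+-suc p i)) (∈common p i<κ)

    last∈common : ∀ p → d (p + κ) ∈ common p
    last∈common p with m≤n⇒∃[o]m+o≡n 1≤κ
    ... | κ′ , eq = subst (λ i → d (p + i) ∈ common p) eq (∈common′ p (≤-reflexive eq))

    common⊆left : ∀ p → common p ⊆ arc p
    common⊆left p x∈ with ∈imgs⁻ (λ i → d (suc p + i)) κ x∈
    ... | i , i<κ , refl = subst (λ q → d q ∈ arc p) (+-suc p i) (∈arc p i<κ)

    left∉common : ∀ p → d p ∉ common p
    left∉common p h with ∈imgs⁻ (λ i → d (suc p + i)) κ h
    ... | i , i<κ , e = index-injective p {0} {suc i} (s≤s z≤n) (s≤s i<κ)
          (λ ()) (trans (cong d (+-identityʳ p)) (trans e (cong d (sym (+-suc p i)))))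

    right∉common : ∀ p → d (suc p + κ) ∉ common p
    right∉common p h with ∈imgs⁻ (λ i → d (suc p + i)) κ h
    ... | i , i<κ , e = index-injective (suc p) (m<n⇒m<1+n i<κ) ≤-refl (<⇒≢ i<κ) (sym e)

    not-both : ∀ p → d p ∉ T p ⊎ d (suc p + κ) ∉ T (suc p)
    not-both p with cover (common p) (subface {p} (common⊆left p))
    ... | σ , (kσ , max) , lo , hi with d (suc p + κ) ∈? σ
    ... | yes right∈σ with proj₂ (arc-facet (suc p)) σ kσ arc⊆σ
      where
      arc⊆σ : arc (suc p) ⊆ σ
      arc⊆σ x∈ with ∈arc⁻ (suc p) x∈
      ... | i , i<k , refl with m<1+n⇒m<n∨m≡n i<k
      ... | inj₁ i<κ = hi (∈common p i<κ)
      ... | inj₂ refl = right∈σ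
    ... | refl = inj₂ λ h → right∉common p (lo h)
    not-both p | σ , (kσ , max) , lo , hi | no right∉σ with max (arc p) (arc-face p) (⊆arc p kσ excl)
      where
      excl : ∀ j → j ≤ suc κ → Excludes p σ j
      excl zero _ = inj₂ (inj₂ (right∉σ ∘ subst (λ q → d q ∈ σ)
          (trans (cong (p +_) (+-identityʳ (suc κ))) (+-suc p κ))))
      excl (suc j) j≤κ with m≤n⇒m<n∨m≡n (s≤s⁻¹ j≤κ)
      ... | inj₁ j<κ = inj₁ (s≤s j<κ , hi (∈common′ p j<κ))
      ... | inj₂ refl = inj₂ (inj₁ (j , refl , hi (last∈common p)))
    ... | refl = inj₁ λ h → left∉common p (lo h)

    -- The singleton of `x` would lie in the intervals of two different facets.
    no-double : ∀ {p q x} → p < q → q < p + length → x ∈ arc p → x ∈ arc q → T p ⊆ ⁅ x ⁆ → T q ⊆ ⁅ x ⁆ → ⊥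
    no-double {p} {q} {x} p<q q< x∈p x∈q Tp Tq = arc-distinct p<q q<
      (disjoint ⁅ x ⁆ _ _ (arc-facet p) (arc-facet q) (Tp , single x∈p) (Tq , single x∈q))
      where
      single : ∀ {ρ} → x ∈ ρ → ⁅ x ⁆ ⊆ ρ
      single {ρ} x∈ h = subst (_∈ ρ) (sym (x∈⁅y⁆⇒x≡y x h)) x∈

    T⊆left : ∀ p → d (p + κ) ∉ T p → T p ⊆ ⁅ d p ⁆
    T⊆left p ∉ x∈ with T-ends p x∈
    ... | inj₁ refl = x∈⁅x⁆ (d p)
    ... | inj₂ refl = contradiction x∈ ∉

    T⊆right : ∀ p → d p ∉ T p → T p ⊆ ⁅ d (p + κ) ⁆
    T⊆right p ∉ x∈ with T-ends p x∈
    ... | inj₁ refl = contradiction x∈ ∉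
    ... | inj₂ refl = x∈⁅x⁆ (d (p + κ))

    d∈arc : ∀ p → d p ∈ arc p
    d∈arc p = subst (λ q → d q ∈ arc p) (+-identityʳ p) (∈arc p z≤n)

    -- If T 0 = ∅, the vertices are used up one by one as right ends, until after one
    -- turn the vertex d 0 is needed a second time.
    module _ (T0≡∅ : ∀ {x} → x ∉ T 0) where

      left∉T : ∀ p → suc p < length → ∀ p′ → p′ ≤ p → d p′ ∉ T p′
      left∉T zero _ _ z≤n = T0≡∅
      left∉T (suc p) p+2<len p′ p′≤ with m≤n⇒m<n∨m≡n p′≤
      ... | inj₁ p′<1+p = left∉T p (<-trans ≤-refl p+2<len) p′ (s≤s⁻¹ p′<1+p)
      ... | inj₂ refl = λ left∈ → clash left∈
        where
        IH = left∉T p (<-trans ≤-refl p+2<len)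
        clash : d (suc p) ∈ T (suc p) → ⊥
        clash left∈ with not-both (suc p)
        ... | inj₁ left∉ = left∉ left∈
        -- Now the lower end of the arc at `2 + p` is at most its left end. That vertex is already
        -- taken: by arc 0 if it lies there, otherwise as the right end of some arc `t`, where
        -- `2 ≤ κ` gives `t ≤ p`.
        ... | inj₂ right∉ with suc (suc p) ≤? κ
        ... | yes le = no-double {0} {suc (suc p)} (s≤s z≤n) p+2<len (∈arc 0 le) (d∈arc _)
              (λ h → contradiction h T0≡∅) (T⊆left _ right∉)
        ... | no ≰ with m≤n⇒∃[o]m+o≡n (<⇒≤ (≰⇒> ≰))
        ... | t , eq = no-double {t} {suc (suc p)} (s≤s (m≤n⇒m≤1+n t≤p)) (<-≤-trans p+2<len (m≤n+m length t))
              (subst (λ q → d q ∈ arc t) t+κ (∈arc t ≤-refl)) (d∈arc _)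
            (subst (λ q → T t ⊆ ⁅ d q ⁆) t+κ (T⊆right t (IH t t≤p))) (T⊆left _ right∉)
          where
          t+κ : t + κ ≡ suc (suc p)
          t+κ = trans (+-comm t κ) eq
          t≤p : t ≤ p
          t≤p = +-cancelˡ-≤ 2 t p (≤-trans (+-monoˡ-≤ t 2≤κ) (≤-reflexive eq))

      T0-nonempty : ⊥
      -- The arc at `3 + κ` is the one whose right end, at position `3 + 2κ`, the length, is `d 0`
      -- again.
      T0-nonempty = no-double {0} {3 + κ} {d 0} (s≤s z≤n) (s≤s (s≤s wide)) (d∈arc 0)
        (subst (_∈ arc (3 + κ)) turn (∈arc (3 + κ) ≤-refl)) (λ h → contradiction h T0≡∅)
        (subst (λ x → T (3 + κ) ⊆ ⁅ x ⁆) turn (T⊆right (3 + κ) (left∉T (3 + κ) (s≤s (s≤s wide′)) (3 + κ) ≤-refl)))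
        where
        wide′ : 3 + κ ≤ κ + suc κ
        wide′ = ≤-trans (s≤s (+-monoˡ-≤ κ 2≤κ)) (≤-reflexive (sym (+-suc κ κ)))
        wide : 2 + κ ≤ κ + suc κ
        wide = ≤-trans (n≤1+n _) wide′
        turn : d (3 + κ + κ) ≡ d 0
        turn = trans (cong d (cong suc (cong suc (sym (+-suc κ κ))))) (period 0)

-- Since no lower end is empty, one left end in its lower end forces the same for all later arcs.
-- Hence each `x` has an arc with lower end inside the singleton of `x`. The facet that covers ∅
-- also covers such a singleton, so it is that arc and has an empty lower end.
not-partitionable-odd : ∀ {n} {G : Graph n} {W d κ} → ArcCycle G W d κ → ¬ Partitionable (IndependenceComplex G W)
not-partitionable-odd {n} {G} {W} {d} {κ} A partition = conclusion
  where
  open Graph G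
  open ArcCycle A
  open Arcs A
  open Partitioned partition

  T-nonempty : ∀ p → (∀ {x} → x ∉ T p) → ⊥
  T-nonempty p = Arcs.Partitioned.T0-nonempty (shift p A) partition

  left-or-right : ∀ p → d p ∈ T p ⊎ d (p + κ) ∈ T p
  left-or-right p with d p ∈? T p | d (p + κ) ∈? T p
  ... | yes h | _ = inj₁ h
  ... | no _ | yes h = inj₂ h
  ... | no l∉ | no r∉ = ⊥-elim (T-nonempty p λ x∈ → [ (λ { refl → l∉ x∈ }) , (λ { refl → r∉ x∈ }) ]′ (T-ends p x∈))

  propagate : ∀ p → d p ∈ T p → d (suc p) ∈ T (suc p) × d (suc p + κ) ∉ T (suc p)
  propagate p left∈ with not-both p
  ... | inj₁ left∉ = contradiction left∈ left∉
  ... | inj₂ right∉ with left-or-right (suc p)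
  ... | inj₁ h = h , right∉
  ... | inj₂ h = contradiction h right∉

  propagate* : ∀ i p → d p ∈ T p → d (suc (i + p)) ∈ T (suc (i + p)) × d (suc (i + p) + κ) ∉ T (suc (i + p))
  propagate* zero p h = propagate p h
  propagate* (suc i) p h = propagate (suc (i + p)) (proj₁ (propagate* i p h))

  singleton-covered : ∀ {x} → x ∈ W → ∃[ p ] (x ∈ arc p × T p ⊆ ⁅ x ⁆)
  -- `x` is the right end of arc `j` and the left end of arc `κ + j`. If the former does not serve,
  -- propagation by `κ` steps leads to the latter.
  singleton-covered x∈ with reach x∈ κ
  ... | j , _ , refl with d j ∈? T j
  ... | no left∉ = j , subst (λ q → d q ∈ arc j) (+-comm j κ) (∈arc j ≤-refl) ,
        subst (λ q → T j ⊆ ⁅ d q ⁆) (+-comm j κ) (T⊆right j left∉)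
  ... | yes left∈ with m≤n⇒∃[o]m+o≡n 1≤κ
  ... | κ′ , eq = κ + j , d∈arc (κ + j) ,
        T⊆left (κ + j) (subst (λ i → d (i + j + κ) ∉ T (i + j)) eq (proj₂ (propagate* κ′ j left∈)))

  conclusion : ⊥
  conclusion with cover ∅ ((λ h → contradiction h ∉⊥) , λ h → contradiction h ∉⊥)
  ... | σ , facet@((σ⊆W , _) , max) , lo , _ with nonempty? σ
  ... | no empty = ∉⊥ (subst (d 0 ∈_)
        (trans (max (arc 0) (arc-face 0) (λ h → ⊥-elim (empty (_ , h)))) (Empty-unique empty)) (d∈arc 0))
  ... | yes (x , x∈σ) with singleton-covered (σ⊆W x∈σ)
  ... | p , x∈arc , Tp with disjoint ⁅ x ⁆ σ (arc p) facet (arc-facet p)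
        ((λ h → contradiction (lo h) ∉⊥) , (λ h → subst (_∈ σ) (sym (x∈⁅y⁆⇒x≡y x h)) x∈σ))
        (Tp , (λ h → subst (_∈ arc p) (sym (x∈⁅y⁆⇒x≡y x h)) x∈arc))
  ... | refl = T-nonempty p λ h → ∉⊥ (lo h)

module OddCycle {n} (G : Graph n) {c : ℕ → Fin n} {m} (bad : BadCycle G c m) {κ} (m≡ : m ≡ suc (suc κ + suc κ)) where
  open Graph G
  open BadCycle bad
  open Cycle G bad

  d : ℕ → Fin n
  d i = c (i + i)

  -- Adding the odd length to `2i - 1` and `2i + 1` gives the even subscripts `2(i + suc κ)` and
  -- `2(i + suc (suc κ))`, the two neighbours of `d i`.
  arcCycle : ArcCycle G image d κ
  arcCycle = record
    { 2≤κ = 2≤κ′ κ m≡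
    ; d∈W = λ i → c∈image (i + i)
    ; period = λ i → trans (cong c (trans (cong (λ l → i + l + (i + l)) (sym m≡)) (shape₁ i m))) (period* 2 (i + i))
    ; opposite = λ i → ~-sym (subst (c (i + suc κ + (i + suc κ)) ~_)
        (trans (cong c (trans (shape₂ i κ) (cong (i + i +_) (sym m≡)))) (period (i + i))) (consecutive _))
    ; opposite′ = λ i → subst (c (i + i) ~_)
        (trans (sym (period (suc (i + i)))) (cong c (trans (cong (suc (i + i) +_) m≡) (shape₃ i κ))))
        (consecutive (i + i))
    ; close = λ i j 1≤j j≤κ → subst (λ q → c (i + i) # c q) (shape₄ i j) (chordless (i + i) (j + j) (+-mono-≤ 1≤j 1≤j)
        (subst (j + j + 2 ≤_) (sym m≡) (≤-trans (+-monoˡ-≤ 2 (+-mono-≤ j≤κ j≤κ))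
            (≤-trans (n≤1+n _) (≤-reflexive (shape₅ κ))))))
    ; reach = reach′ }
    where
    2≤κ′ : ∀ κ → m ≡ suc (suc κ + suc κ) → 2 ≤ κ
    2≤κ′ zero e = contradiction (subst (4 ≤_) e 4≤m) λ { (s≤s (s≤s (s≤s ()))) }
    2≤κ′ (suc zero) e = contradiction e m≢5
    2≤κ′ (suc (suc _)) _ = s≤s (s≤s z≤n)
    shape₁ : ∀ i m → i + m + (i + m) ≡ i + i + (m + (m + 0))
    shape₁ = ℕ-solve-∀
    shape₂ : ∀ i κ → suc (i + suc κ + (i + suc κ)) ≡ i + i + suc (suc κ + suc κ)
    shape₂ = ℕ-solve-∀
    shape₃ : ∀ i κ → suc (i + i) + suc (suc κ + suc κ) ≡ i + suc (suc κ) + (i + suc (suc κ))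
    shape₃ = ℕ-solve-∀
    shape₄ : ∀ i j → i + i + (j + j) ≡ i + j + (i + j)
    shape₄ = ℕ-solve-∀
    shape₅ : ∀ κ → suc (κ + κ + 2) ≡ suc (suc κ + suc κ)
    shape₅ = ℕ-solve-∀
    reach′ : ∀ {x} → x ∈ image → ∀ p → ∃[ j ] (j < suc (suc κ + suc κ) × x ≡ d (p + j))
    reach′ x∈ p with reach x∈ (p + p)
    ... | t , t<m , e with parity t
    ... | inj₁ (j , refl) = j , subst (j <_) m≡ (≤-<-trans (m≤m+n j j) t<m) , trans e (cong c (shape₄ p j))
    ... | inj₂ (j , refl) = suc κ + suc j ,
          s≤s (+-monoʳ-≤ (suc κ) (s≤s (s≤s⁻¹ (double-<-suc {j} {suc κ} (subst (suc (j + j) <_) m≡ t<m))))) ,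
        trans e (trans (sym (period (p + p + suc (j + j))))
            (cong c (trans (cong (p + p + suc (j + j) +_) m≡) (shape₆ p j κ))))
      where
      shape₆ : ∀ p j κ → p + p + suc (j + j) + suc (suc κ + suc κ) ≡ p + (suc κ + suc j) + (p + (suc κ + suc j))
      shape₆ = ℕ-solve-∀

-- Detecting homology

one : ∀ {n} → Chain n
one [] = 1ℤ
one (outside ∷ ρ) = one ρ
one (inside ∷ ρ) = 0ℤ

one-support : ∀ {n} (σ : Subset n) → one σ ≢ 0ℤ → σ ≡ ∅
one-support [] _ = refl
one-support (outside ∷ σ) h = cong (outside ∷_) (one-support σ h)
one-support (inside ∷ σ) h = contradiction refl h

one-∅ : ∀ n → one {n} ∅ ≡ 1ℤ
one-∅ zero = refl
one-∅ (suc n) = one-∅ n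

ι-one : ∀ {n} (v : Fin n) ρ → ι v one ρ ≡ 0ℤ
ι-one Fin.zero (outside ∷ ρ) = refl
ι-one Fin.zero (inside ∷ ρ) = refl
ι-one (Fin.suc v) (outside ∷ ρ) = ι-one v ρ
ι-one (Fin.suc v) (inside ∷ ρ) = cong ℤ.-_ (Linear.zero-map (ι-linear v) ρ)

∂′-one : ∀ {n} (ρ : Subset n) → ∂′ one ρ ≡ 0ℤ
∂′-one [] = refl
∂′-one (outside ∷ ρ) = trans (ℤP.+-identityˡ _) (∂′-one ρ)
∂′-one (inside ∷ ρ) = cong ℤ.-_ (Linear.zero-map ∂′-linear ρ)

point : ∀ {n} → Fin n → Chain n
point x = ε x one

edge : ∀ {n} → Fin n → Fin n → Chain n
edge x y = ε x (point y)

∂′-point : ∀ {n} (x : Fin n) ρ → ∂′ (point x) ρ ≡ one ρ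
∂′-point x ρ = trans (∂′-ε x one ρ)
    (trans (cong (λ z → one ρ ℤ.- z) (trans (Linear.≗-cong (ε-linear x) ∂′-one ρ) (Linear.zero-map (ε-linear x) ρ)))
    (ℤP.+-identityʳ _))

∂′-edge : ∀ {n} (x y : Fin n) ρ → ∂′ (edge x y) ρ ≡ point y ρ ℤ.- point x ρ
∂′-edge x y ρ = trans (∂′-ε x (point y) ρ) (cong (λ z → point y ρ ℤ.- z) (Linear.≗-cong (ε-linear x) (∂′-point y) ρ))

point-support : ∀ {n} (x : Fin n) σ → point x σ ≢ 0ℤ → σ ≡ ⁅ x ⁆
point-support x σ h with ε-support x one σ h
... | x∈σ , h′ = trans (sym (p-x∪⁅x⁆≡p x∈σ)) (trans (cong (_∪ ⁅ x ⁆) (one-support (σ - x) h′)) (∪-identityˡ ⁅ x ⁆))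

edge-support : ∀ {n} (x y : Fin n) σ → edge x y σ ≢ 0ℤ → σ ≡ ⁅ y ⁆ ∪ ⁅ x ⁆ × ∣ σ ∣ ≡ 2
edge-support x y σ h with ε-support x (point y) σ h
... | x∈σ , h′ with point-support y (σ - x) h′
... | e = trans (sym (p-x∪⁅x⁆≡p x∈σ)) (cong (_∪ ⁅ x ⁆) e) ,
      trans (∣p∣≡1+∣p-x∣ σ x∈σ) (cong suc (trans (cong ∣_∣ e) (∣⁅x⁆∣≡1 y)))

-- The Kronecker delta, in the form in which contractions produce it.
δ : ∀ {n} → Fin n → Fin n → ℤ
δ u a = ι u (point a) ∅

δ-same : ∀ {n} (a : Fin n) → δ a a ≡ 1ℤ
δ-same {n} a = trans (ι-ε-same a one ∅) (cong₂ ℤ._-_ (one-∅ n) (ε-∅ a (ι a one)))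

δ-distinct : ∀ {n} {u a : Fin n} → u ≢ a → δ u a ≡ 0ℤ
δ-distinct {u = u} {a} u≢a = trans (ι-ε-distinct u≢a one ∅) (cong ℤ.-_ (ε-∅ a (ι u one)))

ι-ε-∅ : ∀ {n} (u a : Fin n) c → ι u (ε a c) ∅ ≡ δ u a ℤ.* c ∅
ι-ε-∅ {n} u a c with u Fin.≟ a
... | yes refl = begin
    ι u (ε u c) ∅ ≡⟨ ι-ε-same u c ∅ ⟩
    c ∅ ℤ.- ε u (ι u c) ∅ ≡⟨ cong (λ z → c ∅ ℤ.- z) (ε-∅ u (ι u c)) ⟩
    c ∅ ℤ.+ 0ℤ ≡⟨ ℤP.+-identityʳ _ ⟩
    c ∅ ≡⟨ ℤP.*-identityˡ _ ⟨
    1ℤ ℤ.* c ∅ ≡⟨ cong (ℤ._* c ∅) (δ-same u) ⟨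
    δ u u ℤ.* c ∅ ∎
  where
  open ≡-Reasoning
... | no u≢a = trans (vanish c) (sym (trans (cong (ℤ._* c ∅) (vanish one)) (ℤP.*-zeroˡ (c ∅))))
  where
  vanish : ∀ c → ι u (ε a c) ∅ ≡ 0ℤ
  vanish c = trans (ι-ε-distinct u≢a c ∅) (cong ℤ.-_ (ε-∅ a (ι u c)))

sumFin-pick : ∀ {n} (a : Fin n) (f g : Fin n → ℤ) → g a ≡ 1ℤ → (∀ u → u ≢ a → g u ≡ 0ℤ) →
    sumFin (λ u → f u ℤ.* g u) ≡ f a
sumFin-pick {suc n} Fin.zero f g ga≡1 g≡0 = begin
  f Fin.zero ℤ.* g Fin.zero ℤ.+ sumFin (λ u → f (Fin.suc u) ℤ.* g (Fin.suc u)) ≡⟨ cong₂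
      (λ a b → f Fin.zero ℤ.* a ℤ.+ b) ga≡1
      (trans (sumFin-cong (λ u → trans (cong (f (Fin.suc u) ℤ.*_)
      (g≡0 (Fin.suc u) λ ())) (ℤP.*-zeroʳ (f (Fin.suc u))))) (sumFin-0 n)) ⟩
  f Fin.zero ℤ.* 1ℤ ℤ.+ 0ℤ ≡⟨ trans (ℤP.+-identityʳ _) (ℤP.*-identityʳ _) ⟩
  f Fin.zero ∎
  where open ≡-Reasoning
sumFin-pick (Fin.suc a) f g ga≡1 g≡0 =
    trans (cong₂ ℤ._+_ (trans (cong (f Fin.zero ℤ.*_) (g≡0 Fin.zero λ ())) (ℤP.*-zeroʳ (f Fin.zero)))
  (sumFin-pick a (f ∘ Fin.suc) (g ∘ Fin.suc) ga≡1 λ u u≢a → g≡0 (Fin.suc u) (u≢a ∘ FinP.suc-injective)))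
      (ℤP.+-identityˡ _)

sum-δ : ∀ {n} (f : Fin n → ℤ) a → sumFin (λ u → f u ℤ.* δ u a) ≡ f a
sum-δ f a = sumFin-pick a f (λ u → δ u a) (δ-same a) λ u → δ-distinct

-- `edge a b` is the product a ∧ b, so its coefficients are 2 by 2 determinants of deltas.
ι-ι-edge : ∀ {n} (a b u v : Fin n) → ι v (ι u (edge a b)) ∅ ≡ δ u a ℤ.* δ v b ℤ.- δ v a ℤ.* δ u b
ι-ι-edge a b u v with u Fin.≟ a
... | yes refl = begin
    ι v (ι u (edge u b)) ∅ ≡⟨ Linear.≗-cong (ι-linear v) (ι-ε-same u (point b)) ∅ ⟩
    ι v (λ ρ → point b ρ ℤ.- ε u (ι u (point b)) ρ) ∅ ≡⟨ Linear.subtractive (ι-linear v) (point b)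
        (ε u (ι u (point b))) ∅ ⟩
    δ v b ℤ.- ι v (ε u (ι u (point b))) ∅ ≡⟨ cong (λ z → δ v b ℤ.- z) (ι-ε-∅ v u (ι u (point b))) ⟩
    δ v b ℤ.- δ v u ℤ.* δ u b ≡⟨ cong (ℤ._- (δ v u ℤ.* δ u b))
        (trans (cong (ℤ._* δ v b) (δ-same u)) (ℤP.*-identityˡ (δ v b))) ⟨
    δ u u ℤ.* δ v b ℤ.- δ v u ℤ.* δ u b ∎
  where open ≡-Reasoning
... | no u≢a = begin
    ι v (ι u (edge a b)) ∅ ≡⟨ Linear.≗-cong (ι-linear v) (ι-ε-distinct u≢a (point b)) ∅ ⟩
    ι v (λ ρ → ℤ.- ε a (ι u (point b)) ρ) ∅ ≡⟨ Linear.negative (ι-linear v) (ε a (ι u (point b))) ∅ ⟩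
    ℤ.- ι v (ε a (ι u (point b))) ∅ ≡⟨ cong ℤ.-_ (ι-ε-∅ v a (ι u (point b))) ⟩
    ℤ.- (δ v a ℤ.* δ u b) ≡⟨ ℤP.+-identityˡ _ ⟨
    0ℤ ℤ.- δ v a ℤ.* δ u b ≡⟨ cong (ℤ._- (δ v a ℤ.* δ u b))
        (trans (cong (ℤ._* δ v b) (δ-distinct u≢a)) (ℤP.*-zeroˡ (δ v b))) ⟨
    δ u a ℤ.* δ v b ℤ.- δ v a ℤ.* δ u b ∎
  where open ≡-Reasoning

∂′-∅-neg : ∀ {n} (u : Fin n) e → ι u (∂′ e) ∅ ≡ ℤ.- sumFin (λ v → ι v (ι u e) ∅)
∂′-∅-neg u e = trans (sym (ℤP.neg-involutive _)) (cong ℤ.-_ (trans (sym (∂′-ι u e ∅)) (∂′-∅ (ι u e))))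

x+x≡0⇒x≡0 : ∀ x → x ℤ.+ x ≡ 0ℤ → x ≡ 0ℤ
x+x≡0⇒x≡0 x h = ℤP.*-cancelˡ-≡ (ℤ.+ 2) x 0ℤ (trans (double x) h)
  where
  double : ∀ x → ℤ.+ 2 ℤ.* x ≡ x ℤ.+ x
  double = solve-∀

x+x+x≡0⇒x≡0 : ∀ x → x ℤ.+ (x ℤ.+ x) ≡ 0ℤ → x ≡ 0ℤ
x+x+x≡0⇒x≡0 x h = ℤP.*-cancelˡ-≡ (ℤ.+ 3) x 0ℤ (trans (triple x) h)
  where
  triple : ∀ x → ℤ.+ 3 ℤ.* x ≡ x ℤ.+ (x ℤ.+ x)
  triple = solve-∀

-- Pairing chains with cocycles of degree 0 and 1

module _ {n} {K : SC n} (χ : Fin n → ℤ) (constant : ∀ {σ u v} → K σ → u ∈ σ → v ∈ σ → χ u ≡ χ v) where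

  total : Chain n → ℤ
  total e = sumFin λ u → χ u ℤ.* ι u e ∅

  -- On an edge `χ u` may be replaced by `χ v`, while the coefficient changes sign when the indices
  -- are swapped. So the double sum is its own negative, and ℤ has no 2-torsion.
  total-∂ : ∀ {e} → IsChain K 2 e → total (∂′ e) ≡ 0ℤ
  total-∂ {e} chain = trans total≡-S (cong ℤ.-_ (x+x≡0⇒x≡0 S (trans (cong (λ z → S ℤ.+ z) S≡-S) (ℤP.+-inverseʳ S))))
    where
    open ≡-Reasoning
    D : Fin n → Fin n → ℤ
    D u v = ι v (ι u e) ∅
    S : ℤ
    S = sumFin λ u → sumFin λ v → χ u ℤ.* D u v
    total≡-S : total (∂′ e) ≡ ℤ.- S
    total≡-S = begin
      total (∂′ e) ≡⟨ sumFin-cong (λ u → trans (cong (χ u ℤ.*_) (∂′-∅-neg u e))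
          (sym (ℤP.neg-distribʳ-* (χ u) (sumFin (D u))))) ⟩
      sumFin (λ u → ℤ.- (χ u ℤ.* sumFin (D u))) ≡⟨ sumFin-neg (λ u → χ u ℤ.* sumFin (D u)) ⟩
      ℤ.- sumFin (λ u → χ u ℤ.* sumFin (D u)) ≡⟨ cong ℤ.-_ (sumFin-cong (λ u → sumFin-* (χ u) (D u))) ⟨
      ℤ.- S ∎
    same-χ : ∀ u v → χ u ℤ.* D u v ≡ χ v ℤ.* D u v
    same-χ u v with D u v ℤP.≟ 0ℤ
    ... | yes D≡0 = trans (cong (χ u ℤ.*_) D≡0)
          (trans (ℤP.*-zeroʳ (χ u)) (sym (trans (cong (χ v ℤ.*_) D≡0) (ℤP.*-zeroʳ (χ v)))))
    ... | no D≢0 with ι-support v (ι u e) ∅ D≢0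
    ... | _ , h with ι-support u e _ h
    ... | _ , h′ = cong (ℤ._* D u v) (constant (proj₁ (chain _ h′)) (x∈p∪⁅x⁆ _) (p⊆p∪⁅x⁆ (x∈p∪⁅x⁆ ∅)))
    S≡-S : S ≡ ℤ.- S
    S≡-S = begin
      S ≡⟨ sumFin-cong (λ u → sumFin-cong (same-χ u)) ⟩
      sumFin (λ u → sumFin λ v → χ v ℤ.* D u v) ≡⟨ sumFin-swap (λ u v → χ v ℤ.* D u v) ⟩
      sumFin (λ v → sumFin λ u → χ v ℤ.* D u v) ≡⟨ sumFin-cong
          (λ v → sumFin-cong λ u → trans (cong (χ v ℤ.*_) (ι-ι v u e ∅)) (sym (ℤP.neg-distribʳ-* (χ v) (D v u)))) ⟩
      sumFin (λ v → sumFin λ u → ℤ.- (χ v ℤ.* D v u)) ≡⟨ sumFin-cong (λ v → sumFin-neg (λ u → χ v ℤ.* D v u)) ⟩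
      sumFin (λ v → ℤ.- sumFin (λ u → χ v ℤ.* D v u)) ≡⟨ sumFin-neg (λ v → sumFin (λ u → χ v ℤ.* D v u)) ⟩
      ℤ.- S ∎

  separated⇒H₀≢0 : ∀ {x y} → K ⁅ x ⁆ → K ⁅ y ⁆ → χ x ≢ χ y → ¬ HomologyVanishes K 1
  separated⇒H₀≢0 {x} {y} kx ky χx≢χy vanishes with vanishes c chain cycle
    where
    c : Chain n
    c ρ = point x ρ ℤ.- point y ρ
    chain : IsChain K 1 c
    chain σ h with subtract-≢0 h
    ... | inj₁ hx = subst (λ σ → K σ × ∣ σ ∣ ≡ 1) (sym (point-support x σ hx)) (kx , ∣⁅x⁆∣≡1 x)
    ... | inj₂ hy = subst (λ σ → K σ × ∣ σ ∣ ≡ 1) (sym (point-support y σ hy)) (ky , ∣⁅x⁆∣≡1 y)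
    cycle : ∀ ρ → ∂ c ρ ≡ 0ℤ
    cycle ρ = trans (∂≡∂′ c ρ) (trans (Linear.subtractive ∂′-linear (point x) (point y) ρ)
        (trans (cong₂ ℤ._-_ (∂′-point x ρ) (∂′-point y ρ)) (ℤP.+-inverseʳ (one ρ))))
  ... | e , chain-e , ∂e = χx≢χy (ℤP.i-j≡0⇒i≡j (χ x) (χ y) (begin
      χ x ℤ.- χ y ≡⟨ cong₂ ℤ._-_ (sum-δ χ x) (sum-δ χ y) ⟨
      total (point x) ℤ.- total (point y) ≡⟨ cong (λ z → total (point x) ℤ.+ z) (sumFin-neg (λ u → χ u ℤ.* δ u y)) ⟨
      total (point x) ℤ.+ sumFin (λ u → ℤ.- (χ u ℤ.* δ u y)) ≡⟨ sumFin-+ (λ u → χ u ℤ.* δ u x)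
          (λ u → ℤ.- (χ u ℤ.* δ u y)) ⟨
      sumFin (λ u → χ u ℤ.* δ u x ℤ.+ ℤ.- (χ u ℤ.* δ u y)) ≡⟨ sumFin-cong (λ u → factor (χ u) (δ u x) (δ u y)) ⟩
      sumFin (λ u → χ u ℤ.* (δ u x ℤ.- δ u y)) ≡⟨ sumFin-cong
          (λ u → cong (χ u ℤ.*_) (trans (Linear.≗-cong (ι-linear u) (λ ρ → trans (sym (∂≡∂′ e ρ)) (∂e ρ)) ∅)
          (Linear.subtractive (ι-linear u) (point x) (point y) ∅))) ⟨
      total (∂′ e) ≡⟨ total-∂ chain-e ⟩
      0ℤ ∎))
    where
    open ≡-Reasoning
    factor : ∀ a b c → a ℤ.* b ℤ.+ ℤ.- (a ℤ.* c) ≡ a ℤ.* (b ℤ.- c)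
    factor = solve-∀

module _ {n} {K : SC n} (w : Fin n → Fin n → ℤ)
  (closed : ∀ {σ u v x} → K σ → u ∈ σ → v ∈ σ → x ∈ σ → w u v ℤ.+ (w v x ℤ.+ w x u) ≡ 0ℤ) where

  -- Each edge occurs in both orders, so for antisymmetric `w` this is twice the usual evaluation;
  -- no orientation has to be chosen.
  pairing : Chain n → ℤ
  pairing e = sumFin λ u → sumFin λ v → w u v ℤ.* ι v (ι u e) ∅

  pairing-cong : ∀ {c d} → (∀ ρ → c ρ ≡ d ρ) → pairing c ≡ pairing d
  pairing-cong eq = sumFin-cong λ u → sumFin-cong λ v →
      cong (w u v ℤ.*_) (Linear.≗-cong (ι-linear v) (Linear.≗-cong (ι-linear u) eq) ∅)

  pairing-+ : ∀ c d → pairing (λ ρ → c ρ ℤ.+ d ρ) ≡ pairing c ℤ.+ pairing d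
  pairing-+ c d = trans (sumFin-cong λ u → trans (sumFin-cong λ v → trans (cong (w u v ℤ.*_)
      (trans (Linear.≗-cong (ι-linear v) (Linear.additive (ι-linear u) c d) ∅)
          (Linear.additive (ι-linear v) (ι u c) (ι u d) ∅)))
      (ℤP.*-distribˡ-+ (w u v) _ _)) (sumFin-+ (λ v → w u v ℤ.* ι v (ι u c) ∅) (λ v → w u v ℤ.* ι v (ι u d) ∅)))
    (sumFin-+ (λ u → sumFin λ v → w u v ℤ.* ι v (ι u c) ∅) (λ u → sumFin λ v → w u v ℤ.* ι v (ι u d) ∅))

  pairing-edge : ∀ a b → pairing (edge a b) ≡ w a b ℤ.- w b a
  pairing-edge a b = begin
    pairing (edge a b) ≡⟨ sumFin-cong inner ⟩
    sumFin (λ u → w u b ℤ.* δ u a ℤ.+ (ℤ.- w u a) ℤ.* δ u b) ≡⟨ sumFin-+ (λ u → w u b ℤ.* δ u a)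
        (λ u → (ℤ.- w u a) ℤ.* δ u b) ⟩
    sumFin (λ u → w u b ℤ.* δ u a) ℤ.+ sumFin (λ u → (ℤ.- w u a) ℤ.* δ u b) ≡⟨ cong₂ ℤ._+_ (sum-δ (λ u → w u b) a)
        (sum-δ (λ u → ℤ.- w u a) b) ⟩
    w a b ℤ.- w b a ∎
    where
    open ≡-Reasoning
    shape₁ : ∀ w p q r s → w ℤ.* (p ℤ.* q ℤ.- r ℤ.* s) ≡ (p ℤ.* w) ℤ.* q ℤ.+ ((ℤ.- s) ℤ.* w) ℤ.* r
    shape₁ = solve-∀
    shape₂ : ∀ p q r s → p ℤ.* q ℤ.+ (ℤ.- r) ℤ.* s ≡ q ℤ.* p ℤ.+ (ℤ.- s) ℤ.* r
    shape₂ = solve-∀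
    inner : ∀ u → sumFin (λ v → w u v ℤ.* ι v (ι u (edge a b)) ∅) ≡ w u b ℤ.* δ u a ℤ.+ (ℤ.- w u a) ℤ.* δ u b
    inner u = begin
      sumFin (λ v → w u v ℤ.* ι v (ι u (edge a b)) ∅) ≡⟨ sumFin-cong
          (λ v → trans (cong (w u v ℤ.*_) (ι-ι-edge a b u v)) (shape₁ (w u v) (δ u a) (δ v b) (δ v a) (δ u b))) ⟩
      sumFin (λ v → (δ u a ℤ.* w u v) ℤ.* δ v b ℤ.+ ((ℤ.- δ u b) ℤ.* w u v) ℤ.* δ v a) ≡⟨ sumFin-+
          (λ v → (δ u a ℤ.* w u v) ℤ.* δ v b) (λ v → ((ℤ.- δ u b) ℤ.* w u v) ℤ.* δ v a) ⟩
      sumFin (λ v → (δ u a ℤ.* w u v) ℤ.* δ v b) ℤ.+ sumFin (λ v → ((ℤ.- δ u b) ℤ.* w u v) ℤ.* δ v a) ≡⟨ cong₂ ℤ._+_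
          (sum-δ (λ v → δ u a ℤ.* w u v) b) (sum-δ (λ v → (ℤ.- δ u b) ℤ.* w u v) a) ⟩
      δ u a ℤ.* w u b ℤ.+ (ℤ.- δ u b) ℤ.* w u a ≡⟨ shape₂ (δ u a) (w u b) (δ u b) (w u a) ⟩
      w u b ℤ.* δ u a ℤ.+ (ℤ.- w u a) ℤ.* δ u b ∎

  -- The coefficient of a triple is invariant under rotation. The three rotated sums are equal and
  -- add up to 0 by the cocycle condition, and ℤ has no 3-torsion.
  pairing-∂ : ∀ {e} → IsChain K 3 e → pairing (∂′ e) ≡ 0ℤ
  pairing-∂ {e} chain = trans pairing≡S
      (x+x+x≡0⇒x≡0 S (trans (cong (λ z → S ℤ.+ z)
      (cong₂ ℤ._+_ (rotate g) (trans (rotate g) (rotate λ u v x → g v x u)))) collect))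
    where
    open ≡-Reasoning
    D : Fin n → Fin n → Fin n → ℤ
    D u v x = ι x (ι v (ι u e)) ∅
    g : Fin n → Fin n → Fin n → ℤ
    g u v x = w u v ℤ.* D u v x
    ∑ : (Fin n → Fin n → Fin n → ℤ) → ℤ
    ∑ f = sumFin λ u → sumFin λ v → sumFin λ x → f u v x
    S : ℤ
    S = ∑ g
    rotate : ∀ f → ∑ f ≡ ∑ (λ u v x → f v x u)
    rotate f = trans (sumFin-cong λ v → sumFin-swap (f v)) (sumFin-swap (λ v u → sumFin λ x → f v x u))
    ∂-coefficient : ∀ u v → ι v (ι u (∂′ e)) ∅ ≡ sumFin (D u v)
    ∂-coefficient u v = begin
      ι v (ι u (∂′ e)) ∅ ≡⟨ Linear.≗-cong (ι-linear v)
          (λ ρ → trans (sym (ℤP.neg-involutive _)) (cong ℤ.-_ (sym (∂′-ι u e ρ)))) ∅ ⟩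
      ι v (λ ρ → ℤ.- ∂′ (ι u e) ρ) ∅ ≡⟨ Linear.negative (ι-linear v) (∂′ (ι u e)) ∅ ⟩
      ℤ.- ι v (∂′ (ι u e)) ∅ ≡⟨ ∂′-ι v (ι u e) ∅ ⟨
      ∂′ (ι v (ι u e)) ∅ ≡⟨ ∂′-∅ (ι v (ι u e)) ⟩
      sumFin (D u v) ∎
    pairing≡S : pairing (∂′ e) ≡ S
    pairing≡S = sumFin-cong λ u → sumFin-cong λ v →
        trans (cong (w u v ℤ.*_) (∂-coefficient u v)) (sym (sumFin-* (w u v) (D u v)))
    cyclic : ∀ u v x → D v x u ≡ D u v x
    cyclic u v x = begin
      ι u (ι x (ι v e)) ∅ ≡⟨ ι-ι u x (ι v e) ∅ ⟩
      ℤ.- ι x (ι u (ι v e)) ∅ ≡⟨ cong ℤ.-_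
          (trans (Linear.≗-cong (ι-linear x) (ι-ι u v e) ∅) (Linear.negative (ι-linear x) (ι v (ι u e)) ∅)) ⟩
      ℤ.- (ℤ.- ι x (ι v (ι u e)) ∅) ≡⟨ ℤP.neg-involutive _ ⟩
      ι x (ι v (ι u e)) ∅ ∎
    cocycle : ∀ u v x → g u v x ℤ.+ (g v x u ℤ.+ g x u v) ≡ 0ℤ
    cocycle u v x = begin
      g u v x ℤ.+ (g v x u ℤ.+ g x u v) ≡⟨ cong₂ (λ p q → g u v x ℤ.+ (w v x ℤ.* p ℤ.+ w x u ℤ.* q)) (cyclic u v x)
          (sym (cyclic x u v)) ⟩
      w u v ℤ.* D u v x ℤ.+ (w v x ℤ.* D u v x ℤ.+ w x u ℤ.* D u v x) ≡⟨ factor (w u v) (w v x) (w x u) (D u v x) ⟩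
      (w u v ℤ.+ (w v x ℤ.+ w x u)) ℤ.* D u v x ≡⟨ vanish ⟩
      0ℤ ∎
      where
      factor : ∀ a b c d → a ℤ.* d ℤ.+ (b ℤ.* d ℤ.+ c ℤ.* d) ≡ (a ℤ.+ (b ℤ.+ c)) ℤ.* d
      factor = solve-∀
      vanish : (w u v ℤ.+ (w v x ℤ.+ w x u)) ℤ.* D u v x ≡ 0ℤ
      vanish with D u v x ℤP.≟ 0ℤ
      ... | yes D≡0 = trans (cong (λ z → (w u v ℤ.+ (w v x ℤ.+ w x u)) ℤ.* z) D≡0)
            (ℤP.*-zeroʳ (w u v ℤ.+ (w v x ℤ.+ w x u)))
      ... | no D≢0 with ι-support x (ι v (ι u e)) ∅ D≢0
      ... | _ , h with ι-support v (ι u e) _ h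
      ... | _ , h′ with ι-support u e _ h′
      ... | _ , h″ = cong (ℤ._* D u v x) (closed (proj₁ (chain _ h″)) (x∈p∪⁅x⁆ _) (p⊆p∪⁅x⁆ (x∈p∪⁅x⁆ _))
            (p⊆p∪⁅x⁆ (p⊆p∪⁅x⁆ (x∈p∪⁅x⁆ ∅))))
    collect : S ℤ.+ (∑ (λ u v x → g v x u) ℤ.+ ∑ (λ u v x → g x u v)) ≡ 0ℤ
    collect = begin
      S ℤ.+ (∑ (λ u v x → g v x u) ℤ.+ ∑ (λ u v x → g x u v)) ≡⟨ cong (λ z → S ℤ.+ z)
          (∑-+ (λ u v x → g v x u) (λ u v x → g x u v)) ⟨
      S ℤ.+ ∑ (λ u v x → g v x u ℤ.+ g x u v) ≡⟨ ∑-+ g (λ u v x → g v x u ℤ.+ g x u v) ⟨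
      ∑ (λ u v x → g u v x ℤ.+ (g v x u ℤ.+ g x u v)) ≡⟨ sumFin-cong
          (λ u → trans (sumFin-cong (λ v → trans (sumFin-cong (cocycle u v)) (sumFin-0 n))) (sumFin-0 n)) ⟩
      sumFin {n} (λ _ → 0ℤ) ≡⟨ sumFin-0 n ⟩
      0ℤ ∎
      where
      ∑-+ : ∀ f h → ∑ (λ u v x → f u v x ℤ.+ h u v x) ≡ ∑ f ℤ.+ ∑ h
      ∑-+ f h = trans (sumFin-cong λ u → trans (sumFin-cong λ v → sumFin-+ (f u v) (h u v))
          (sumFin-+ (λ v → sumFin (f u v)) (λ v → sumFin (h u v))))
        (sumFin-+ (λ u → sumFin λ v → sumFin (f u v)) (λ u → sumFin λ v → sumFin (h u v)))

  module _ (d : ℕ → Fin n) where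

    polygon : ℕ → Chain n
    polygon zero _ = 0ℤ
    polygon (suc t) ρ = polygon t ρ ℤ.+ edge (d t) (d (suc t)) ρ

    winding : ℕ → ℤ
    winding zero = 0ℤ
    winding (suc t) = winding t ℤ.+ (w (d t) (d (suc t)) ℤ.- w (d (suc t)) (d t))

    pairing-polygon : ∀ t → pairing (polygon t) ≡ winding t
    pairing-polygon zero = trans (sumFin-cong λ u → trans (sumFin-cong λ v → trans (cong (w u v ℤ.*_)
        (trans (Linear.≗-cong (ι-linear v) (Linear.zero-map (ι-linear u)) ∅) (Linear.zero-map (ι-linear v) ∅)))
            (ℤP.*-zeroʳ (w u v))) (sumFin-0 n)) (sumFin-0 n)
    pairing-polygon (suc t) = trans (pairing-+ (polygon t) (edge (d t) (d (suc t))))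
        (cong₂ ℤ._+_ (pairing-polygon t) (pairing-edge (d t) (d (suc t))))

    ∂′-polygon : ∀ t ρ → ∂′ (polygon t) ρ ≡ point (d t) ρ ℤ.- point (d 0) ρ
    ∂′-polygon zero ρ = trans (Linear.zero-map ∂′-linear ρ) (sym (ℤP.+-inverseʳ (point (d 0) ρ)))
    ∂′-polygon (suc t) ρ = trans (Linear.additive ∂′-linear (polygon t) (edge (d t) (d (suc t))) ρ)
      (trans (cong₂ ℤ._+_ (∂′-polygon t ρ) (∂′-edge (d t) (d (suc t)) ρ))
          (telescope (point (d t) ρ) (point (d 0) ρ) (point (d (suc t)) ρ)))
      where
      telescope : ∀ a b c → (a ℤ.- b) ℤ.+ (c ℤ.- a) ≡ c ℤ.- b
      telescope = solve-∀

    polygon-chain : (∀ i → K (⁅ d (suc i) ⁆ ∪ ⁅ d i ⁆)) → ∀ t → IsChain K 2 (polygon t)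
    polygon-chain edges zero σ h = contradiction refl h
    polygon-chain edges (suc t) σ h with +-≢0 h
    ... | inj₁ h′ = polygon-chain edges t σ h′
    ... | inj₂ h′ with edge-support (d t) (d (suc t)) σ h′
    ... | refl , size = edges t , size

    winding⇒H₁≢0 : (∀ i → K (⁅ d (suc i) ⁆ ∪ ⁅ d i ⁆)) → ∀ t → d t ≡ d 0 → winding t ≢ 0ℤ → ¬ HomologyVanishes K 2
    winding⇒H₁≢0 edges t closes wind≢0 vanishes
      with vanishes (polygon t) (polygon-chain edges t) (λ ρ → trans (∂≡∂′ (polygon t) ρ) (trans (∂′-polygon t ρ)
             (trans (cong (λ x → point x ρ ℤ.- point (d 0) ρ) closes) (ℤP.+-inverseʳ (point (d 0) ρ)))))
    ... | e , chain , ∂e = wind≢0 (trans (sym (pairing-polygon t))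
          (trans (pairing-cong λ ρ → trans (sym (∂e ρ)) (∂≡∂′ e ρ)) (pairing-∂ chain)))

-- The link of ∅ in the skeleton is the skeleton itself, and `ρ` ensures that its top size is `s`.
top-skeleton-acyclic : ∀ {n} {K : SC n} {ρ s} → SeqCohenMacaulay K → K ρ → ∣ ρ ∣ ≡ s → ∀ m → m ≢ s →
    HomologyVanishes (PureSkel K s) m
top-skeleton-acyclic {n} {K} {ρ} {s} scm kρ size m m≢s =
    homologyVanishes-≐ link-∅ (scm s ∅ (ρ , kρ , ⊥⊆ , size) s dim m m≢s)
  where
  link-∅ : Link (PureSkel K s) ∅ ≐ PureSkel K s
  link-∅ η = (λ (_ , k) → subst (PureSkel K s) (∪-identityʳ η) k) , λ k → ∩-zeroʳ η ,
      subst (PureSkel K s) (sym (∪-identityʳ η)) k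
  dim : HasDimSize (Link (PureSkel K s) ∅) s
  dim = ρ , (proj₂ (link-∅ ρ) (ρ , kρ , ⊆-refl , size) , size) , λ τ l → let (_ , _ , τ⊆ , size′) = proj₁ (link-∅ τ) l in subst (∣ τ ∣ ≤_) size′ (p⊆q⇒∣p∣≤∣q∣ τ⊆)

-- Cycles are not sequentially Cohen-Macaulay

module _ {n} {G : Graph n} {c : ℕ → Fin n} {k} (bad : BadCycle G c (k + k)) where
  open Graph G
  open Cycle G bad
  open EvenCycle G bad {k} refl

  -- The skeleton in size `k` is two disjoint simplices, which `side` tells apart. As `2 ≤ k`, size
  -- 1 is below the top.
  even-not-seqCohenMacaulay : ¬ SeqCohenMacaulay K
  even-not-seqCohenMacaulay scm = separated⇒H₀≢0 side constant (vertex 0) (vertex 1) sides-differ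
    (top-skeleton-acyclic scm (⟨⟩-face {k} 2k≤m 0) (⟨⟩-size {k} 2k≤m 0) 1 (<⇒≢ 2≤k))
    where
    side : Fin n → ℤ
    side x = if does (x ∈? ⟨ k ⟩ 0) then 1ℤ else 0ℤ
    side-in : ∀ {x} → x ∈ ⟨ k ⟩ 0 → side x ≡ 1ℤ
    side-in {x} h = cong (λ b → if b then 1ℤ else 0ℤ) (dec-true (x ∈? ⟨ k ⟩ 0) h)
    side-out : ∀ {x} → x ∉ ⟨ k ⟩ 0 → side x ≡ 0ℤ
    side-out {x} h = cong (λ b → if b then 1ℤ else 0ℤ) (dec-false (x ∈? ⟨ k ⟩ 0) h)
    start∈ : ∀ p → c p ∈ ⟨ k ⟩ p
    start∈ p = subst (λ q → c q ∈ ⟨ k ⟩ p) (+-identityʳ p) (∈imgs⁺ (λ i → c (p + (i + i))) (≤-trans (s≤s z≤n) 2≤k))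
    disjoint-sides : ∀ {x} → x ∈ ⟨ k ⟩ 1 → x ∉ ⟨ k ⟩ 0
    disjoint-sides x∈1 x∈0 with ∈imgs⁻ (λ i → c (1 + (i + i))) k x∈1
    ... | i , i<k , refl = proj₂ (⟨⟩-face {k} 2k≤m 0) (∈imgs⁺ (λ i → c (i + i)) i<k) x∈0
          (BadCycle.consecutive bad (i + i))
    constant : ∀ {σ u v} → PureSkel K k σ → u ∈ σ → v ∈ σ → side u ≡ side v
    constant (ρ , kρ , σ⊆ρ , size) u∈ v∈ with maximum kρ size
    ... | inj₁ ρ⊆ = trans (side-in (ρ⊆ (σ⊆ρ u∈))) (sym (side-in (ρ⊆ (σ⊆ρ v∈))))
    ... | inj₂ ρ⊆ = trans (side-out (disjoint-sides (ρ⊆ (σ⊆ρ u∈)))) (sym (side-out (disjoint-sides (ρ⊆ (σ⊆ρ v∈)))))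
    vertex : ∀ p → PureSkel K k ⁅ c p ⁆
    vertex p = ⟨ k ⟩ p , ⟨⟩-face {k} 2k≤m p , (λ h → subst (_∈ ⟨ k ⟩ p) (sym (x∈⁅y⁆⇒x≡y (c p) h)) (start∈ p)) ,
        ⟨⟩-size {k} 2k≤m p
    sides-differ : side (c 0) ≢ side (c 1)
    sides-differ e with trans (sym (side-in (start∈ 0))) (trans e (side-out (disjoint-sides (start∈ 1))))
    ... | ()

-- Winding number on the band of arcs

module _ {n} {G : Graph n} {W d κ} (A : ArcCycle G W d κ) where
  open Graph G
  open ArcCycle A
  open Arcs A

  arc-size : ∀ p → ∣ arc p ∣ ≡ suc κ
  arc-size p = ∣imgs∣ (λ i → d (p + i)) (suc κ) λ i j i<j j<k → proj₁ (close-< p i<j j<k)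

  -- Distances up to `κ` fall under `close`, the next two under adjacency, and longer ones under
  -- `close` measured the other way round.
  d-distinct : ∀ i j → 1 ≤ j → j < length → d i ≢ d (i + j)
  d-distinct i j 1≤j j<len eq with j ≤? κ
  ... | yes j≤κ = proj₁ (close i j 1≤j j≤κ) eq
  ... | no j≰κ with m≤n⇒∃[o]m+o≡n (≰⇒> j≰κ)
  ... | zero , refl = ~-irrefl (subst (d i ~_) (trans (cong (λ t → d (i + t)) (sym (+-identityʳ (suc κ)))) (sym eq))
        (opposite i))
  ... | suc zero , refl = ~-irrefl (subst (d i ~_) (trans (cong (λ t → d (i + t)) (+-comm 1 (suc κ))) (sym eq))
        (opposite′ i))
  ... | suc (suc s) , refl with m≤n⇒∃[o]m+o≡n s<κ
    where
    s<κ : suc s ≤ κ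
    s<κ = s≤s⁻¹ (+-cancelˡ-≤ (suc κ) (suc (suc s)) (suc κ) (s≤s⁻¹ j<len))
  ... | t , refl = proj₁ (close (i + (suc (suc s + t) + suc (suc s))) (suc t) (s≤s z≤n) (s≤s (m≤n+m t s)))
      (trans (sym eq) (trans (sym (period i)) (cong d (shape i s t))))
    where
    shape : ∀ i s t → i + suc (suc (suc s + t) + suc (suc s + t)) ≡ i + (suc (suc s + t) + suc (suc s)) + suc t
    shape = ℕ-solve-∀

  index : Fin n → ℕ
  index x with FinP.any? {n = length} (λ i → d (toℕ i) Fin.≟ x)
  ... | yes (i , _) = toℕ i
  ... | no _ = 0

  index-d : ∀ {i} → i < length → index (d i) ≡ i
  index-d {i} i<len with FinP.any? {n = length} (λ j → d (toℕ j) Fin.≟ d i)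
  ... | no none = contradiction (fromℕ< i<len , cong d (FinP.toℕ-fromℕ< i<len)) none
  ... | yes (j , e) with <-cmp (toℕ j) i
  ... | tri≈ _ j≡i _ = j≡i
  ... | tri< j<i _ _ with m≤n⇒∃[o]m+o≡n j<i
  ... | t , refl = contradiction (trans e (cong d (sym (+-suc (toℕ j) t))))
        (d-distinct (toℕ j) (suc t) (s≤s z≤n)
        (≤-<-trans (≤-trans (m≤n+m (suc t) (toℕ j)) (≤-reflexive (+-suc (toℕ j) t))) i<len))
  index-d {i} i<len | yes (j , e) | tri> _ _ i<j with m≤n⇒∃[o]m+o≡n i<j
  ... | t , eq = contradiction (trans (sym e) (cong d (trans (sym eq) (sym (+-suc i t)))))
        (d-distinct i (suc t) (s≤s z≤n) (≤-<-trans (≤-trans (m≤n+m (suc t) i) (≤-reflexive (trans (+-suc i t) eq)))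
        (FinP.toℕ<n j)))

  -- Indices of the vertices of arc `q`: the positions `q + i` pass `length` at most once and then
  -- restart from 0.
  data Located (q : ℕ) : ℕ → Set where
    unwrapped : ∀ {i} → i ≤ κ → Located q (q + i)
    wrapped : ∀ {i b} → i ≤ κ → q + i ≡ length + b → Located q b

  locate : ∀ {q x} → q < length → x ∈ arc q → Located q (index x)
  locate {q} q<len x∈ with ∈arc⁻ q x∈
  ... | i , s≤s i≤κ , refl with q + i <? length
  ... | yes lt = subst (Located q) (sym (index-d lt)) (unwrapped i≤κ)
  ... | no ≮ with m≤n⇒∃[o]m+o≡n (≮⇒≥ ≮)
  ... | b , eq = subst (Located q) (sym
        (trans (cong index (trans (cong d (trans (sym eq) (+-comm length b))) (period b))) (index-d b<len)))
        (wrapped i≤κ (sym eq))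
    where
    b<len : b < length
    b<len = +-cancelˡ-< length b length
        (subst (_< length + length) (sym eq)
        (+-mono-<-≤ q<len (≤-trans i≤κ (≤-trans (n≤1+n κ) (m≤n+m (suc κ) (suc (suc κ)))))))

  wrapped-below : ∀ {q i b} → i ≤ κ → q + i ≡ length + b → b < q
  wrapped-below {q} {i} {b} i≤κ eq = +-cancelʳ-< i b q (begin-strict
    b + i <⟨ +-monoʳ-< b (s≤s (≤-trans i≤κ (≤-trans (n≤1+n κ) (m≤m+n (suc κ) (suc κ))))) ⟩
    b + length ≡⟨ trans (+-comm b length) (sym eq) ⟩
    q + i ∎)
    where open ≤-Reasoning

  indicator : ∀ {P : Set} → Dec P → ℤ
  indicator P? = if does P? then 1ℤ else 0ℤ

  indicator-true : ∀ {P : Set} (P? : Dec P) → P → indicator P? ≡ 1ℤ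
  indicator-true P? p = cong (λ b → if b then 1ℤ else 0ℤ) (dec-true P? p)

  indicator-false : ∀ {P : Set} (P? : Dec P) → ¬ P → indicator P? ≡ 0ℤ
  indicator-false P? ¬p = cong (λ b → if b then 1ℤ else 0ℤ) (dec-false P? ¬p)

  -- crossing counts the edges that pass the base point between d 2k and d 0; on the
  -- vertices of one arc it is the coboundary of wraps q.
  jump : ℕ → ℕ → ℤ
  jump a b = indicator (suc κ + b <? a)

  crossing : ℕ → ℕ → ℤ
  crossing a b = jump a b ℤ.- jump b a

  wraps : ℕ → ℕ → ℤ
  wraps q b = indicator (b <? q)

  jump-up : ∀ {a b} → a ≤ b + κ → jump a b ≡ 0ℤ
  jump-up {a} {b} a≤ = indicator-false (suc κ + b <? a) λ lt →
      <⇒≱ lt (≤-trans a≤ (≤-trans (≤-reflexive (+-comm b κ)) (n≤1+n _)))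

  -- Indices on the same side of the base point differ by at most `κ`, those on different sides by
  -- at least `κ + 3`; the threshold of `jump` lies between.
  crossing-local : ∀ {q a b} → Located q a → Located q b → crossing a b ≡ wraps q b ℤ.- wraps q a
  crossing-local {q} (unwrapped {i} i≤κ) (unwrapped {j} j≤κ) =
    trans (cong₂ ℤ._-_ (jump-up (near i j i≤κ)) (jump-up (near j i j≤κ)))
      (sym (cong₂ ℤ._-_ (indicator-false (q + j <? q) (≤⇒≯ (m≤m+n q j)))
          (indicator-false (q + i <? q) (≤⇒≯ (m≤m+n q i)))))
    where
    near : ∀ i j → i ≤ κ → q + i ≤ q + j + κ
    near i j i≤κ = ≤-trans (+-monoʳ-≤ q (≤-trans i≤κ (m≤n+m κ j))) (≤-reflexive (sym (+-assoc q j κ)))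
  crossing-local {q} {a} {b} (wrapped {i} i≤κ ea) (wrapped {j} j≤κ eb) =
    trans (cong₂ ℤ._-_ (jump-up (near ea eb i≤κ)) (jump-up (near eb ea j≤κ)))
      (sym (cong₂ ℤ._-_ (indicator-true (b <? q) (wrapped-below j≤κ eb))
          (indicator-true (a <? q) (wrapped-below i≤κ ea))))
    where
    near : ∀ {i j a b} → q + i ≡ length + a → q + j ≡ length + b → i ≤ κ → a ≤ b + κ
    near {i} {j} {a} {b} ea eb i≤κ = +-cancelˡ-≤ length a (b + κ) (begin
      length + a ≡⟨ ea ⟨
      q + i ≤⟨ +-monoʳ-≤ q (≤-trans i≤κ (m≤n+m κ j)) ⟩
      q + (j + κ) ≡⟨ +-assoc q j κ ⟨
      q + j + κ ≡⟨ cong (_+ κ) eb ⟩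
      length + b + κ ≡⟨ +-assoc length b κ ⟩
      length + (b + κ) ∎)
      where open ≤-Reasoning
  crossing-local {q} {b = b} (unwrapped {i} i≤κ) (wrapped {j} j≤κ eb) =
    trans (cong₂ ℤ._-_ (indicator-true (suc κ + b <? q + i) far)
        (jump-up {b} {q + i} (≤-trans (<⇒≤ (wrapped-below j≤κ eb)) (≤-trans (m≤m+n q i) (m≤m+n (q + i) κ)))))
      (sym (cong₂ ℤ._-_ (indicator-true (b <? q) (wrapped-below j≤κ eb))
          (indicator-false (q + i <? q) (≤⇒≯ (m≤m+n q i)))))
    where
    far : suc κ + b < q + i
    far = ≤-trans (+-cancelʳ-< κ (suc κ + b) q (begin-strict
      suc κ + b + κ <⟨ ≤-refl ⟩
      suc (suc κ + b + κ) ≤⟨ n≤1+n _ ⟩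
      suc (suc (suc κ + b + κ)) ≡⟨ shape κ b ⟩
      length + b ≡⟨ eb ⟨
      q + j ≤⟨ +-monoʳ-≤ q j≤κ ⟩
      q + κ ∎)) (m≤m+n q i)
      where
      open ≤-Reasoning
      shape : ∀ κ b → suc (suc (suc κ + b + κ)) ≡ suc (suc κ + suc κ) + b
      shape = ℕ-solve-∀
  crossing-local {q} {a} {b} (wrapped i≤κ ea) (unwrapped j≤κ) =
    trans (antisym (jump a b) (jump b a))
        (trans (cong ℤ.-_ (crossing-local (unwrapped j≤κ) (wrapped i≤κ ea))) (sym (antisym (wraps q b) (wraps q a))))
    where
    antisym : ∀ x y → x ℤ.- y ≡ ℤ.- (y ℤ.- x)
    antisym = solve-∀

  module _ (maximum : ∀ {ρ} → K ρ → ∣ ρ ∣ ≡ suc κ → ∃[ q ] (q < length × ρ ⊆ arc q)) where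

    -- On one arc the three crossings of a triple telescope, so `w` is a cocycle. By `2 ≤ κ`, size 2
    -- is below the top size `suc κ`; for a 5-cycle it would be the top.
    odd-not-seqCohenMacaulay : ¬ SeqCohenMacaulay K
    odd-not-seqCohenMacaulay scm = winding⇒H₁≢0 w closed d edges length (period 0) turns
      (top-skeleton-acyclic scm (arc-face 0) (arc-size 0) 2 (<⇒≢ (s≤s 2≤κ)))
      where
      w : Fin n → Fin n → ℤ
      w u v = crossing (index u) (index v)

      closed : ∀ {σ u v x} → PureSkel K (suc κ) σ → u ∈ σ → v ∈ σ → x ∈ σ → w u v ℤ.+ (w v x ℤ.+ w x u) ≡ 0ℤ
      closed {u = u} {v} {x} (ρ , kρ , σ⊆ρ , size) u∈ v∈ x∈ with maximum kρ size
      ... | q , q<len , ρ⊆ = trans (cong₂ ℤ._+_ (crossing-local lu lv)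
            (cong₂ ℤ._+_ (crossing-local lv lx) (crossing-local lx lu)))
          (telescope (wraps q (index u)) (wraps q (index v)) (wraps q (index x)))
        where
        lu = locate q<len (ρ⊆ (σ⊆ρ u∈))
        lv = locate q<len (ρ⊆ (σ⊆ρ v∈))
        lx = locate q<len (ρ⊆ (σ⊆ρ x∈))
        telescope : ∀ a b c → (b ℤ.- a) ℤ.+ ((c ℤ.- b) ℤ.+ (a ℤ.- c)) ≡ 0ℤ
        telescope = solve-∀

      edges : ∀ i → PureSkel K (suc κ) (⁅ d (suc i) ⁆ ∪ ⁅ d i ⁆)
      edges i = arc i , arc-face i , ∪⁅⁆-⊆
          (λ h → subst (_∈ arc i) (sym (x∈⁅y⁆⇒x≡y _ h))
          (subst (λ q → d q ∈ arc i) (+-comm i 1) (∈arc i (≤-trans (s≤s z≤n) 2≤κ))))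
        (subst (λ q → d q ∈ arc i) (+-identityʳ i) (∈arc i z≤n)) , arc-size i

      winding-0 : ∀ t → t < length → winding w closed d t ≡ 0ℤ
      winding-0 zero _ = refl
      winding-0 (suc t) t<len = trans (cong₂ ℤ._+_ (winding-0 t (<-trans ≤-refl t<len))
          (cong₂ ℤ._-_ (flat t (suc t) (m≤n⇒m≤1+n (m≤m+n t κ)) one-step (<-trans ≤-refl t<len) t<len)
          (flat (suc t) t one-step (m≤n⇒m≤1+n (m≤m+n t κ)) t<len (<-trans ≤-refl t<len)))) refl
        where
        one-step : suc t ≤ t + κ
        one-step = ≤-trans (≤-reflexive (+-comm 1 t)) (+-monoʳ-≤ t (≤-trans (s≤s z≤n) 2≤κ))
        flat : ∀ a b → a ≤ b + κ → b ≤ a + κ → a < length → b < length → w (d a) (d b) ≡ 0ℤ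
        flat a b a≤ b≤ a< b< = trans (cong₂ crossing (index-d a<) (index-d b<))
            (cong₂ ℤ._-_ (jump-up {a} {b} a≤) (jump-up {b} {a} b≤))

      -- Only the last edge crosses the base point, and it contributes 1 - (-1) = 2.
      turns : winding w closed d length ≢ 0ℤ
      turns e with trans (sym (trans (cong₂ ℤ._+_ (winding-0 (suc κ + suc κ) ≤-refl) (cong₂ ℤ._-_ last last′))
          refl)) e
        where
        back : index (d length) ≡ 0
        back = trans (cong index (period 0)) (index-d (s≤s z≤n))
        up : jump (suc κ + suc κ) 0 ≡ 1ℤ
        up = indicator-true (suc κ + 0 <? suc κ + suc κ) (+-monoʳ-< (suc κ) (s≤s z≤n))
        down : jump 0 (suc κ + suc κ) ≡ 0ℤ
        down = jump-up {0} {suc κ + suc κ} z≤n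
        last : w (d (suc κ + suc κ)) (d length) ≡ 1ℤ
        last = trans (cong₂ crossing (index-d ≤-refl) back) (cong₂ ℤ._-_ up down)
        last′ : w (d length) (d (suc κ + suc κ)) ≡ -1ℤ
        last′ = trans (cong₂ crossing back (index-d ≤-refl)) (cong₂ ℤ._-_ down up)
      ... | ()

-- Maximum independent sets of an odd cycle

module _ {n} {G : Graph n} {c : ℕ → Fin n} {m} (bad : BadCycle G c m) {κ} (m≡ : m ≡ suc (suc κ + suc κ)) where
  open Graph G
  open BadCycle bad
  open Cycle G bad
  open OddCycle G bad {κ} m≡
  open Arcs arcCycle using (arc)

  private
    k = suc κ

    2k≤m : k + k ≤ m
    2k≤m = ≤-trans (n≤1+n _) (≤-reflexive (sym m≡))

  -- Otherwise membership alternates and, the length being odd, reaches a neighbour of its starting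
  -- point.
  two-gaps : ∀ {ρ} → K ρ → ∃[ q ] (c q ∉ ρ × c (suc q) ∉ ρ)
  two-gaps {ρ} (_ , ind) with FinP.any? {n = m} (λ i → ¬? (c (toℕ i) ∈? ρ) ×-dec ¬? (c (suc (toℕ i)) ∈? ρ))
  ... | yes (i , gaps) = toℕ i , gaps
  ... | no none = ⊥-elim odd-period
    where
    either : ∀ q → c q ∈ ρ ⊎ c (suc q) ∈ ρ
    either q with c q ∈? ρ | c (suc q) ∈? ρ
    ... | yes h | _ = inj₁ h
    ... | no _ | yes h = inj₂ h
    ... | no h | no h′ = contradiction (fromℕ< (m%n<n q m) ,
        (h ∘ subst (_∈ ρ) (trans (cong c (FinP.toℕ-fromℕ< (m%n<n q m))) (c-% 0 q))) ,
        (h′ ∘ subst (_∈ ρ) (trans (cong (c ∘ suc) (FinP.toℕ-fromℕ< (m%n<n q m))) (c-% 1 q)))) none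
    odd-period : ⊥
    odd-period with either 0
    ... | inj₁ 0∈ = ind (alternate either ind k 0∈) 0∈ (wrap-adjacent 0 (k + k) (sym m≡))
    ... | inj₂ 1∈ = ind (subst (_∈ ρ) (trans (cong c (sym m≡)) (BadCycle.period bad 0))
          (alternate either ind {1} k 1∈)) 1∈ (consecutive 0)

  -- Apart from the gap `c q`, the `2k` remaining vertices form `k` pairs, all of them hit. As
  -- `c (suc q)` is a gap too, it is the second vertex in every pair, and these form an arc.
  odd-maximum : ∀ {ρ} → K ρ → ∣ ρ ∣ ≡ k → ∃[ q ] (q < suc (k + k) × ρ ⊆ arc q)
  odd-maximum {ρ} kρ@(ρ⊆ , ind) size with two-gaps kρ
  ... | q , q∉ , q+1∉ = reduce (to-arc (parity (suc (suc q))))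
    where
    cov : ∀ {x} → x ∈ ρ → ∃[ j ] (j < k + k × x ≡ c (suc q + j))
    cov x∈ with reach (ρ⊆ x∈) q
    ... | zero , _ , refl = contradiction (subst (λ i → c i ∈ ρ) (+-identityʳ q) x∈) q∉
    ... | suc j , j<m , e = j , s<s⁻¹ (subst (suc j <_) m≡ j<m) , trans e (cong c (+-suc q j))
    absent : ∀ i → i < k → c (suc q + (i + i)) ∉ ρ
    absent zero _ = q+1∉ ∘ subst (λ i → c i ∈ ρ) (+-identityʳ (suc q))
    absent (suc i) i<k h with pair-hit {k} 2k≤m kρ size (suc q) cov {i} (<-trans ≤-refl i<k)
    ... | inj₁ h′ = absent i (<-trans ≤-refl i<k) h′
    ... | inj₂ h′ = ind h′ (subst (λ j → c j ∈ ρ) (shape q i) h) (consecutive _)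
      where
      shape : ∀ q i → suc q + (suc i + suc i) ≡ suc (suc (suc q + (i + i)))
      shape = ℕ-solve-∀
    present : ∀ {x} → x ∈ ρ → ∃[ i ] (i < k × x ≡ c (suc (suc q) + (i + i)))
    present x∈ with cov x∈
    ... | j , j<2k , refl with parity j
    ... | inj₁ (i , refl) = contradiction x∈ (absent i (double-<⁻ j<2k))
    ... | inj₂ (i , refl) = i , double-<⁻ (<-trans ≤-refl j<2k) , cong c (+-suc (suc q) (i + i))
    to-arc : (∃[ a ] suc (suc q) ≡ a + a) ⊎ (∃[ a ] suc (suc q) ≡ suc (a + a)) →
        ∃[ a ] (∀ {x} → x ∈ ρ → ∃[ i ] (i < k × x ≡ d (a + i)))
    to-arc (inj₁ (a , e)) = a , λ x∈ → let (i , i<k , x≡) = present x∈ in i , i<k , trans x≡ (cong c (trans (cong (_+ (i + i)) e) (shape a i)))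
      where
      shape : ∀ a i → a + a + (i + i) ≡ a + i + (a + i)
      shape = ℕ-solve-∀
    -- An odd start becomes even by adding the odd length: `2(a + suc k) = (2a + 1) + m`.
    to-arc (inj₂ (a , e)) = a + suc k , λ x∈ → let (i , i<k , x≡) = present x∈ in i , i<k ,
        trans x≡ (trans (cong c (cong (_+ (i + i)) e))
            (trans (sym (BadCycle.period bad (suc (a + a) + (i + i))))
            (cong c (trans (cong (suc (a + a) + (i + i) +_) m≡) (shape a i κ)))))
      where
      shape : ∀ a i κ → suc (a + a) + (i + i) + suc (suc κ + suc κ) ≡ a + suc (suc κ) + i + (a + suc (suc κ) + i)
      shape = ℕ-solve-∀
    reduce : ∃[ a ] (∀ {x} → x ∈ ρ → ∃[ i ] (i < k × x ≡ d (a + i))) → ∃[ q ] (q < suc (k + k) × ρ ⊆ arc q)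
    reduce (a , h) = a % m , subst (a % m <_) m≡ (m%n<n a m) , λ x∈ → let (i , i<k , x≡) = h x∈ in
      subst (_∈ arc (a % m)) (sym (trans x≡ (d-% i))) (∈imgs⁺ (λ i → d (a % m + i)) i<k)
      where
      d-% : ∀ i → d (a + i) ≡ d (a % m + i)
      d-% i = trans (cong (λ a → c (a + i + (a + i))) (m≡m%n+[m/n]*n a m))
          (trans (cong c (shape (a % m) (a / m) i m)) (period* (a / m + a / m) (a % m + i + (a % m + i))))
        where
        shape : ∀ r q i m → r + q * m + i + (r + q * m + i) ≡ r + i + (r + i) + (q + q) * m
        shape = ℕ-solve-∀

-- Obstructions

module _ {n} (G : Graph n) {c : ℕ → Fin n} {m} (bad : BadCycle G c m) where
  open Cycle G bad using (K; 1≤m)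

  half : (∃[ k ] m ≡ k + k) ⊎ (∃[ κ ] m ≡ suc (suc κ + suc κ))
  half with parity m
  ... | inj₁ even = inj₁ even
  ... | inj₂ (suc κ , e) = inj₂ (κ , e)
  ... | inj₂ (zero , e) = contradiction (subst (4 ≤_) e (BadCycle.4≤m bad)) λ { (s≤s ()) }

  badCycle-not-partitionable : ¬ Partitionable K
  badCycle-not-partitionable with half
  ... | inj₁ (k , m≡) = EvenCycle.not-partitionable G bad {k} m≡
  ... | inj₂ (κ , m≡) = not-partitionable-odd (OddCycle.arcCycle G bad {κ} m≡)

  badCycle-not-seqCohenMacaulay : ¬ SeqCohenMacaulay K
  badCycle-not-seqCohenMacaulay with half
  ... | inj₁ (k , refl) = even-not-seqCohenMacaulay {k = k} bad
  ... | inj₂ (κ , m≡) = odd-not-seqCohenMacaulay (OddCycle.arcCycle G bad {κ} m≡) (odd-maximum bad {κ} m≡)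

module Obstructions {n} (Γ : SC n) (Γ? : Decidable Γ) (cl : Closed Γ) (flag : IsFlag Γ) where
  open Flag Γ Γ? cl flag

  -- P holds for the induced subcomplexes without bad cycles and fails for the bad
  -- cycles themselves; this determines the obstructions to P inside Γ.
  record ExcludesBadCycles (P : SC n → Set) : Set₁ where
    field
      respects : ∀ {K L : SC n} → K ≐ L → P K → P L
      holds : ∀ {W} → W ⊆ vertices → NoBadCycle incompatibility W → P (Induced Γ W)
      fails : ∀ {c m} → BadCycle incompatibility c m → imgs c m ⊆ vertices → ¬ P (Induced Γ (imgs c m))

  open ExcludesBadCycles

  Γ≐induced : ∀ {W} → vertices ⊆ W → Γ ≐ Induced Γ W
  Γ≐induced V⊆W σ = (λ γ → V⊆W ∘ face⇒vertices γ , γ) , proj₂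

  -- A bad cycle on fewer than all vertices would have P by minimality, so every bad cycle spans Γ
  -- and proper subsets satisfy Q. If Γ had Q, no cycle could span it either, and without bad cycles
  -- Γ would have P.
  obstruction-transfer : ∀ {P Q : SC n → Set} → ExcludesBadCycles P → ExcludesBadCycles Q → Obstruction P Γ →
      Obstruction Q Γ
  obstruction-transfer {P} {Q} p q (¬PΓ , proper) = ¬QΓ , λ W (W-vertices , v , v-vertex , v∉W) →
      holds q (∈⟦⟧⁺ vertex? ∘ W-vertices) λ c m bad c∈W →
        let image⊆W = ⊆-image c m c∈W in
        fails p bad (∈⟦⟧⁺ vertex? ∘ W-vertices ∘ image⊆W)
            (proper _ (W-vertices ∘ image⊆W , v , v-vertex , v∉W ∘ image⊆W))
    where
    ⊆-image : ∀ c m {W} → (∀ i → c i ∈ W) → imgs c m ⊆ W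
    ⊆-image c m {W} c∈W x∈ = let (i , _ , x≡) = ∈imgs⁻ c m x∈ in subst (_∈ W) (sym x≡) (c∈W i)

    ¬QΓ : ¬ Q Γ
    ¬QΓ qΓ = ¬PΓ (respects p (≐-sym (Γ≐induced ⊆-refl)) (holds p ⊆-refl noBad))
      where
      noBad : NoBadCycle incompatibility vertices
      noBad c m bad c∈V with vertices ⊆? imgs c m
      ... | yes V⊆ = fails q bad (⊆-image c m c∈V) (respects q (Γ≐induced V⊆) qΓ)
      ... | no V⊈ with ⊈⇒∃ (imgs c m) vertices V⊈
      ... | v , v∈V , v∉ = fails p bad (⊆-image c m c∈V)
          (proper (imgs c m) (∈⟦⟧⁻ vertex? ∘ ⊆-image c m c∈V , v , ∈⟦⟧⁻ vertex? v∈V , v∉))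

  induced≐independence : ∀ {W} → W ⊆ vertices → Induced Γ W ≐ IndependenceComplex incompatibility W
  induced≐independence W⊆V σ = map₂ face⇒independent , λ (σ⊆W , ind) → σ⊆W , independent⇒face (W⊆V ∘ σ⊆W) ind

  partitionable-excludes : ExcludesBadCycles Partitionable
  partitionable-excludes = record
    { respects = partitionable-≐
    ; holds = noBadCycle⇒partitionable
    ; fails = λ bad image⊆V → badCycle-not-partitionable incompatibility bad ∘ partitionable-≐
        (induced≐independence image⊆V) }

  shellable-excludes : ExcludesBadCycles Shellable
  shellable-excludes = record
    { respects = shellable-≐
    ; holds = noBadCycle⇒shellable
    ; fails = λ {c} {m} bad image⊆V → fails partitionable-excludes bad image⊆V ∘ shellable⇒partitionable
        (induced? (imgs c m)) (induced-closed (imgs c m)) }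

  seqCohenMacaulay-excludes : ExcludesBadCycles SeqCohenMacaulay
  seqCohenMacaulay-excludes = record
    { respects = seqCohenMacaulay-≐
    ; holds = noBadCycle⇒seqCohenMacaulay
    ; fails = λ bad image⊆V → badCycle-not-seqCohenMacaulay incompatibility bad ∘ seqCohenMacaulay-≐
        (induced≐independence image⊆V) }

theorem3p13 : (n : ℕ) (Γ : SC n) → (∀ (σ : Subset n) → Dec (Γ σ)) →
    IsComplex Γ → IsFlag Γ →
    (Obstruction Shellable Γ ⇔ Obstruction Partitionable Γ) ×
    (Obstruction Partitionable Γ ⇔ Obstruction SeqCohenMacaulay Γ)
theorem3p13 n Γ Γ? (_ , cl) flag =
  mk⇔ (obstruction-transfer shellable-excludes partitionable-excludes)
      (obstruction-transfer partitionable-excludes shellable-excludes) ,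
  mk⇔ (obstruction-transfer partitionable-excludes seqCohenMacaulay-excludes)
      (obstruction-transfer seqCohenMacaulay-excludes partitionable-excludes)
  where open Obstructions Γ Γ? cl flag
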